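{- Let $\mathcal{T}$ be a good set of weighted trees. Then the $W$-polynomial distinguishes non-isomorphic members of $\mathcal{T}$: for all $(T,w),(T',w')\in\mathcal{T}$, if $W_{(T,w)}=W_{(T',w')}$, then $(T,w)$ and $(T',w')$ are isomorphic as weighted trees.
   Context: All graphs are finite. A weighted graph is a graph $G=(V,E)$ together with a function $w\colon V\to\mathbf{Z}^+$ (positive integers). A weighted tree is a weighted graph whose underlying graph is a tree. For $V'\subseteq V$, $w(V')=\sum_{v\in V'}w(v)$; for a subtree $S$ write $w(S)=w(V(S))$. $W$-polynomial: for $A\subseteq E$ let $c(A)$ be the number of connected components of the spanning subgraph $(V,A)$, let $n_1\ge\dots\ge n_{c(A)}$ be the weights of the vertex sets of these components, and let $x(A)=\prod_{i=1}^{c(A)}x_{n_i}$, where $x_1,x_2,\dots$ are indeterminates. Then $$W_G(z,x_1,x_2,\dots)=\sum_{A\subseteq E}x(A)(z-1)^{|A|-|V|+c(A)}.$$ (For a tree the exponent of $z-1$ is always $0$.) Two weighted graphs are isomorphic if there is a graph isomorphism between them preserving vertex weights. Two rooted weighted trees are r-isomorphic if there is a graph isomorphism between them preserving the vertex weights and mapping root to root. For a weighted tree $(T,w)$, $\mathrm{Ex}(T)$ denotes the multiset of all vertex weights of $T$ (with multiplicities). A shape of $(T,w)$ is a rooted weighted tree $(S,w_S)$ such that $2\le |V(S)|\le |V(T)|-2$ and there is an edge $e\in E(T)$ such that $S$ is one of the two components of $T-e$; $S$ is rooted at the end-vertex of $e$ that it contains, and $w_S$ is the restriction of $w$ to $V(S)$.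 A leaf is a vertex of degree one. A set $\mathcal{T}$ of weighted trees is good if it satisfies the following. (1) For every $(T,w)\in\mathcal{T}$: if a vertex of $T$ is adjacent to a leaf, then all its neighbours but possibly one are leaves. (2) For every $(T,w)\in\mathcal{T}$: if a vertex $v$ of $T$ is a leaf or has a neighbour that is a leaf, then $w(v)=1$. (3) For all $(T,w),(T',w')\in\mathcal{T}$: if $S$ is a shape of $T$ with $w(S)\le w(T)/2$ and $S'$ is a shape of $T'$ with $\mathrm{Ex}(S')=\mathrm{Ex}(S)$, then $S'$ and $S$ are r-isomorphic. -}

module Defs where

open import Data.Bool.Base using (Bool; T)
open import Data.Bool.Properties using (T?)
open import Data.Fin.Base using (Fin)
open import Data.Fin.Properties using (_≟_; _<?_)
open import Data.Integer.Base as ℤ using (ℤ; 0ℤ; 1ℤ; -1ℤ)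
open import Data.List.Base
  using (List; []; _∷_; _++_; [_]; map; filter; foldr; length; allFin;
         deduplicate; cartesianProduct; cartesianProductWith)
open import Data.List.Membership.Propositional using (_∈_)
open import Data.List.Membership.Propositional.Properties using (∈-∃++)
import Data.List.Membership.DecPropositional as DecMembership
open import Data.List.Relation.Binary.Permutation.Propositional
  using (_↭_; prep; ↭-refl; ↭-sym; ↭-trans)
open import Data.List.Relation.Binary.Permutation.Propositional.Properties
  using (shift; drop-∷; ∈-resp-↭; ¬x∷xs↭[])
open import Data.List.Relation.Unary.Any using (here; there)
open import Data.List.Relation.Unary.Linked using (Linked)
open import Data.List.Relation.Unary.Unique.Propositional using (Unique)
open import Data.Nat.Base using (ℕ; zero; suc; _+_; _*_; _∸_; _≤_)
open import Data.Nat.ListAction using (sum)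
import Data.Nat.Properties as ℕ
open import Data.Product.Base using (∃; _×_; _,_)
open import Data.Sum.Base using (_⊎_; inj₁; inj₂)
open import Function.Base using (_∘_)
open import Function.Bundles using (_↔_; _⇔_; Inverse)
open import Function.Definitions using (Injective)
open import Level using (Level; 0ℓ)
open import Relation.Binary.Construct.Closure.ReflexiveTransitive
  using (Star; ε; _◅_; _◅◅_) renaming (map to mapStar)
open import Relation.Binary.Core using (Rel)
open import Relation.Binary.Definitions using (Symmetric; Irreflexive; DecidableEquality; Decidable)
open import Relation.Binary.PropositionalEquality using (_≡_; refl; cong)
open import Relation.Nullary using (¬_; Dec; yes; no)
open import Relation.Nullary.Decidable using (map′; _×-dec_; _⊎-dec_)
open import Relation.Unary using (Pred)

private
  variable
    n : ℕ

------------------------------------------------------------------------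
-- Graphs and trees

record Graph : Set where
  field
    order : ℕ

  V : Set
  V = Fin order

  field
    adj : V → V → Bool

  Adj : Rel V 0ℓ
  Adj u v = T (adj u v)

  field
    symmetric   : Symmetric Adj
    irreflexive : Irreflexive _≡_ Adj

  vertices : List V
  vertices = allFin order

  -- Every edge occurs exactly once, as the pair (u , v) with u < v.
  edges : List (V × V)
  edges = filter (λ (u , v) → (u <? v) ×-dec T? (adj u v))
                 (cartesianProduct vertices vertices)

  degree : V → ℕ
  degree v = length (filter (λ u → T? (adj v u)) vertices)

  Leaf : V → Set
  Leaf v = degree v ≡ 1

  HasLeafNeighbour : V → Set
  HasLeafNeighbour v = ∃ λ u → Adj v u × Leaf u

  Connected : Set
  Connected = ∀ u v → Star Adj u v

  -- The cycle v, v₁, …, vₖ, v with k ≥ 2 and distinct vertices v, v₁, …, vₖ.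
  Cycle : V → List V → Set
  Cycle v vs = 2 ≤ length vs × Unique (v ∷ vs) × Linked Adj (v ∷ vs ++ [ v ])

  Acyclic : Set
  Acyclic = ∀ v vs → ¬ Cycle v vs

  -- Adjacency in the graph obtained by deleting the edge between u and v.
  AdjWithout : V → V → Rel V 0ℓ
  AdjWithout u v a b = Adj a b × ¬ ((a ≡ u × b ≡ v) ⊎ (a ≡ v × b ≡ u))

  record IsTree : Set where
    field
      nonempty  : 1 ≤ order
      connected : Connected
      acyclic   : Acyclic

record WeightedGraph : Set where
  field
    graph : Graph
  open Graph graph public
  field
    w          : V → ℕ
    w-positive : ∀ v → 1 ≤ w v

  weight : List V → ℕ
  weight = sum ∘ map w

  totalWeight : ℕ
  totalWeight = weight vertices

  -- A multiset, represented by a list; multisets are compared with _↭_.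
  Ex : List ℕ
  Ex = map w vertices

record WeightedTree : Set where
  field
    weightedGraph : WeightedGraph
  open WeightedGraph weightedGraph public
  field
    isTree : IsTree

record RootedWeightedTree : Set where
  field
    tree : WeightedTree
  open WeightedTree tree public
  field
    root : V

record _≅_ (G H : WeightedGraph) : Set where
  private
    module G = WeightedGraph G
    module H = WeightedGraph H
  field
    bijection : G.V ↔ H.V
  open Inverse bijection public using (to; from)
  field
    adjacency : ∀ u v → G.Adj u v ⇔ H.Adj (to u) (to v)
    weights   : ∀ v → H.w (to v) ≡ G.w v

infix 4 _≅_ _≅ᵣ_

record _≅ᵣ_ (R S : RootedWeightedTree) : Set where
  private
    module R = RootedWeightedTree R
    module S = RootedWeightedTree S
  field
    iso : R.weightedGraph ≅ S.weightedGraph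
  open _≅_ iso public
  field
    roots : to R.root ≡ S.root

------------------------------------------------------------------------
-- Connected components of a spanning subgraph, given by its list of edges

Joins : List (Fin n × Fin n) → Rel (Fin n) 0ℓ
Joins A u v = (u , v) ∈ A ⊎ (v , u) ∈ A

SameComponent : List (Fin n × Fin n) → Rel (Fin n) 0ℓ
SameComponent A = Star (Joins A)

private
  Via : Fin n × Fin n → List (Fin n × Fin n) → Rel (Fin n) 0ℓ
  Via (a , b) A u v =
    SameComponent A u v ⊎
    (SameComponent A u a × SameComponent A b v) ⊎
    (SameComponent A u b × SameComponent A a v)

  weaken : ∀ {e} {A : List (Fin n × Fin n)} {u v} →
           SameComponent A u v → SameComponent (e ∷ A) u v
  weaken = mapStar λ { (inj₁ p) → inj₁ (there p) ; (inj₂ p) → inj₂ (there p) }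

  via⇒ : ∀ {e} {A : List (Fin n × Fin n)} {u v} →
         Via e A u v → SameComponent (e ∷ A) u v
  via⇒ (inj₁ p)              = weaken p
  via⇒ (inj₂ (inj₁ (p , q))) = weaken p ◅◅ (inj₁ (here refl) ◅ weaken q)
  via⇒ (inj₂ (inj₂ (p , q))) = weaken p ◅◅ (inj₂ (here refl) ◅ weaken q)

  extend : ∀ {e} {A : List (Fin n × Fin n)} {u v t} →
           Joins A u v → Via e A v t → Via e A u t
  extend s (inj₁ p)              = inj₁ (s ◅ p)
  extend s (inj₂ (inj₁ (p , q))) = inj₂ (inj₁ (s ◅ p , q))
  extend s (inj₂ (inj₂ (p , q))) = inj₂ (inj₂ (s ◅ p , q))

  via⇐ : ∀ {e} {A : List (Fin n × Fin n)} {u v} →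
         SameComponent (e ∷ A) u v → Via e A u v
  via⇐ ε = inj₁ ε
  via⇐ (inj₁ (there s) ◅ p) = extend (inj₁ s) (via⇐ p)
  via⇐ (inj₂ (there s) ◅ p) = extend (inj₂ s) (via⇐ p)
  via⇐ (inj₁ (here refl) ◅ p) with via⇐ p
  ... | inj₁ q              = inj₂ (inj₁ (ε , q))
  ... | inj₂ (inj₁ (_ , q)) = inj₂ (inj₁ (ε , q))
  ... | inj₂ (inj₂ (_ , q)) = inj₁ q
  via⇐ (inj₂ (here refl) ◅ p) with via⇐ p
  ... | inj₁ q              = inj₂ (inj₂ (ε , q))
  ... | inj₂ (inj₁ (_ , q)) = inj₁ q
  ... | inj₂ (inj₂ (_ , q)) = inj₂ (inj₂ (ε , q))

sameComponent? : (A : List (Fin n × Fin n)) → Decidable (SameComponent A)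
sameComponent? [] u v = map′ (λ { refl → ε }) (λ { ε → refl ; (inj₁ () ◅ _) ; (inj₂ () ◅ _) }) (u ≟ v)
sameComponent? ((a , b) ∷ A) u v = map′ via⇒ via⇐
  (sameComponent? A u v ⊎-dec
   (sameComponent? A u a ×-dec sameComponent? A b v) ⊎-dec
   (sameComponent? A u b ×-dec sameComponent? A a v))

-- The vertex sets of the components, one for each of the representatives
-- selected by deduplicate.
components : List (Fin n × Fin n) → List (List (Fin n))
components {n} A =
  map (λ r → filter (sameComponent? A r) (allFin n))
      (deduplicate (sameComponent? A) (allFin n))

------------------------------------------------------------------------
-- Polynomials over ℤ in the indeterminates z, x₁, x₂, …

data Var : Set where
  z : Var
  x : ℕ → Var

-- A monomial is a product of indeterminates, up to permutation of the factors.
Monomial : Set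
Monomial = List Var

_≟ᵛ_ : DecidableEquality Var
z   ≟ᵛ z   = yes refl
z   ≟ᵛ x _ = no λ ()
x _ ≟ᵛ z   = no λ ()
x i ≟ᵛ x j = map′ (cong x) (λ { refl → refl }) (i ℕ.≟ j)

_↭?_ : (m m′ : Monomial) → Dec (m ↭ m′)
[]      ↭? []      = yes ↭-refl
[]      ↭? (_ ∷ _) = no (¬x∷xs↭[] ∘ ↭-sym)
(v ∷ m) ↭? m′ with DecMembership._∈?_ _≟ᵛ_ v m′
... | no v∉m′ = no λ p → v∉m′ (∈-resp-↭ p (here refl))
... | yes v∈m′ with ∈-∃++ v∈m′
...   | as , bs , refl =
  map′ (λ p → ↭-trans (prep v p) (↭-sym (shift v as bs)))
       (λ p → drop-∷ (↭-trans p (shift v as bs)))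
       (m ↭? (as ++ bs))

-- A formal sum of terms; the same monomial may occur in several terms.
Polynomial : Set
Polynomial = List (ℤ × Monomial)

coefficient : Polynomial → Monomial → ℤ
coefficient p m =
  foldr (λ (c , _) s → c ℤ.+ s) 0ℤ (filter (λ (_ , m′) → m′ ↭? m) p)

infix 4 _≈ₚ_

_≈ₚ_ : Rel Polynomial 0ℓ
p ≈ₚ q = ∀ m → coefficient p m ≡ coefficient q m

term : ℤ → Monomial → Polynomial
term c m = [ (c , m) ]

infixl 6 _+ₚ_
infixl 7 _*ₚ_
infixr 8 _^ₚ_

_+ₚ_ : Polynomial → Polynomial → Polynomial
_+ₚ_ = _++_

_*ₚ_ : Polynomial → Polynomial → Polynomial
_*ₚ_ = cartesianProductWith λ (c , m) (d , m′) → (c ℤ.* d , m ++ m′)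

_^ₚ_ : Polynomial → ℕ → Polynomial
p ^ₚ zero  = term 1ℤ []
p ^ₚ suc k = p *ₚ (p ^ₚ k)

sumₚ : List Polynomial → Polynomial
sumₚ = foldr _+ₚ_ []

------------------------------------------------------------------------
-- The W-polynomial

subsets : {A : Set} → List A → List (List A)
subsets []       = [ [] ]
subsets (e ∷ es) = subsets es ++ map (e ∷_) (subsets es)

module _ (G : WeightedGraph) where
  open WeightedGraph G

  -- Truncated subtraction is harmless: |A| + c(A) ≥ |V| for every A.
  rankExponent : List (V × V) → ℕ
  rankExponent A = length A + length (components A) ∸ order

  x⟨_⟩ : List (V × V) → Polynomial
  x⟨ A ⟩ = term 1ℤ (map (x ∘ weight) (components A))

  W : Polynomial
  W = sumₚ (map (λ A → x⟨ A ⟩ *ₚ (term 1ℤ [ z ] +ₚ term -1ℤ []) ^ₚ rankExponent A)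
                (subsets edges))

------------------------------------------------------------------------
-- Shapes and good sets

-- S is, up to renaming of vertices along the embedding, the component of
-- T − {end , other} containing end.
record IsShape (S : RootedWeightedTree) (T : WeightedTree) : Set where
  private
    module S = RootedWeightedTree S
    module T = WeightedTree T
  field
    size-lower : 2 ≤ S.order
    size-upper : S.order + 2 ≤ T.order
    end other  : T.V
    edge       : T.Adj end other
    embed      : S.V → T.V
    injective  : Injective _≡_ _≡_ embed
    image      : ∀ v → (∃ λ a → embed a ≡ v) ⇔ Star (T.AdjWithout end other) end v
    adjacency  : ∀ a b → S.Adj a b ⇔ T.AdjWithout end other (embed a) (embed b)
    weights    : ∀ a → S.w a ≡ T.w (embed a)
    roots      : embed S.root ≡ end

record Good {ℓ : Level} (𝒯 : Pred WeightedTree ℓ) : Set ℓ where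
  field
    neighbours-of-leaf-neighbours :
      ∀ {T} → 𝒯 T → let open WeightedTree T in
      ∀ v → HasLeafNeighbour v →
      ∀ a b → Adj v a → Adj v b → ¬ Leaf a → ¬ Leaf b → a ≡ b
    unit-weights :
      ∀ {T} → 𝒯 T → let open WeightedTree T in
      ∀ v → Leaf v ⊎ HasLeafNeighbour v → w v ≡ 1
    shapes-determined :
      ∀ {T T′} → 𝒯 T → 𝒯 T′ →
      ∀ {S S′} → IsShape S T → IsShape S′ T′ →
      let module T  = WeightedTree T
          module S  = RootedWeightedTree S
          module S′ = RootedWeightedTree S′ in
      2 * S.totalWeight ≤ T.totalWeight →
      S′.Ex ↭ S.Ex → S′ ≅ᵣ S

{-# OPTIONS --safe #-}
-- Since a tree has no cycles, its W-polynomial is a list of partitions of the total weight N, one for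
-- each set of edges. Delete from such a partition one part, of weight at least N/2: that part comes
-- from the component of a centroid (or from one of the two halves, if some edge halves the tree), so
-- the remaining parts are a partition of some disjoint branches of weight at most N/2. Counting these
-- remainders gives, up to degree N/2, the product over the maximal branches t of whole t + rest t,
-- where whole t lists all partitions of t, and rest t is what they leave when the part of the root is
-- removed. This product determines the branches of weight at most d, by induction on d: in degree
-- d + 1, the new branches contribute just the sum of their whole t. The longest partition in this sum
-- is the multiset of vertex weights of a branch with most vertices; as the set of trees is good, it
-- determines that branch, which can then be cancelled from the sum.
module Submission where

open import Data.Bool.Base using (true; false; T; if_then_else_)
open import Data.Bool.Properties using (T?)
open import Data.Empty using (⊥; ⊥-elim)
open import Data.Fin.Base using (Fin; zero; suc)
import Data.Fin.Base as Fin
import Data.Fin.Properties as Fin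
import Data.Integer.Base as ℤ
import Data.Integer.Properties as ℤ
open import Data.List.Base
  using (List; []; _∷_; _++_; [_]; map; filter; foldr; length; allFin; lookup; concat; concatMap; deduplicate;
      cartesianProduct; cartesianProductWith)
open import Data.List.Membership.Propositional using (_∈_; _∉_; find; lose)
open import Data.List.Membership.Propositional.Properties
open import Data.List.Properties
  using (++-assoc; ++-identityʳ; map-++; map-∘; map-cong; map-id; length-++; length-map;
      cartesianProductWith-distribʳ-++; cartesianProductWith-zeroʳ; filter-≐)
import Data.List.Properties as List
open import Data.List.Relation.Binary.Permutation.Homogeneous using (Permutation)
import Data.List.Relation.Binary.Permutation.Homogeneous as H
open import Data.List.Relation.Binary.Permutation.Propositional using
    (_↭_; ↭-refl; ↭-sym; ↭-trans; ↭-prep; ↭-swap; ↭-reflexive)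
import Data.List.Relation.Binary.Permutation.Propositional as ↭
import Data.List.Relation.Binary.Permutation.Propositional.Properties as ↭ₚ
import Data.List.Relation.Binary.Permutation.Setoid.Properties as Hₚ
open import Data.List.Relation.Binary.Pointwise.Base using (Pointwise; []; _∷_)
import Data.List.Relation.Binary.Pointwise.Properties as Pointwise
open import Data.List.Relation.Unary.All as All using (All; []; _∷_)
import Data.List.Relation.Unary.All.Properties as All
open import Data.List.Relation.Unary.AllPairs using (AllPairs; []; _∷_)
import Data.List.Relation.Unary.AllPairs.Properties as AllPairs
open import Data.List.Relation.Unary.Any as Any using (Any; here; there)
import Data.List.Relation.Unary.Any.Properties as Any
open import Data.List.Relation.Unary.Linked using (Linked; []; [-]; _∷_)
import Data.List.Relation.Unary.Linked.Properties as Linked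
open import Data.List.Relation.Unary.Unique.Propositional using (Unique)
import Data.List.Relation.Unary.Unique.Propositional.Properties as Unique
open import Data.Maybe.Base using (Maybe; just; nothing)
import Data.Maybe.Properties as Maybe
open import Data.Nat.Base using (ℕ; zero; suc; pred; _+_; _*_; _∸_; _≤_; _<_; z≤n; s≤s; ⌊_/2⌋)
open import Data.Nat.ListAction using (sum)
import Data.Nat.ListAction.Properties as ℕ
import Data.Nat.Properties as ℕ
open import Data.Nat.Solver using (module +-*-Solver)
open import Data.Product.Base using (∃; _×_; _,_; proj₁; proj₂; uncurry; map₁; map₂)
open import Data.Sum.Base using (_⊎_; inj₁; inj₂)
open import Function.Base using (_∘_; id; case_of_)
open import Function.Bundles using (mk⇔; mk↔ₛ′; Equivalence; Inverse)
open import Function.Definitions using (Injective)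
open import Level using (Level; 0ℓ)
open import Relation.Binary.Bundles using (Setoid)
open import Relation.Binary.Construct.Closure.ReflexiveTransitive using (Star; ε; _◅_; _◅◅_)
import Relation.Binary.Construct.Closure.ReflexiveTransitive as Star
open import Relation.Binary.Core using (Rel)
open import Relation.Binary.Definitions using (Symmetric; tri<; tri≈; tri>)
open import Relation.Binary.PropositionalEquality
  using (_≡_; _≢_; refl; sym; trans; cong; cong₂; subst; subst₂; module ≡-Reasoning)
open import Relation.Nullary using (¬_; Dec; yes; no; contradiction; ¬?)
open import Relation.Nullary.Decidable using (map′; does; dec-true; dec-false; _×-dec_)
open import Relation.Unary using (Pred)
open import Defs

-- `W` does not tell which part of a partition comes from which component. Half of the weight is the
-- threshold that repairs this: seen from a centroid, every component avoiding the root is lighter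
-- than N/2, so deleting its part leaves a degree above N/2, where nothing is compared. Goodness
-- controls branches up to just this weight. Hence polynomials are compared only modulo terms of
-- degree above some d.
--
-- A branch t enters the product through `whole t`, of degree w(t), and through `rest t`, which has
-- constant term 1 and is itself the product over the children of t. So a branch heavier than d is
-- visible up to degree d only through its children, and in degree d + 1 each new `whole t` meets
-- nothing but constant terms: this turns the product into a sum.
--
-- In that sum a branch with most vertices has to come first, because the weights of a branch with
-- fewer vertices may also arise as a coarser partition of another branch.

private
  variable
    ℓ : Level
    A B C : Set

-- Polynomials as lists of partitions, compared up to a degree

Partition : Set
Partition = List ℕ

map-x-↭⁻ : {m μ : Partition} → map x m ↭ map x μ → m ↭ μ
map-x-↭⁻ {m} {μ} p with ↭ₚ.↭-map-inv x p
... | ys , eq , q = ↭-trans q (↭-reflexive (sym (map-x-injective eq)))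
  where
  map-x-injective : ∀ {m μ : Partition} → map x m ≡ map x μ → m ≡ μ
  map-x-injective = List.map-injective λ { refl → refl }

-- Borrows the decision procedure for monomials through the injection `x`.
_≟ₚ_ : (m μ : Partition) → Dec (m ↭ μ)
m ≟ₚ μ = map′ map-x-↭⁻ (↭ₚ.map⁺ x) (map x m ↭? map x μ)

ind : {P : Set} → Dec P → ℕ
ind P? = if does P? then 1 else 0

ind-cong : {P Q : Set} (P? : Dec P) (Q? : Dec Q) → (P → Q) → (Q → P) → ind P? ≡ ind Q?
ind-cong (yes p) (yes q) f g = refl
ind-cong (yes p) (no ¬q) f g = contradiction (f p) ¬q
ind-cong (no ¬p) (yes q) f g = contradiction (g q) ¬p
ind-cong (no ¬p) (no ¬q) f g = refl

ind-yes : {P : Set} (P? : Dec P) → P → ind P? ≡ 1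
ind-yes P? p = cong (if_then 1 else 0) (dec-true P? p)

ind-no : {P : Set} (P? : Dec P) → ¬ P → ind P? ≡ 0
ind-no P? ¬p = cong (if_then 1 else 0) (dec-false P? ¬p)

-- Polynomials with natural coefficients, as lists of monomials; the exponents of a monomial are
-- the multiplicities in a partition, so its degree is the sum of that partition.
Poly : Set
Poly = List Partition

count : Poly → Partition → ℕ
count []      μ = 0
count (m ∷ p) μ = ind (m ≟ₚ μ) + count p μ

infix 4 _≈[_]_
-- Congruence modulo terms of degree above `d`. A record and not a plain function type, so that `p`,
-- `d` and `q` can be inferred from a proof.
record _≈[_]_ (p : Poly) (d : ℕ) (q : Poly) : Set where
  field
    counts : ∀ μ → sum μ ≤ d → count p μ ≡ count q μ
open _≈[_]_

count-++ : ∀ p q μ → count (p ++ q) μ ≡ count p μ + count q μ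
count-++ []      q μ = refl
count-++ (m ∷ p) q μ = trans (cong (ind (m ≟ₚ μ) +_) (count-++ p q μ)) (sym (ℕ.+-assoc (ind (m ≟ₚ μ)) _ _))

count-↭ : ∀ {m m′} μ → m ↭ m′ → ind (m ≟ₚ μ) ≡ ind (m′ ≟ₚ μ)
count-↭ μ p = ind-cong (_ ≟ₚ μ) (_ ≟ₚ μ) (↭-trans (↭-sym p)) (↭-trans p)

module _ {d : ℕ} where

  ≈-refl : ∀ {p} → p ≈[ d ] p
  ≈-refl .counts _ _ = refl

  ≈-reflexive : ∀ {p q} → p ≡ q → p ≈[ d ] q
  ≈-reflexive refl = ≈-refl

  ≈-sym : ∀ {p q} → p ≈[ d ] q → q ≈[ d ] p
  ≈-sym e .counts μ b = sym (e .counts μ b)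

  ≈-trans : ∀ {p q r} → p ≈[ d ] q → q ≈[ d ] r → p ≈[ d ] r
  ≈-trans e f .counts μ b = trans (e .counts μ b) (f .counts μ b)

  ++-cong : ∀ {p p′ q q′} → p ≈[ d ] p′ → q ≈[ d ] q′ → p ++ q ≈[ d ] p′ ++ q′
  ++-cong {p} {p′} {q} {q′} e f .counts μ b = trans (count-++ p q μ)
      (trans (cong₂ _+_ (e .counts μ b) (f .counts μ b)) (sym (count-++ p′ q′ μ)))

  ++-comm : ∀ p q → p ++ q ≈[ d ] q ++ p
  ++-comm p q .counts μ b = trans (count-++ p q μ) (trans (ℕ.+-comm (count p μ) _) (sym (count-++ q p μ)))

  ++-cancelʳ : ∀ p {p′ q q′} → q ≈[ d ] q′ → p ++ q ≈[ d ] p′ ++ q′ → p ≈[ d ] p′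
  ++-cancelʳ p {p′} {q} {q′} f e .counts μ b = ℕ.+-cancelʳ-≡ (count q μ) _ _
    (trans (sym (count-++ p q μ)) (trans (e .counts μ b)
        (trans (count-++ p′ q′ μ) (cong (count p′ μ +_) (sym (f .counts μ b))))))

  ++-cancelˡ : ∀ {p p′ q q′} → p ≈[ d ] p′ → p ++ q ≈[ d ] p′ ++ q′ → q ≈[ d ] q′
  ++-cancelˡ {p} {p′} {q} {q′} f e =
    ++-cancelʳ q f (≈-trans (++-comm q p) (≈-trans e (++-comm p′ q′)))

  ∷-cong : ∀ {m m′ p q} → m ↭ m′ → p ≈[ d ] q → m ∷ p ≈[ d ] m′ ∷ q
  ∷-cong r e .counts μ b = cong₂ _+_ (count-↭ μ r) (e .counts μ b)

  map-↭-cong : {f g : A → Partition} → (∀ a → f a ↭ g a) → ∀ xs → map f xs ≈[ d ] map g xs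
  map-↭-cong r []       = ≈-refl
  map-↭-cong r (a ∷ xs) = ∷-cong (r a) (map-↭-cong r xs)

  ++-interchange : ∀ p q r s → (p ++ q) ++ (r ++ s) ≈[ d ] (p ++ r) ++ (q ++ s)
  ++-interchange p q r s .counts μ b = trans (count-++ (p ++ q) _ μ)
      (trans (cong₂ _+_ (count-++ p q μ) (count-++ r s μ))
    (trans (solve 4 (λ a b c e → (a :+ b) :+ (c :+ e) := (a :+ c) :+ (b :+ e)) refl (count p μ) (count q μ)
        (count r μ) (count s μ))
    (sym (trans (count-++ (p ++ r) _ μ) (cong₂ _+_ (count-++ p r μ) (count-++ q s μ))))))
    where open +-*-Solver

  high-degree : ∀ {p} → All (λ m → d < sum m) p → p ≈[ d ] []
  high-degree [] = ≈-refl
  high-degree {m ∷ p} (h ∷ hs) .counts μ b = cong₂ _+_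
    (ind-no (m ≟ₚ μ) (λ r → ℕ.<⇒≱ h (subst (_≤ d) (sym (ℕ.sum-↭ r)) b))) (high-degree hs .counts μ b)

count-positive : ∀ {p m} → m ∈ p → 0 < count p m
count-positive {m ∷ p} (here refl) = subst (λ k → 0 < k + count p m) (sym (ind-yes (m ≟ₚ m) ↭-refl)) (s≤s z≤n)
count-positive {m ∷ p} {m′} (there i) = ℕ.<-≤-trans (count-positive i) (ℕ.m≤n+m _ (ind (m ≟ₚ m′)))

positive-count : ∀ p {μ} → 0 < count p μ → ∃ λ m → m ∈ p × m ↭ μ
positive-count (m ∷ p) {μ} h with m ≟ₚ μ
... | yes r = m , here refl , r
... | no ¬r with m′ , i , r ← positive-count p (subst (λ k → 0 < k + count p μ) (ind-no (m ≟ₚ μ) ¬r) h) = m′ ,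
    there i , r

≈-weaken : ∀ {d e p q} → d ≤ e → p ≈[ e ] q → p ≈[ d ] q
≈-weaken le e .counts μ b = e .counts μ (ℕ.≤-trans b le)

_∈?ₙ_ : (a : ℕ) (μ : Partition) → Dec (a ∈ μ)
a ∈?ₙ μ = Any.any? (a ℕ.≟_) μ

∈⇒↭ : {a : A} {as : List A} → a ∈ as → ∃ λ bs → as ↭ a ∷ bs
∈⇒↭ {a = a} i with bs , cs , refl ← ∈-∃++ i = bs ++ cs , ↭ₚ.shift a bs cs

-- The coefficient at `μ` is zero if `a` is no part of `μ`; otherwise it is the old coefficient at
-- `μ` with one `a` removed. Degrees rise by `a`, and so does the range of agreement.
map-∷-cong : ∀ {d p q} a → p ≈[ d ] q → map (a ∷_) p ≈[ a + d ] map (a ∷_) q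
map-∷-cong {d} {p} {q} a e .counts μ b with a ∈?ₙ μ
... | no a∉μ = trans (zero-count p) (sym (zero-count q))
  where
  zero-count : ∀ p → count (map (a ∷_) p) μ ≡ 0
  zero-count []      = refl
  zero-count (m ∷ p) = cong₂ _+_ (ind-no ((a ∷ m) ≟ₚ μ) (λ r → a∉μ (↭ₚ.∈-resp-↭ r (here refl)))) (zero-count p)
... | yes a∈μ with μ′ , r ← ∈⇒↭ a∈μ = trans (shift-count p) (trans (e .counts μ′ b′) (sym (shift-count q)))
  where
  b′ : sum μ′ ≤ d
  b′ = ℕ.+-cancelˡ-≤ a _ _ (subst (_≤ a + d) (ℕ.sum-↭ r) b)
  shift-count : ∀ p → count (map (a ∷_) p) μ ≡ count p μ′
  shift-count []      = refl
  shift-count (m ∷ p) = cong₂ _+_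
    (ind-cong ((a ∷ m) ≟ₚ μ) (m ≟ₚ μ′) (λ s → ↭ₚ.drop-∷ (↭-trans s r)) (λ s → ↭-trans (↭-prep a s) (↭-sym r)))
        (shift-count p)

map-++-cong : ∀ {d p q} m → p ≈[ d ] q → map (m ++_) p ≈[ sum m + d ] map (m ++_) q
map-++-cong {d} {p} {q} [] e =
  ≈-trans (≈-reflexive (map-id p)) (≈-trans e (≈-reflexive (sym (map-id q))))
map-++-cong {d} {p} {q} (a ∷ m) e = ≈-trans (≈-reflexive (map-∘ p)) (≈-trans
  (subst (λ k → map (a ∷_) (map (m ++_) p) ≈[ k ] map (a ∷_) (map (m ++_) q)) (sym (ℕ.+-assoc a (sum m) d))
      (map-∷-cong a (map-++-cong m e))) (≈-reflexive (sym (map-∘ q))))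

infixl 7 _⊗_
_⊗_ : Poly → Poly → Poly
_⊗_ = cartesianProductWith _++_

⊗-congˡ : ∀ {d} p {q q′} → q ≈[ d ] q′ → p ⊗ q ≈[ d ] p ⊗ q′
⊗-congˡ []      e = ≈-refl
⊗-congˡ (m ∷ p) {q} {q′} e =
  ++-cong {p = map (m ++_) q} (≈-weaken (ℕ.m≤n+m _ (sum m)) (map-++-cong m e)) (⊗-congˡ p e)

⊗-comm : ∀ {d} p q → p ⊗ q ≈[ d ] q ⊗ p
⊗-comm []      q = ≈-reflexive (sym (cartesianProductWith-zeroʳ _++_ q))
⊗-comm (m ∷ p) q = ≈-trans (++-cong {p = map (m ++_) q} (map-↭-cong (λ a → ↭ₚ.++-comm m a) q) (⊗-comm p q))
    (≈-sym (⊗-∷ q))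
  where
  ⊗-∷ : ∀ {d} q → q ⊗ (m ∷ p) ≈[ d ] map (_++ m) q ++ q ⊗ p
  ⊗-∷ [] = ≈-refl
  ⊗-∷ (n ∷ q) = ∷-cong ↭-refl (≈-trans (++-cong {p = map (n ++_) p} ≈-refl (⊗-∷ q)) (≈-trans
    (≈-reflexive (sym (++-assoc (map (n ++_) p) (map (_++ m) q) (q ⊗ p))))
    (≈-trans (++-cong {p = map (n ++_) p ++ map (_++ m) q} (++-comm (map (n ++_) p) _) (≈-refl {p = q ⊗ p}))
    (≈-reflexive (++-assoc (map (_++ m) q) _ _)))))

⊗-congʳ : ∀ {d} {p p′} q → p ≈[ d ] p′ → p ⊗ q ≈[ d ] p′ ⊗ q
⊗-congʳ {p = p} {p′} q e = ≈-trans (⊗-comm p q) (≈-trans (⊗-congˡ q e) (⊗-comm q p′))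

⊗-cong : ∀ {d} {p p′ q q′} → p ≈[ d ] p′ → q ≈[ d ] q′ → p ⊗ q ≈[ d ] p′ ⊗ q′
⊗-cong {p = p} {p′} {q} {q′} e f = ≈-trans (⊗-congʳ q e) (⊗-congˡ p′ f)

⊗-distribʳ : ∀ p q r → (p ++ q) ⊗ r ≡ p ⊗ r ++ q ⊗ r
⊗-distribʳ p q r = cartesianProductWith-distribʳ-++ _++_ p q r

⊗-distribˡ : ∀ {d} p q r → p ⊗ (q ++ r) ≈[ d ] p ⊗ q ++ p ⊗ r
⊗-distribˡ p q r = ≈-trans (⊗-comm p (q ++ r)) (≈-trans (≈-reflexive (⊗-distribʳ q r p))
    (++-cong (⊗-comm q p) (⊗-comm r p)))

⊗-assoc : ∀ p q r → (p ⊗ q) ⊗ r ≡ p ⊗ (q ⊗ r)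
⊗-assoc []      q r = refl
⊗-assoc (m ∷ p) q r = trans (⊗-distribʳ (map (m ++_) q) (p ⊗ q) r) (cong₂ _++_ (map-⊗ q) (⊗-assoc p q r))
  where
  map-⊗ : ∀ q → map (m ++_) q ⊗ r ≡ map (m ++_) (q ⊗ r)
  map-⊗ []      = refl
  map-⊗ (n ∷ q) = trans (cong₂ _++_ (trans (map-cong (++-assoc m n) r) (map-∘ r)) (map-⊗ q))
      (sym (map-++ (m ++_) (map (n ++_) r) _))

⊗-swap : ∀ {d} p q r → p ⊗ (q ⊗ r) ≈[ d ] q ⊗ (p ⊗ r)
⊗-swap p q r = ≈-trans (≈-reflexive (sym (⊗-assoc p q r)))
    (≈-trans (⊗-congʳ r (⊗-comm p q)) (≈-reflexive (⊗-assoc q p r)))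

𝟙 : Poly
𝟙 = [ [] ]

⊗-identityʳ : ∀ p → p ⊗ 𝟙 ≡ p
⊗-identityʳ []      = refl
⊗-identityʳ (m ∷ p) = cong₂ _∷_ (++-identityʳ m) (⊗-identityʳ p)

-- `p` already uses up the degree `d`, so only the constant term of `q` can contribute.
homogeneous-⊗ : ∀ {d} p {q} → All (λ m → sum m ≡ d) p → q ≈[ 0 ] 𝟙 → p ⊗ q ≈[ d ] p
homogeneous-⊗ {d} p {q} hs e = ≈-trans (go p hs) (≈-reflexive (⊗-identityʳ p))
  where
  go : ∀ p → All (λ m → sum m ≡ d) p → p ⊗ q ≈[ d ] p ⊗ 𝟙
  go []      []       = ≈-refl
  go (m ∷ p) (h ∷ hs) = ++-cong {p = map (m ++_) q}
      (≈-weaken (ℕ.≤-reflexive (trans (sym h) (sym (ℕ.+-identityʳ _)))) (map-++-cong m e)) (go p hs)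

infix 4 _≈_
_≈_ : Poly → Poly → Set
p ≈ q = ∀ μ → count p μ ≡ count q μ

-- Equal counts do not make the lists permutations of each other, since one monomial can be written
-- in several orders. The head of `p` is therefore located in `q` up to reordering and removed from
-- both sides.
concatMap-≈ : (h : Partition → Poly) → (∀ {m m′} → m ↭ m′ → h m ≈ h m′) →
              ∀ {p q} → p ≈ q → concatMap h p ≈ concatMap h q
concatMap-≈ h resp {[]} {[]} e = λ _ → refl
concatMap-≈ h resp {[]} {m ∷ q} e = contradiction (e m) (ℕ.<⇒≢ (count-positive {p = m ∷ q} (here refl)))
concatMap-≈ h resp {m ∷ p} {q} e μ with positive-count q {m}
    (subst (0 <_) (e m) (count-positive {p = m ∷ p} (here refl)))
... | m′ , i , r with q₁ , q₂ , refl ← ∈-∃++ i = begin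
  count (h m ++ concatMap h p) μ                     ≡⟨ count-++ (h m) _ μ ⟩
  count (h m) μ + count (concatMap h p) μ            ≡⟨ cong₂ _+_ (resp (↭-sym r) μ)
      (concatMap-≈ h resp {p} {q₁ ++ q₂} rest μ) ⟩
  count (h m′) μ + count (concatMap h (q₁ ++ q₂)) μ  ≡⟨ sym (count-++ (h m′) _ μ) ⟩
  count (h m′ ++ concatMap h (q₁ ++ q₂)) μ           ≡⟨ cong (λ t → count (h m′ ++ t) μ)
      (List.concatMap-++ h q₁ q₂) ⟩
  count (h m′ ++ (concatMap h q₁ ++ concatMap h q₂)) μ ≡⟨ count-mid (h m′) (concatMap h q₁) (concatMap h q₂) μ ⟩
  count (concatMap h q₁ ++ (h m′ ++ concatMap h q₂)) μ ≡⟨ cong (λ t → count t μ)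
      (sym (List.concatMap-++ h q₁ (m′ ∷ q₂))) ⟩
  count (concatMap h (q₁ ++ m′ ∷ q₂)) μ              ∎
  where
  open ≡-Reasoning
  count-mid : ∀ a b c μ → count (a ++ (b ++ c)) μ ≡ count (b ++ (a ++ c)) μ
  count-mid a b c μ = trans (cong (λ t → count t μ) (sym (++-assoc a b c)))
      (trans (++-cong {d = sum μ} {p = a ++ b} {q = c} (++-comm a b) ≈-refl .counts μ ℕ.≤-refl)
        (cong (λ t → count t μ) (++-assoc b a c)))
  rest : p ≈ q₁ ++ q₂
  rest ν = ℕ.+-cancelˡ-≡ (ind (m ≟ₚ ν)) _ _ (trans (e ν)
      (trans (sym (count-mid [ m′ ] q₁ q₂ ν)) (cong (_+ _) (count-↭ ν r))))

-- Partitions of rooted trees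

data Tree (A : Set) : Set where
  node : A → List (Tree A) → Tree A

label : Tree A → A
label (node a _) = a

children : Tree A → List (Tree A)
children (node _ ts) = ts

-- A vertex labelled k has weight suc k, so that weights are positive.
mutual
  weights : Tree ℕ → List ℕ
  weights (node k ts) = suc k ∷ weightsᶠ ts

  weightsᶠ : List (Tree ℕ) → List ℕ
  weightsᶠ []       = []
  weightsᶠ (t ∷ ts) = weights t ++ weightsᶠ ts

treeWeight : Tree ℕ → ℕ
treeWeight t = sum (weights t)

-- The first argument belongs to a child, the second to its remaining siblings. Cutting the edge
-- above the child makes its root component a part of its own; keeping the edge joins that component
-- to the parent.
cut keep : ℕ × Partition → ℕ × Partition → ℕ × Partition
cut  (a , m) (b , n) = b , a ∷ m ++ n
keep (a , m) (b , n) = a + b , m ++ n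

-- Each set of edges gives the weight of the component of the root, and the weights of the other
-- components. In a forest, the first entry is the weight of what is joined to a common parent.
mutual
  splits : Tree ℕ → List (ℕ × Partition)
  splits (node k ts) = map (map₁ (suc k +_)) (splitsᶠ ts)

  splitsᶠ : List (Tree ℕ) → List (ℕ × Partition)
  splitsᶠ []       = [ 0 , [] ]
  splitsᶠ (t ∷ ts) = cartesianProductWith cut (splits t) (splitsᶠ ts) ++ cartesianProductWith keep (splits t)
      (splitsᶠ ts)

-- The summands of `factor t` are the two fates of the edge above `t`. If it is deleted, a full
-- partition of `t` remains; if it is kept, the root component of `t` disappears into the part that
-- will be removed.
whole rest factor : Tree ℕ → Poly
whole  t = map (uncurry _∷_) (splits t)
rest   t = map proj₂ (splits t)
factor t = whole t ++ rest t

restᶠ : List (Tree ℕ) → Poly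
restᶠ ts = map proj₂ (splitsᶠ ts)

All-cartesianProductWith : {P : A → Set} {Q : B → Set} {R : C → Set} {f : A → B → C} →
  (∀ {a b} → P a → Q b → R (f a b)) → ∀ {as bs} → All P as → All Q bs → All R (cartesianProductWith f as bs)
All-cartesianProductWith g []       qs = []
All-cartesianProductWith g (p ∷ ps) qs = All.++⁺ (All.map⁺ (All.map (g p) qs))
    (All-cartesianProductWith g ps qs)

map-cartesianProductWith : {A B C A′ B′ C′ : Set} (h : C → C′) (f : A → B → C) (g : A′ → B′ → C′) (u : A → A′)
    (v : B → B′) →
  (∀ a b → h (f a b) ≡ g (u a) (v b)) →
  ∀ as bs → map h (cartesianProductWith f as bs) ≡ cartesianProductWith g (map u as) (map v bs)
map-cartesianProductWith h f g u v eq []       bs = refl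
map-cartesianProductWith h f g u v eq (a ∷ as) bs = trans (map-++ h (map (f a) bs) _)
  (cong₂ _++_ (trans (sym (map-∘ bs)) (trans (map-cong (eq a) bs) (map-∘ bs)))
      (map-cartesianProductWith h f g u v eq as bs))

rest-node : ∀ k ts → rest (node k ts) ≡ restᶠ ts
rest-node k ts = sym (map-∘ (splitsᶠ ts))

-- The choices in disjoint subtrees are independent, and joining lists of parts is multiplying
-- monomials.
restᶠ-∷ : ∀ t ts → restᶠ (t ∷ ts) ≡ factor t ⊗ restᶠ ts
restᶠ-∷ t ts = trans (map-++ proj₂ (cartesianProductWith cut (splits t) (splitsᶠ ts)) _) (trans
  (cong₂ _++_ (map-cartesianProductWith proj₂ cut _++_ _ _ (λ _ _ → refl) (splits t) (splitsᶠ ts))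
              (map-cartesianProductWith proj₂ keep _++_ _ _ (λ _ _ → refl) (splits t) (splitsᶠ ts)))
  (sym (⊗-distribʳ (whole t) (rest t) (restᶠ ts))))

restᶠ-++ : ∀ ts us → restᶠ (ts ++ us) ≡ restᶠ ts ⊗ restᶠ us
restᶠ-++ []       us = sym (trans (++-identityʳ _) (map-id _))
restᶠ-++ (t ∷ ts) us = trans (restᶠ-∷ t (ts ++ us)) (trans (cong (factor t ⊗_) (restᶠ-++ ts us))
  (trans (sym (⊗-assoc (factor t) (restᶠ ts) (restᶠ us))) (cong (_⊗ restᶠ us) (sym (restᶠ-∷ t ts)))))

Total : ℕ → ℕ × Partition → Set
Total n (a , m) = a + sum m ≡ n

mutual
  splits-total : ∀ t → All (Total (treeWeight t)) (splits t)
  splits-total (node k ts) = All.map⁺ (All.map (λ {(a , m)} e →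
      cong suc (trans (ℕ.+-assoc k a (sum m)) (cong (k +_) e))) (splitsᶠ-total ts))

  splitsᶠ-total : ∀ ts → All (Total (sum (weightsᶠ ts))) (splitsᶠ ts)
  splitsᶠ-total []       = refl ∷ []
  splitsᶠ-total (t ∷ ts) = All.++⁺
    (All-cartesianProductWith (λ {(a , m)} {(b , n)} e f → trans (cong (λ s → b + (a + s)) (ℕ.sum-++ m n))
       (trans (solve 4 (λ a b m n → b :+ (a :+ (m :+ n)) := (a :+ m) :+ (b :+ n)) refl a b (sum m) (sum n))
           (total e f)))
       (splits-total t) (splitsᶠ-total ts))
    (All-cartesianProductWith (λ {(a , m)} {(b , n)} e f → trans (cong (λ s → a + b + s) (ℕ.sum-++ m n))
       (trans (solve 4 (λ a b m n → a :+ b :+ (m :+ n) := (a :+ m) :+ (b :+ n)) refl a b (sum m) (sum n))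
           (total e f)))
       (splits-total t) (splitsᶠ-total ts))
    where
    open +-*-Solver
    total : ∀ {i j} → i ≡ treeWeight t → j ≡ sum (weightsᶠ ts) → i + j ≡ sum (weightsᶠ (t ∷ ts))
    total refl refl = sym (ℕ.sum-++ (weights t) (weightsᶠ ts))

whole-homogeneous : ∀ t → All (λ m → sum m ≡ treeWeight t) (whole t)
whole-homogeneous t = All.map⁺ (splits-total t)

treeWeight-positive : ∀ t → 0 < treeWeight t
treeWeight-positive (node k ts) = s≤s z≤n

-- The longest partition in whole t comes from the empty set of edges.
mutual
  splits-length : ∀ t → All (λ (a , m) → length (a ∷ m) ≤ length (weights t) ×
      (length (a ∷ m) ≡ length (weights t) → a ∷ m ↭ weights t)) (splits t)
  splits-length (node k ts) = All.map⁺ (All.map (λ {(a , m)} (le , f) → s≤s le ,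
    λ e → case f (ℕ.suc-injective e) of λ { (refl , r) →
        ↭-trans (↭-reflexive (cong (λ s → suc s ∷ m) (ℕ.+-identityʳ k))) (↭-prep (suc k) r) })
          (splitsᶠ-length ts))

  splitsᶠ-length : ∀ ts → All (λ (a , m) → length m ≤ length (weightsᶠ ts) ×
      (length m ≡ length (weightsᶠ ts) → a ≡ 0 × m ↭ weightsᶠ ts)) (splitsᶠ ts)
  splitsᶠ-length []       = (z≤n , λ _ → refl , ↭-refl) ∷ []
  splitsᶠ-length (t ∷ ts) = All.++⁺
    (All-cartesianProductWith {P = λ (a , m) → length (a ∷ m) ≤ length (weights t) ×
        (length (a ∷ m) ≡ length (weights t) → a ∷ m ↭ weights t)} (λ {(a , m)} {(b , n)} (le , f) (le′ , g) →
        subst₂ _≤_ (sym (length-++ (a ∷ m))) (sym (length-++ (weights t))) (ℕ.+-mono-≤ le le′) ,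
        λ e → let e′ = trans (sym (length-++ (a ∷ m))) (trans e (length-++ (weights t))) in
          case g (tight le le′ e′) of λ (a≡0 , r) → a≡0 , ↭ₚ.++⁺ (f (tight′ le le′ e′)) r)
      (splits-length t) (splitsᶠ-length ts))
    (All-cartesianProductWith {P = λ (a , m) → length (a ∷ m) ≤ length (weights t) ×
        (length (a ∷ m) ≡ length (weights t) → a ∷ m ↭ weights t)} (λ {(a , m)} {(b , n)} (le , f) (le′ , g) →
        -- Keeping an edge merges two components, so a part is lost: the bound is strict and the
        -- case of equality is void.
        let lt = subst₂ _<_ (sym (length-++ m)) (sym (length-++ (weights t))) (ℕ.+-mono-≤ le le′) in
        ℕ.<⇒≤ lt , λ e → contradiction e (ℕ.<⇒≢ lt))
      (splits-length t) (splitsᶠ-length ts))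
    where
    tight : ∀ {i j k l} → i ≤ j → k ≤ l → i + k ≡ j + l → k ≡ l
    tight {i} {j} {k} {l} p q e with ℕ.m≤n⇒m<n∨m≡n q
    ... | inj₂ k≡l = k≡l
    ... | inj₁ k<l = contradiction e (ℕ.<⇒≢ (ℕ.+-mono-≤-< p k<l))
    tight′ : ∀ {i j k l} → i ≤ j → k ≤ l → i + k ≡ j + l → i ≡ j
    tight′ {i} {j} {k} {l} p q e with ℕ.m≤n⇒m<n∨m≡n p
    ... | inj₂ i≡j = i≡j
    ... | inj₁ i<j = contradiction e (ℕ.<⇒≢ (ℕ.+-mono-<-≤ i<j q))

whole-length : ∀ t → All (λ m → length m ≤ length (weights t) × (length m ≡ length (weights t) → m ↭ weights t))
    (whole t)
whole-length t = All.map⁺ (splits-length t)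

∈-cartesianProductWith : (f : A → B → C) → ∀ {a b as bs} → a ∈ as → b ∈ bs →
    f a b ∈ cartesianProductWith f as bs
∈-cartesianProductWith f (here refl) j = ∈-++⁺ˡ (∈-map⁺ (f _) j)
∈-cartesianProductWith f {as = a′ ∷ as} {bs} (there i) j = ∈-++⁺ʳ (map (f a′) bs) (∈-cartesianProductWith f i j)

mutual
  splits-discrete : ∀ k ts → (suc k , weightsᶠ ts) ∈ splits (node k ts)
  splits-discrete k ts = subst (λ s → (suc s , weightsᶠ ts) ∈ splits (node k ts)) (ℕ.+-identityʳ k)
      (∈-map⁺ (map₁ (suc k +_)) (splitsᶠ-discrete ts))

  splitsᶠ-discrete : ∀ ts → (0 , weightsᶠ ts) ∈ splitsᶠ ts
  splitsᶠ-discrete []              = here refl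
  splitsᶠ-discrete (node k us ∷ ts) = ∈-++⁺ˡ (∈-cartesianProductWith cut (splits-discrete k us)
      (splitsᶠ-discrete ts))

weights∈whole : ∀ t → weights t ∈ whole t
weights∈whole (node k ts) = ∈-map⁺ (uncurry _∷_) (splits-discrete k ts)

-- Rooted trees up to the order of children

infix 4 _~_
-- r-isomorphism for trees without named vertices. `Permutation _~_` reorders the children and
-- replaces them by similar ones in a single relation.
data _~_ : Tree ℕ → Tree ℕ → Set where
  node : ∀ {k ts us} → Permutation _~_ ts us → node k ts ~ node k us

infix 4 _~ᶠ_
_~ᶠ_ : List (Tree ℕ) → List (Tree ℕ) → Set
_~ᶠ_ = Permutation _~_

mutual
  ~-refl : ∀ {t} → t ~ t
  ~-refl {node k ts} = node (H.refl ~-reflᶠ)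

  ~-reflᶠ : ∀ {ts} → Pointwise _~_ ts ts
  ~-reflᶠ {[]}     = []
  ~-reflᶠ {t ∷ ts} = ~-refl ∷ ~-reflᶠ

mutual
  ~-sym : ∀ {t u} → t ~ u → u ~ t
  ~-sym (node p) = node (~ᶠ-sym p)

  ~ᶠ-sym : ∀ {ts us} → ts ~ᶠ us → us ~ᶠ ts
  ~ᶠ-sym (H.refl es)     = H.refl (go es)
    where
    go : ∀ {ts us} → Pointwise _~_ ts us → Pointwise _~_ us ts
    go []       = []
    go (e ∷ es) = ~-sym e ∷ go es
  ~ᶠ-sym (H.prep e p)    = H.prep (~-sym e) (~ᶠ-sym p)
  ~ᶠ-sym (H.swap e f p)  = H.swap (~-sym f) (~-sym e) (~ᶠ-sym p)
  ~ᶠ-sym (H.trans p q)   = H.trans (~ᶠ-sym q) (~ᶠ-sym p)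

~-trans : ∀ {t u v} → t ~ u → u ~ v → t ~ v
~-trans (node p) (node q) = node (H.trans p q)

~-setoid : Setoid 0ℓ 0ℓ
~-setoid = record { _≈_ = _~_ ; isEquivalence = record { refl = ~-refl ; sym = ~-sym ; trans = ~-trans } }

module ~ₚ = Hₚ ~-setoid

↭⇒~ᶠ : ∀ {ts us} → ts ↭ us → ts ~ᶠ us
↭⇒~ᶠ = ↭.↭⇒↭ₛ′ (Setoid.isEquivalence ~-setoid)

mutual
  weights-~ : ∀ {t u} → t ~ u → weights t ↭ weights u
  weights-~ (node p) = ↭-prep _ (weightsᶠ-~ p)

  weightsᶠ-~ : ∀ {ts us} → ts ~ᶠ us → weightsᶠ ts ↭ weightsᶠ us
  weightsᶠ-~ (H.refl es) = go es
    where
    go : ∀ {ts us} → Pointwise _~_ ts us → weightsᶠ ts ↭ weightsᶠ us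
    go []       = ↭-refl
    go (e ∷ es) = ↭ₚ.++⁺ (weights-~ e) (go es)
  weightsᶠ-~ (H.prep e p) = ↭ₚ.++⁺ (weights-~ e) (weightsᶠ-~ p)
  weightsᶠ-~ (H.swap {x = t} {y = u} e f p) = ↭-trans (↭ₚ.shifts (weights t) (weights u))
      (↭ₚ.++⁺ (weights-~ f) (↭ₚ.++⁺ (weights-~ e) (weightsᶠ-~ p)))
  weightsᶠ-~ (H.trans p q) = ↭-trans (weightsᶠ-~ p) (weightsᶠ-~ q)

-- The total weight `n` recovers the part of the root from the other parts. So `rest t` and the
-- weight of `t` determine `whole t`, and invariance under `_~_` has to be followed through the
-- recursion for `rest` only.
complete : ℕ → Partition → Poly
complete n m = [ (n ∸ sum m) ∷ m ]

whole-rest : ∀ t {n} → treeWeight t ≡ n → whole t ≡ concatMap (complete n) (rest t)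
whole-rest t refl = go (splits-total t)
  where
  go : ∀ {ss} → All (Total (treeWeight t)) ss → map (uncurry _∷_) ss ≡ concatMap (complete (treeWeight t))
      (map proj₂ ss)
  go []       = refl
  go {(a , m) ∷ ss} (e ∷ es) = cong₂ _∷_ (cong (_∷ m) (trans (sym (ℕ.m+n∸n≡m a (sum m))) (cong (_∸ sum m) e)))
      (go es)

≈⇒≈[] : ∀ {d p q} → p ≈ q → p ≈[ d ] q
≈⇒≈[] e .counts μ _ = e μ

≈[]⇒≈ : ∀ {p q} → (∀ d → p ≈[ d ] q) → p ≈ q
≈[]⇒≈ e μ = e (sum μ) .counts μ ℕ.≤-refl

whole-cong : ∀ t u → treeWeight t ≡ treeWeight u → (∀ d → rest t ≈[ d ] rest u) → ∀ d → whole t ≈[ d ] whole u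
whole-cong t u e r d = ≈-trans (≈-reflexive (whole-rest t e)) (≈-trans
  (≈⇒≈[] {p = concatMap (complete n) (rest t)} (concatMap-≈ (complete n) resp {rest t} {rest u} (≈[]⇒≈ r)))
  (≈-reflexive (sym (whole-rest u refl))))
  where
  n = treeWeight u
  resp : ∀ {m m′} → m ↭ m′ → complete n m ≈ complete n m′
  resp {m} {m′} s = ≈[]⇒≈ λ d → ∷-cong (↭-trans (↭-prep _ s)
      (↭-reflexive (cong (λ k → (n ∸ k) ∷ m′) (ℕ.sum-↭ s)))) (≈-refl {p = []})

mutual
  rest-~ : ∀ {t u} → t ~ u → ∀ d → rest t ≈[ d ] rest u
  rest-~ (node {k} {ts} {us} p) d = ≈-trans (≈-reflexive (rest-node k ts))
      (≈-trans (restᶠ-~ p d) (≈-reflexive (sym (rest-node k us))))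

  factor-~ : ∀ {t u} → t ~ u → ∀ d → factor t ≈[ d ] factor u
  factor-~ {t} {u} e d = ++-cong (whole-cong t u (ℕ.sum-↭ (weights-~ e)) (rest-~ e) d) (rest-~ e d)

  restᶠ-~ : ∀ {ts us} → ts ~ᶠ us → ∀ d → restᶠ ts ≈[ d ] restᶠ us
  restᶠ-~ (H.refl es) d = go es
    where
    go : ∀ {ts us} → Pointwise _~_ ts us → restᶠ ts ≈[ d ] restᶠ us
    go []       = ≈-refl
    go {t ∷ ts} {u ∷ us} (e ∷ es) = restᶠ-∷-cong t u ts us (factor-~ e d) (go es)
  restᶠ-~ (H.prep {ts} {us} {t} {u} e p) d = restᶠ-∷-cong t u ts us (factor-~ e d) (restᶠ-~ p d)
  restᶠ-~ (H.swap {xs = ts} {us} {t} {u} {t′} {u′} e f p) d =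
      ≈-trans (≈-reflexive (trans (restᶠ-∷ t (u ∷ ts)) (cong (factor t ⊗_) (restᶠ-∷ u ts))))
    (≈-trans (⊗-swap (factor t) (factor u) (restᶠ ts))
        (≈-trans (⊗-cong (factor-~ f d) (⊗-cong (factor-~ e d) (restᶠ-~ p d)))
    (≈-reflexive (sym (trans (restᶠ-∷ u′ (t′ ∷ us)) (cong (factor u′ ⊗_) (restᶠ-∷ t′ us)))))))
  restᶠ-~ (H.trans p q) d = ≈-trans (restᶠ-~ p d) (restᶠ-~ q d)

  restᶠ-∷-cong : ∀ {d} t u ts us → factor t ≈[ d ] factor u → restᶠ ts ≈[ d ] restᶠ us →
      restᶠ (t ∷ ts) ≈[ d ] restᶠ (u ∷ us)
  restᶠ-∷-cong t u ts us e f = ≈-trans (≈-reflexive (restᶠ-∷ t ts))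
      (≈-trans (⊗-cong e f) (≈-reflexive (sym (restᶠ-∷ u us))))

whole-~ : ∀ {t u} → t ~ u → ∀ d → whole t ≈[ d ] whole u
whole-~ {t} {u} e = whole-cong t u (ℕ.sum-↭ (weights-~ e)) (rest-~ e)

mutual
  -- Only the full set of edges leaves nothing beside the component of the root.
  rest-unit : ∀ t → rest t ≈[ 0 ] 𝟙
  rest-unit (node k ts) = ≈-trans (≈-reflexive (rest-node k ts)) (restᶠ-unit ts)

  factor-unit : ∀ t → factor t ≈[ 0 ] 𝟙
  factor-unit t = ++-cong (high-degree (All.map (λ e → subst (0 <_) (sym e) (treeWeight-positive t))
      (whole-homogeneous t))) (rest-unit t)

  restᶠ-unit : ∀ ts → restᶠ ts ≈[ 0 ] 𝟙
  restᶠ-unit []       = ≈-refl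
  restᶠ-unit (t ∷ ts) = ≈-trans (≈-reflexive (restᶠ-∷ t ts)) (⊗-cong (factor-unit t) (restᶠ-unit ts))

-- Recovering a forest from its partitions

mutual
  -- These are the maximal branches of weight at most `d`. A heavier tree gives way to its children
  -- because its `whole` has no term of degree at most `d`, while its `rest` is the product over the
  -- children.
  trim : ℕ → Tree ℕ → List (Tree ℕ)
  trim d (node k ts) with treeWeight (node k ts) ℕ.≤? d
  ... | yes _ = [ node k ts ]
  ... | no _  = trimᶠ d ts

  trimᶠ : ℕ → List (Tree ℕ) → List (Tree ℕ)
  trimᶠ d []       = []
  trimᶠ d (t ∷ ts) = trim d t ++ trimᶠ d ts

trim-light : ∀ {d} t → treeWeight t ≤ d → trim d t ≡ [ t ]
trim-light {d} (node k ts) le with treeWeight (node k ts) ℕ.≤? d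
... | yes _   = refl
... | no ¬le = contradiction le ¬le

trim-heavy : ∀ {d} t → ¬ treeWeight t ≤ d → trim d t ≡ trimᶠ d (children t)
trim-heavy {d} (node k ts) ¬le with treeWeight (node k ts) ℕ.≤? d
... | yes le = contradiction le ¬le
... | no _   = refl

trimᶠ-light : ∀ {d ts} → All (λ t → treeWeight t ≤ d) ts → trimᶠ d ts ≡ ts
trimᶠ-light []                    = refl
trimᶠ-light {ts = t ∷ ts} (le ∷ les) = cong₂ _++_ (trim-light t le) (trimᶠ-light les)

trimᶠ-++ : ∀ d ts us → trimᶠ d (ts ++ us) ≡ trimᶠ d ts ++ trimᶠ d us
trimᶠ-++ d []       us = refl
trimᶠ-++ d (t ∷ ts) us = trans (cong (trim d t ++_) (trimᶠ-++ d ts us)) (sym (++-assoc (trim d t) _ _))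

mutual
  trim-trim : ∀ {d e} t → d ≤ e → trimᶠ d (trim e t) ≡ trim d t
  trim-trim {d} {e} (node k ts) le with treeWeight (node k ts) ℕ.≤? e
  ... | yes _   = ++-identityʳ _
  ... | no ¬le = trans (trimᶠ-trimᶠ ts le) (sym (trim-heavy (node k ts) (λ le′ → ¬le (ℕ.≤-trans le′ le))))

  trimᶠ-trimᶠ : ∀ {d e} ts → d ≤ e → trimᶠ d (trimᶠ e ts) ≡ trimᶠ d ts
  trimᶠ-trimᶠ []       le = refl
  trimᶠ-trimᶠ {d} {e} (t ∷ ts) le = trans (trimᶠ-++ d (trim e t) _)
      (cong₂ _++_ (trim-trim t le) (trimᶠ-trimᶠ ts le))

mutual
  trim-bound : ∀ d t → All (λ u → treeWeight u ≤ d) (trim d t)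
  trim-bound d (node k ts) with treeWeight (node k ts) ℕ.≤? d
  ... | yes le = le ∷ []
  ... | no _   = trimᶠ-bound d ts

  trimᶠ-bound : ∀ d ts → All (λ u → treeWeight u ≤ d) (trimᶠ d ts)
  trimᶠ-bound d []       = []
  trimᶠ-bound d (t ∷ ts) = All.++⁺ (trim-bound d t) (trimᶠ-bound d ts)

Hereditary : Pred (Tree ℕ) ℓ → Set ℓ
Hereditary P = ∀ {t} → P t → All P (children t)

module _ {P : Pred (Tree ℕ) ℓ} (hereditary : Hereditary P) where
  mutual
    trim-All : ∀ d t → P t → All P (trim d t)
    trim-All d (node k ts) p with treeWeight (node k ts) ℕ.≤? d
    ... | yes _ = p ∷ []
    ... | no _  = trimᶠ-All d ts (hereditary p)

    trimᶠ-All : ∀ d ts → All P ts → All P (trimᶠ d ts)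
    trimᶠ-All d []       []       = []
    trimᶠ-All d (t ∷ ts) (p ∷ ps) = All.++⁺ (trim-All d t p) (trimᶠ-All d ts ps)

trimᶠ-zero : ∀ ts → trimᶠ 0 ts ≡ []
trimᶠ-zero ts with trimᶠ 0 ts | trimᶠ-bound 0 ts
... | []    | _      = refl
... | t ∷ _ | le ∷ _ = contradiction le (ℕ.<⇒≱ (treeWeight-positive t))

-- The root itself has positive weight, so trimming at `d` a tree of weight `suc d` stops at its
-- children.
children-bound : ∀ {d} t → treeWeight t ≤ suc d → All (λ u → treeWeight u ≤ d) (children t)
children-bound {d} (node k ts) (s≤s le) = go ts (ℕ.m+n≤o⇒n≤o k le)
  where
  go : ∀ ts → sum (weightsᶠ ts) ≤ d → All (λ u → treeWeight u ≤ d) ts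
  go []       _  = []
  go (t ∷ ts) le = ℕ.m+n≤o⇒m≤o (treeWeight t) le′ ∷ go ts (ℕ.m+n≤o⇒n≤o (treeWeight t) le′)
    where le′ = subst (_≤ d) (ℕ.sum-++ (weights t) (weightsᶠ ts)) le

wholes : List (Tree ℕ) → Poly
wholes = concatMap whole

module _ (d : ℕ) where
  heavy : List (Tree ℕ) → List (Tree ℕ)
  heavy []       = []
  heavy (t ∷ ts) with treeWeight t ℕ.≟ suc d
  ... | yes _ = t ∷ heavy ts
  ... | no _  = heavy ts

  light : List (Tree ℕ) → List (Tree ℕ)
  light []       = []
  light (t ∷ ts) with treeWeight t ℕ.≟ suc d
  ... | yes _ = light ts
  ... | no _  = t ∷ light ts

  heavy-weight : ∀ ts → All (λ t → treeWeight t ≡ suc d) (heavy ts)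
  heavy-weight []       = []
  heavy-weight (t ∷ ts) with treeWeight t ℕ.≟ suc d
  ... | yes eq = eq ∷ heavy-weight ts
  ... | no _   = heavy-weight ts

  heavy-light : ∀ ts → ts ↭ heavy ts ++ light ts
  heavy-light []       = ↭-refl
  heavy-light (t ∷ ts) with treeWeight t ℕ.≟ suc d
  ... | yes _ = ↭-prep t (heavy-light ts)
  ... | no _  = ↭-trans (↭-prep t (heavy-light ts)) (↭-sym (↭ₚ.shift t (heavy ts) (light ts)))

  trim-equal : ∀ t → treeWeight t ≡ suc d → trim d t ≡ children t
  trim-equal t eq = trans (trim-heavy t (λ le → ℕ.<⇒≱ (ℕ.≤-reflexive (sym eq)) le))
      (trimᶠ-light (children-bound t (ℕ.≤-reflexive eq)))

  bound-pred : ∀ {n} → n ≤ suc d → n ≢ suc d → n ≤ d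
  bound-pred le ne = ℕ.≤-pred (ℕ.≤∧≢⇒< le ne)

  trimᶠ-heavy-light : ∀ {ts} → All (λ t → treeWeight t ≤ suc d) ts →
      trimᶠ d ts ↭ concatMap children (heavy ts) ++ light ts
  trimᶠ-heavy-light []                       = ↭-refl
  trimᶠ-heavy-light {t ∷ ts} (le ∷ les) with treeWeight t ℕ.≟ suc d
  ... | yes eq = subst₂ _↭_ (cong (_++ trimᶠ d ts) (sym (trim-equal t eq))) (sym (++-assoc (children t) _ _))
      (↭ₚ.++⁺ˡ (children t) (trimᶠ-heavy-light les))
  ... | no ne  = ↭-trans (↭-reflexive (cong (_++ trimᶠ d ts) (trim-light t (bound-pred le ne))))
                   (↭-trans (↭-prep t (trimᶠ-heavy-light les))
                       (↭-sym (↭ₚ.shift t (concatMap children (heavy ts)) (light ts))))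

  wholes-heavy-homogeneous : ∀ ts → All (λ m → sum m ≡ suc d) (wholes (heavy ts))
  wholes-heavy-homogeneous []       = []
  wholes-heavy-homogeneous (t ∷ ts) with treeWeight t ℕ.≟ suc d
  ... | yes eq = All.++⁺ (All.map (λ e → trans e eq) (whole-homogeneous t)) (wholes-heavy-homogeneous ts)
  ... | no _   = wholes-heavy-homogeneous ts

  -- Expanding the product of all `whole t + rest t`, a chosen heavy `whole t` exhausts the degree,
  -- so the other factors contribute their constant term 1. If none is chosen, each heavy tree is
  -- replaced by its children.
  restᶠ-heavy : ∀ {ts} → All (λ t → treeWeight t ≤ suc d) ts →
                restᶠ ts ≈[ suc d ] wholes (heavy ts) ++ restᶠ (trimᶠ d ts)
  restᶠ-heavy []                  = ≈-refl
  restᶠ-heavy {t@(node k us) ∷ ts} (le ∷ les) = ≈-trans (≈-reflexive (restᶠ-∷ t ts)) step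
    where
    S = wholes (heavy ts)
    R = restᶠ (trimᶠ d ts)
    -- A factor with constant term 1 is swallowed by `S`, which is homogeneous of the top degree,
    -- and survives only in front of `R`.
    absorb : ∀ p → p ≈[ 0 ] 𝟙 → p ⊗ restᶠ ts ≈[ suc d ] S ++ p ⊗ R
    absorb p e = ≈-trans (⊗-congˡ p (restᶠ-heavy les)) (≈-trans (⊗-distribˡ p S R)
      (++-cong {q = p ⊗ R} (≈-trans (⊗-comm p S) (homogeneous-⊗ S (wholes-heavy-homogeneous ts) e)) ≈-refl))
    step : factor t ⊗ restᶠ ts ≈[ suc d ] wholes (heavy (t ∷ ts)) ++ restᶠ (trim d t ++ trimᶠ d ts)
    step with treeWeight t ℕ.≟ suc d
    ... | no ne = ≈-trans (absorb (factor t) (factor-unit t)) (++-cong {p = S} ≈-refl (≈-reflexive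
                    (trans (sym (restᶠ-∷ t (trimᶠ d ts))) (cong (λ us → restᶠ (us ++ trimᶠ d ts))
                        (sym (trim-light t (bound-pred le ne)))))))
    -- Here `whole t` joins the sum, and `rest t` is the product over the children, which are all
    -- that trimming leaves of `t`.
    ... | yes eq = ≈-trans (≈-reflexive (⊗-distribʳ (whole t) (rest t) (restᶠ ts))) (≈-trans
                     (++-cong (homogeneous-⊗ (whole t) (All.map (λ e → trans e eq) (whole-homogeneous t))
                         (restᶠ-unit ts)) (absorb (rest t) (rest-unit t)))
                     (≈-reflexive (trans (sym (++-assoc (whole t) S _)) (cong ((whole t ++ S) ++_)
                       (trans (cong (_⊗ R) (rest-node k us)) (trans (sym (restᶠ-++ us (trimᶠ d ts)))
                           (cong (λ vs → restᶠ (vs ++ trimᶠ d ts)) (sym (trim-equal t eq)))))))))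

argmax : (f : A → ℕ) (a : A) (as : List A) → ∃ λ b → b ∈ a ∷ as × All (λ c → f c ≤ f b) (a ∷ as)
argmax f a [] = a , here refl , ℕ.≤-refl ∷ []
argmax f a (a′ ∷ as) with b , i , le ← argmax f a′ as with ℕ.≤-total (f a) (f b)
... | inj₁ a≤b = b , there i , a≤b ∷ le
... | inj₂ b≤a = a , here refl , ℕ.≤-refl ∷ All.map (λ c≤b → ℕ.≤-trans c≤b b≤a) le

size : Tree ℕ → ℕ
size t = length (weights t)

module _ {d : ℕ} where

  -- The partition of `t` into single vertices is counted on the left, so some `u` on the right has
  -- it too. A partition of `u` has at most `size u` parts, and exactly that many only if it is
  -- `weights u`.
  larger-partner : ∀ {ts us t} → t ∈ ts → treeWeight t ≡ d → wholes ts ≈[ d ] wholes us →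
                   ∃ λ u → u ∈ us × size t ≤ size u × (size t ≡ size u → weights t ↭ weights u)
  larger-partner {ts} {us} {t} i eq e
    with m , j , r ← positive-count (wholes us) (subst (0 <_) (e .counts (weights t) (ℕ.≤-reflexive eq))
                       (count-positive (∈-concatMap⁺ whole (lose i (weights∈whole t)))))
    with u , k , j′ ← find (∈-concatMap⁻ whole {xs = us} j)
    with le , f ← All.lookup (whole-length u) j′ =
    u , k , subst (_≤ size u) (↭ₚ.↭-length r) le , λ s → ↭-trans (↭-sym r) (f (trans (↭ₚ.↭-length r) s))

concatMap-↭ : (f : A → List B) → ∀ {as bs} → as ↭ bs → concatMap f as ↭ concatMap f bs
concatMap-↭ f ↭.refl         = ↭-refl
concatMap-↭ f (↭.prep a p)   = ↭ₚ.++⁺ˡ (f a) (concatMap-↭ f p)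
concatMap-↭ f (↭.swap a b p) = ↭-trans (↭ₚ.shifts (f a) (f b)) (↭ₚ.++⁺ˡ (f b) (↭ₚ.++⁺ˡ (f a) (concatMap-↭ f p)))
concatMap-↭ f (↭.trans p q)  = ↭-trans (concatMap-↭ f p) (concatMap-↭ f q)

↭⇒≈ : ∀ {d p q} → p ↭ q → p ≈[ d ] q
↭⇒≈ ↭.refl         = ≈-refl
↭⇒≈ (↭.prep m p)   = ∷-cong ↭-refl (↭⇒≈ p)
↭⇒≈ {d} {p = _ ∷ _ ∷ ps} (↭.swap m n p) = ≈-trans (++-cong {d = d} {p = m ∷ [ n ]} {q = ps}
    (++-comm [ m ] [ n ]) ≈-refl) (∷-cong ↭-refl (∷-cong ↭-refl (↭⇒≈ p)))
↭⇒≈ (↭.trans p q)  = ≈-trans (↭⇒≈ p) (↭⇒≈ q)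

module _ {P Q : Pred (Tree ℕ) ℓ} (determined : ∀ {t u} → P t → Q u → weights t ↭ weights u → t ~ u) where

  -- A tree with the most vertices is found through its longest partition, then cancelled.
  wholes-injective : ∀ n {d ts us} → length ts ≤ n → All P ts → All Q us →
    All (λ t → treeWeight t ≡ d) ts → All (λ u → treeWeight u ≡ d) us →
    wholes ts ≈[ d ] wholes us → ts ~ᶠ us
  wholes-injective n {ts = []} {[]} _ _ _ _ _ _ = H.refl []
  wholes-injective n {d} {[]} {u ∷ us} _ _ _ _ (eq ∷ _) e with larger-partner {ts = u ∷ us} {[]} (here refl) eq
      (≈-sym e)
  ... | _ , () , _
  wholes-injective n {d} {t ∷ ts} {[]} _ _ _ (eq ∷ _) _ e with larger-partner {ts = t ∷ ts} {[]}
      (here refl) eq e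
  ... | _ , () , _
  wholes-injective (suc n) {d} {t₀ ∷ ts₀} {u₀ ∷ us₀} len ps qs ets eus e
    with t , i , t-max ← argmax size t₀ ts₀
    with u₁ , j₁ , u₁-max ← argmax size u₀ us₀
    with u , j , t≤u , same ← larger-partner i (All.lookup ets i) e
    -- Returning from a largest `u₁` closes the circle: size u ≤ size u₁ ≤ size t₁ ≤ size t. So `t`
    -- and `u` have the same size, and hence the same weights.
    with t₁ , i₁ , u₁≤t₁ , _ ← larger-partner j₁ (All.lookup eus j₁) (≈-sym e)
    with t~u ← determined (All.lookup ps i) (All.lookup qs j)
                 (same (ℕ.≤-antisym t≤u (ℕ.≤-trans (All.lookup u₁-max j)
                     (ℕ.≤-trans u₁≤t₁ (All.lookup t-max i₁)))))
    with ts , r ← ∈⇒↭ i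
    with us , s ← ∈⇒↭ j
    = H.trans (↭⇒~ᶠ r) (H.trans (H.prep t~u
        (wholes-injective n (ℕ.≤-pred (subst (_≤ suc n) (↭ₚ.↭-length r) len))
          (All.tail (↭ₚ.All-resp-↭ r ps)) (All.tail (↭ₚ.All-resp-↭ s qs))
          (All.tail (↭ₚ.All-resp-↭ r ets)) (All.tail (↭ₚ.All-resp-↭ s eus))
          (++-cancelˡ (whole-~ t~u d) (≈-trans (≈-sym (↭⇒≈ (concatMap-↭ whole r)))
              (≈-trans e (↭⇒≈ (concatMap-↭ whole s)))))))
        (↭⇒~ᶠ (↭-sym s)))

concatMap-children-~ : ∀ {ts us} → ts ~ᶠ us → concatMap children ts ~ᶠ concatMap children us
concatMap-children-~ (H.refl es) = go es
  where
  go : ∀ {ts us} → Pointwise _~_ ts us → concatMap children ts ~ᶠ concatMap children us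
  go []            = H.refl []
  go (node p ∷ es) = ~ₚ.++⁺ p (go es)
concatMap-children-~ (H.prep (node p) q) = ~ₚ.++⁺ p (concatMap-children-~ q)
concatMap-children-~ (H.swap {x = t} {y = u} (node p) (node q) r) =
  H.trans (~ₚ.shifts (children t) (children u)) (~ₚ.++⁺ q (~ₚ.++⁺ p (concatMap-children-~ r)))
concatMap-children-~ (H.trans p q) = H.trans (concatMap-children-~ p) (concatMap-children-~ q)

module _ {P Q : Pred (Tree ℕ) ℓ} (hereditaryᴾ : Hereditary P) (hereditaryᵠ : Hereditary Q)
         (determined : ∀ {t u} → P t → Q u → weights t ↭ weights u → t ~ u) where

  -- By `restᶠ-heavy`, the polynomials up to degree `suc d` consist of the contribution of the
  -- trimmed forests, already known to agree, and the sum of the heavy `whole t`, which is left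
  -- after cancelling.
  trim-step : ∀ d {ts us} → All P ts → All Q us →
    All (λ t → treeWeight t ≤ suc d) ts → All (λ u → treeWeight u ≤ suc d) us →
    restᶠ ts ≈[ suc d ] restᶠ us → trimᶠ d ts ~ᶠ trimᶠ d us → ts ~ᶠ us
  trim-step d {ts} {us} ps qs les les′ e trimmed =
    H.trans (↭⇒~ᶠ (heavy-light d ts)) (H.trans (~ₚ.++⁺ heavies lights) (↭⇒~ᶠ (↭-sym (heavy-light d us))))
    where
    heavy-All : ∀ {P : Pred (Tree ℕ) ℓ} {ts} → All P ts → All P (heavy d ts)
    heavy-All {ts = ts} ps = All.++⁻ˡ (heavy d ts) (↭ₚ.All-resp-↭ (heavy-light d ts) ps)
    heavies : heavy d ts ~ᶠ heavy d us
    heavies = wholes-injective determined (length (heavy d ts)) ℕ.≤-refl (heavy-All ps) (heavy-All qs)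
      (heavy-weight d ts) (heavy-weight d us)
      (++-cancelʳ (wholes (heavy d ts)) (restᶠ-~ trimmed (suc d))
          (≈-trans (≈-sym (restᶠ-heavy d les)) (≈-trans e (restᶠ-heavy d les′))))
    lights : light d ts ~ᶠ light d us
    -- Each trimmed forest consists of the children of the heavy trees and of the light trees; the
    -- former are similar by now and cancel.
    lights = ~ₚ.dropMiddle {concatMap children (heavy d ts)} [] []
        (H.trans (↭⇒~ᶠ (↭-sym (trimᶠ-heavy-light d les))) (H.trans trimmed
      (H.trans (↭⇒~ᶠ (trimᶠ-heavy-light d les′)) (~ₚ.++⁺ (~ᶠ-sym (concatMap-children-~ heavies))
          (↭⇒~ᶠ ↭-refl)))))

  mutual
    restᶠ-trim : ∀ d ts → restᶠ ts ≈[ d ] restᶠ (trimᶠ d ts)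
    restᶠ-trim d []       = ≈-refl
    restᶠ-trim d (t ∷ ts) = ≈-trans (≈-reflexive (restᶠ-∷ t ts))
        (≈-trans (⊗-cong (factor-trim d t) (restᶠ-trim d ts))
      (≈-reflexive (sym (restᶠ-++ (trim d t) (trimᶠ d ts)))))

    factor-trim : ∀ d t → factor t ≈[ d ] restᶠ (trim d t)
    factor-trim d (node k ts) with treeWeight (node k ts) ℕ.≤? d
    ... | yes _  = ≈-reflexive (sym (trans (restᶠ-∷ (node k ts) []) (⊗-identityʳ _)))
    ... | no ¬le = ++-cong (high-degree (All.map (λ e → subst (d <_) (sym e) (ℕ.≰⇒> ¬le))
        (whole-homogeneous (node k ts)))) (≈-trans (≈-reflexive (rest-node k ts)) (restᶠ-trim d ts))

  restᶠ-injective : ∀ d {ts us} → All P ts → All Q us →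
    All (λ t → treeWeight t ≤ d) ts → All (λ u → treeWeight u ≤ d) us → restᶠ ts ≈[ d ] restᶠ us → ts ~ᶠ us
  restᶠ-injective d {ts} {us} ps qs les les′ e = subst₂ _~ᶠ_ (trimᶠ-light les) (trimᶠ-light les′)
      (go d ℕ.≤-refl)
    where
    go : ∀ c → c ≤ d → trimᶠ c ts ~ᶠ trimᶠ c us
    -- Positive weights leave no tree of weight 0, so the induction starts with empty forests.
    go zero    _   = subst₂ _~ᶠ_ (sym (trimᶠ-zero ts)) (sym (trimᶠ-zero us)) (H.refl [])
    go (suc c) c<d = trim-step c (trimᶠ-All hereditaryᴾ _ ts ps) (trimᶠ-All hereditaryᵠ _ us qs)
        (trimᶠ-bound _ ts) (trimᶠ-bound _ us)
      (≈-trans (≈-sym (restᶠ-trim _ ts)) (≈-trans (≈-weaken c<d e) (restᶠ-trim _ us)))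
      (subst₂ _~ᶠ_ (sym (trimᶠ-trimᶠ ts (ℕ.n≤1+n c))) (sym (trimᶠ-trimᶠ us (ℕ.n≤1+n c))) (go c (ℕ.<⇒≤ c<d)))

-- Partitions with a part of at least half the total weight

-- The sum of all partial derivatives of the monomial: a part is deleted once for each of its
-- occurrences.
rests : Partition → Poly
rests []      = []
rests (a ∷ m) = m ∷ map (a ∷_) (rests m)

rests-↭ : ∀ {m m′} → m ↭ m′ → ∀ d → rests m ≈[ d ] rests m′
rests-↭ ↭.refl d = ≈-refl
rests-↭ (↭.prep a p) d = ∷-cong p (≈-weaken (ℕ.m≤n+m d a) (map-∷-cong a (rests-↭ p d)))
rests-↭ (↭.swap {xs = m} {ys = m′} a b p) d = ≈-trans
  (∷-cong (↭-prep b p) (∷-cong (↭-prep a p) (map-map (rests-↭ p d))))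
  (≈-trans (++-cong {p = (b ∷ m′) ∷ [ a ∷ m′ ]} (++-comm [ b ∷ m′ ] [ a ∷ m′ ])
      (≈-refl {p = map (a ∷_) (map (b ∷_) (rests m′))}))
    (∷-cong ↭-refl (∷-cong ↭-refl (≈-trans (≈-reflexive (sym (map-∘ (rests m′))))
        (≈-trans (map-↭-cong (λ n → ↭-swap a b ↭-refl) (rests m′)) (≈-reflexive (map-∘ (rests m′))))))))
  where
  map-map : ∀ {p q} → p ≈[ d ] q → map (a ∷_) (map (b ∷_) p) ≈[ d ] map (a ∷_) (map (b ∷_) q)
  map-map e = ≈-weaken (ℕ.m≤n+m d a) (map-∷-cong a (≈-weaken (ℕ.m≤n+m d b) (map-∷-cong b e)))
rests-↭ (↭.trans p q) d = ≈-trans (rests-↭ p d) (rests-↭ q d)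

rests-sum : ∀ {P : Pred ℕ 0ℓ} {m} → All P m → All (λ r → ∃ λ e → P e × e + sum r ≡ sum m) (rests m)
rests-sum [] = []
rests-sum {m = a ∷ m} (p ∷ ps) = (a , p , refl) ∷ All.map⁺
    (All.map (λ {r} (e , q , eq) → e , q , trans (lemma e (sum r)) (cong (a +_) eq)) (rests-sum ps))
  where
  open +-*-Solver
  lemma : ∀ e s → e + (a + s) ≡ a + (e + s)
  lemma e s = solve 3 (λ a e s → e :+ (a :+ s) := a :+ (e :+ s)) refl a e s

Small : ℕ → ℕ → Set
Small n e = 2 * e < n

Small-mono : ∀ {n e f} → e ≤ f → Small n f → Small n e
Small-mono le = ℕ.≤-<-trans (ℕ.*-monoʳ-≤ 2 le)

Dominant : ℕ → ℕ × Partition → Set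
Dominant n (a , m) = Total n (a , m) × All (Small n) m

module _ {n d : ℕ} (2d≤n : 2 * d ≤ n) where

  Small-complement : ∀ e f → Small n e → e + f ≡ n → d < f
  Small-complement e f small eq = ℕ.≰⇒> λ f≤d → ℕ.<-irrefl refl (begin-strict
    n + n          ≡⟨ cong₂ _+_ (sym eq) (sym eq) ⟩
    e + f + (e + f) ≡⟨ solve 2 (λ e f → e :+ f :+ (e :+ f) := con 2 :* e :+ con 2 :* f) refl e f ⟩
    2 * e + 2 * f  <⟨ ℕ.+-mono-<-≤ small (ℕ.≤-trans (ℕ.*-monoʳ-≤ 2 f≤d) 2d≤n) ⟩
    n + n          ∎)
    where
    open ℕ.≤-Reasoning
    open +-*-Solver

  rests-small : ∀ a {m} → a + sum m ≡ n → All (Small n) m → All (λ r → d < sum r) (map (a ∷_) (rests m))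
  rests-small a {m} total smalls = All.map⁺ (All.map
      (λ {r} (e , s , eq) → Small-complement e (a + sum r) s (lemma e (sum r) eq)) (rests-sum smalls))
    where
    open +-*-Solver
    lemma : ∀ e s → e + s ≡ sum m → e + (a + s) ≡ n
    lemma e s eq = trans (solve 3 (λ a e s → e :+ (a :+ s) := a :+ (e :+ s)) refl a e s)
        (trans (cong (a +_) eq) total)

  -- Deleting a part below n/2 leaves a degree above n/2, hence above `d`. Only the deletion of the
  -- distinguished part survives the truncation.
  dominant-rests : ∀ {ss} → All (Dominant n) ss → concatMap rests (map (uncurry _∷_) ss) ≈[ d ] map proj₂ ss
  dominant-rests [] = ≈-refl
  dominant-rests {(a , m) ∷ ss} ((total , smalls) ∷ ds) =
      ∷-cong ↭-refl (++-cong {p′ = []} (high-degree (rests-small a total smalls)) (dominant-rests ds))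

∈⇒≤sum : ∀ m → All (λ e → e ≤ sum m) m
∈⇒≤sum []      = []
∈⇒≤sum (a ∷ m) = ℕ.m≤m+n a (sum m) ∷ All.map (λ le → ℕ.≤-trans le (ℕ.m≤n+m (sum m) a)) (∈⇒≤sum m)

splits-small : ∀ {n} t → Small n (treeWeight t) → All (λ (a , m) → All (Small n) (a ∷ m)) (splits t)
splits-small t small = All.map (λ {(a , m)} total →
    All.map (λ le → Small-mono (ℕ.≤-trans le (ℕ.≤-reflexive total)) small) (∈⇒≤sum (a ∷ m))) (splits-total t)

splitsᶠ-small : ∀ {n ts} → All (λ t → Small n (treeWeight t)) ts →
    All (λ (a , m) → All (Small n) m) (splitsᶠ ts)
splitsᶠ-small [] = [] ∷ []
splitsᶠ-small {n} {t ∷ ts} (s ∷ ss) = All.++⁺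
  (All-cartesianProductWith {P = λ (a , m) → All (Small n) (a ∷ m)} All.++⁺ (splits-small t s)
      (splitsᶠ-small ss))
  (All-cartesianProductWith {P = λ (a , m) → All (Small n) (a ∷ m)} (λ { (_ ∷ p) q → All.++⁺ p q })
      (splits-small t s) (splitsᶠ-small ss))

-- A component that avoids the root lies inside one branch at the root, so all its parts are small.
vertex-rests : ∀ {n d} t → treeWeight t ≡ n → 2 * d ≤ n → All (λ u → Small n (treeWeight u)) (children t) →
               concatMap rests (whole t) ≈[ d ] restᶠ (children t)
vertex-rests (node k ts) refl 2d≤n small = ≈-trans
  (dominant-rests 2d≤n (All.zip (splits-total (node k ts) , All.map⁺ (splitsᶠ-small small))))
      (≈-reflexive (rest-node k ts))

-- These parts miss the root, whose weight is positive. Strictness makes them small even when `t`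
-- has exactly half of the weight.
splits-below : ∀ t → All (λ (a , m) → All (_< treeWeight t) m) (splits t)
splits-below (node k ts) = All.map⁺ (All.map (λ {(a , m)} total →
    All.map (λ le → s≤s (ℕ.≤-trans le (ℕ.≤-trans (ℕ.m+n≤o⇒n≤o a (ℕ.≤-reflexive total)) (ℕ.m≤n+m _ k))))
      (∈⇒≤sum m)) (splitsᶠ-total ts))

module _ {d : ℕ} where
  pairs-rests : (f g₁ g₂ : A → Partition) → ∀ {as} → All (λ a → rests (f a) ≈[ d ] g₁ a ∷ g₂ a ∷ []) as →
                concatMap rests (map f as) ≈[ d ] map g₁ as ++ map g₂ as
  pairs-rests f g₁ g₂ [] = ≈-refl
  pairs-rests f g₁ g₂ {a ∷ as} (e ∷ es) = ≈-trans (++-cong e (pairs-rests f g₁ g₂ es))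
      (++-interchange [ g₁ a ] [ g₂ a ] (map g₁ as) (map g₂ as))

-- The two halves u and node k ts play the same role, although the root is chosen in the second.
edge-rests : ∀ {d} k u ts → treeWeight u ≡ d → treeWeight (node k ts) ≡ d →
             concatMap rests (whole (node k (u ∷ ts))) ≈[ d ] restᶠ (u ∷ node k ts ∷ [])
edge-rests {d} k u ts eu ev = ≈-trans (≈-reflexive split-whole) (≈-trans (++-cong cuts keeps) (≈-sym expand))
  where
  v = node k ts
  n = d + d

  2d≤n : 2 * d ≤ n
  2d≤n = ℕ.≤-reflexive (cong (d +_) (ℕ.+-identityʳ d))

  small : ∀ {e} → e < d → Small n e
  small {e} lt = ℕ.+-mono-<-≤ lt (ℕ.≤-trans (ℕ.≤-reflexive (ℕ.+-identityʳ e)) (ℕ.<⇒≤ lt))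

  pairs : List ((ℕ × Partition) × (ℕ × Partition))
  pairs = cartesianProduct (splits u) (splits v)

  Half : ℕ × Partition → Set
  Half (a , m) = Total d (a , m) × All (Small n) m

  half : ∀ t → treeWeight t ≡ d → All Half (splits t)
  half t refl = All.zip (splits-total t , All.map (All.map small) (splits-below t))

  halves : All (λ (s , s′) → Half s × Half s′) pairs
  halves = All-cartesianProductWith {P = Half} {Q = Half} _,_ (half u eu) (half v ev)

  cut′ : (ℕ × Partition) × (ℕ × Partition) → Partition
  cut′ ((a , m) , (b , n)) = b ∷ a ∷ m ++ n

  pairs-map : {R : Set} (f : ℕ × Partition → ℕ × Partition → R) →
      map (uncurry f) pairs ≡ cartesianProductWith f (splits u) (splits v)
  pairs-map f = trans (map-cartesianProductWith (uncurry f) _,_ f id id (λ _ _ → refl) (splits u) (splits v))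
      (cong₂ (cartesianProductWith f) (map-id (splits u)) (map-id (splits v)))

  cut-pairs : map (uncurry _∷_) (map (map₁ (suc k +_)) (cartesianProductWith cut (splits u) (splitsᶠ ts))) ≡ map
      cut′ pairs
  cut-pairs = trans (sym (map-∘ _)) (trans (map-cartesianProductWith _ cut (λ s s′ → cut′ (s , s′)) id
      (map₁ (suc k +_)) (λ _ _ → refl) (splits u) (splitsᶠ ts))
    (trans (cong (λ ss → cartesianProductWith _ ss (splits v)) (map-id (splits u)))
        (sym (pairs-map (λ s s′ → cut′ (s , s′))))))

  keep-pairs : map (map₁ (suc k +_)) (cartesianProductWith keep (splits u) (splitsᶠ ts)) ≡ map
      (uncurry keep) pairs
  keep-pairs = trans (map-cartesianProductWith _ keep keep id (map₁ (suc k +_))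
      (λ (a , m) (b , n) → cong (_, m ++ n) (lemma a b)) (splits u) (splitsᶠ ts))
    (trans (cong (λ ss → cartesianProductWith _ ss (splits v)) (map-id (splits u))) (sym (pairs-map keep)))
    where
    open +-*-Solver
    lemma : ∀ a b → suc k + (a + b) ≡ a + (suc k + b)
    lemma a b = solve 3 (λ k a b → con 1 :+ k :+ (a :+ b) := a :+ (con 1 :+ k :+ b)) refl k a b

  split-whole : concatMap rests (whole (node k (u ∷ ts))) ≡ concatMap rests (map cut′ pairs) ++ concatMap rests
      (map (uncurry _∷_) (map (uncurry keep) pairs))
  split-whole = trans (cong (concatMap rests) (trans
      (cong (map (uncurry _∷_)) (map-++ _ (cartesianProductWith cut (splits u) (splitsᶠ ts)) _))
    (trans (map-++ _ (map (map₁ (suc k +_)) (cartesianProductWith cut (splits u) (splitsᶠ ts))) _)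
        (cong₂ _++_ cut-pairs (cong (map (uncurry _∷_)) keep-pairs)))))
    (List.concatMap-++ rests (map cut′ pairs) _)

  total-sum : ∀ a b m m′ → Total d (a , m) → Total d (b , m′) → a + b + sum (m ++ m′) ≡ n
  total-sum a b m m′ e f = trans (cong (a + b +_) (ℕ.sum-++ m m′))
    (trans (solve 4 (λ a b s s′ → a :+ b :+ (s :+ s′) := (a :+ s) :+ (b :+ s′)) refl a b (sum m) (sum m′))
        (cong₂ _+_ e f))
    where open +-*-Solver

  -- With the halving edge kept, the component through it contains both roots, and all other parts
  -- are below half.
  keeps : concatMap rests (map (uncurry _∷_) (map (uncurry keep) pairs)) ≈[ d ] rest u ⊗ rest v
  keeps = ≈-trans (dominant-rests 2d≤n (All.map⁺ (All.map
      (λ {((a , m) , (b , m′))} ((e , s) , (f , s′)) → total-sum a b m m′ e f , All.++⁺ s s′) halves)))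
    (≈-reflexive (trans (sym (map-∘ pairs)) (trans (map-cartesianProductWith _ _,_ _++_ proj₂ proj₂
        (λ _ _ → refl) (splits u) (splits v)) refl)))

  -- With the halving edge deleted, the root component of either half may be the part removed, which
  -- gives two terms; deleting any other part leaves too high a degree.
  cuts : concatMap rests (map cut′ pairs) ≈[ d ] whole u ⊗ rest v ++ rest u ⊗ whole v
  cuts = ≈-trans (pairs-rests cut′ (λ ((a , m) , (b , m′)) → a ∷ m ++ m′) (λ ((a , m) , (b , m′)) → m ++ b ∷ m′)
      (All.map (λ {((a , m) , (b , m′))} ((e , s) , (f , s′)) → ∷-cong ↭-refl (∷-cong (↭-sym (↭ₚ.shift b m m′))
        (≈-trans (≈-reflexive (sym (map-∘ (rests (m ++ m′)))))
        (≈-trans (map-↭-cong (λ r → ↭-refl) (rests (m ++ m′)))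
        (high-degree (All.map⁺ (All.map (λ {r} h → ℕ.<-≤-trans h (ℕ.≤-reflexive (lemma a b (sum r))))
            (All.map⁻ {f = (a + b) ∷_} (rests-small 2d≤n (a + b) (total-sum a b m m′ e f)
              (All.++⁺ s s′)))))))))) halves))
    (≈-reflexive (cong₂ _++_ (map-cartesianProductWith _ _,_ _++_ (uncurry _∷_) proj₂ (λ _ _ → refl) (splits u)
        (splits v))
                             (map-cartesianProductWith _ _,_ _++_ proj₂ (uncurry _∷_) (λ _ _ → refl) (splits u)
                                 (splits v))))
    where
    open +-*-Solver
    lemma : ∀ a b s → a + b + s ≡ b + (a + s)
    lemma = solve 3 (λ a b s → a :+ b :+ s := b :+ (a :+ s)) refl

  d-positive : 0 < d
  d-positive = subst (0 <_) eu (treeWeight-positive u)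

  -- This is the one term of `factor u ⊗ factor v` that does not come from the edge; its degree is
  -- `d + d`, and `d` is positive.
  both-high : whole u ⊗ whole v ≈[ d ] []
  both-high = high-degree (All-cartesianProductWith {P = λ m → sum m ≡ treeWeight u}
      {Q = λ m → sum m ≡ treeWeight v}
    (λ {m} {m′} e f → ℕ.<-≤-trans (ℕ.m<m+n d d-positive)
        (ℕ.≤-reflexive (sym (trans (ℕ.sum-++ m m′) (cong₂ _+_ (trans e eu) (trans f ev))))))
    (whole-homogeneous u) (whole-homogeneous v))

  expand : restᶠ (u ∷ v ∷ []) ≈[ d ] (whole u ⊗ rest v ++ rest u ⊗ whole v) ++ rest u ⊗ rest v
  expand = ≈-trans (≈-reflexive (trans (restᶠ-∷ u (v ∷ []))
      (cong (factor u ⊗_) (trans (restᶠ-∷ v []) (⊗-identityʳ (factor v))))))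
    (≈-trans (≈-reflexive (⊗-distribʳ (whole u) (rest u) (factor v)))
    (≈-trans (++-cong (≈-trans (⊗-distribˡ (whole u) (whole v) (rest v))
        (++-cong {q = whole u ⊗ rest v} both-high ≈-refl)) (⊗-distribˡ (rest u) (whole v) (rest v)))
    (≈-reflexive (sym (++-assoc (whole u ⊗ rest v) (rest u ⊗ whole v) (rest u ⊗ rest v))))))

-- Unfolding a graph from a vertex

AllPairs-↭ : {R : Rel A 0ℓ} → Symmetric R → ∀ {as bs} → as ↭ bs → AllPairs R as → AllPairs R bs
AllPairs-↭ s ↭.refl         rs                     = rs
AllPairs-↭ s (↭.prep a p)   (r ∷ rs)               = ↭ₚ.All-resp-↭ p r ∷ AllPairs-↭ s p rs
AllPairs-↭ s (↭.swap a b p) ((r ∷ ra) ∷ (rb ∷ rs)) =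
    (s r ∷ ↭ₚ.All-resp-↭ p rb) ∷ ↭ₚ.All-resp-↭ p ra ∷ AllPairs-↭ s p rs
AllPairs-↭ s (↭.trans p q)  rs                     = AllPairs-↭ s q (AllPairs-↭ s p rs)

Unique-↭ : {as bs : List A} → as ↭ bs → Unique as → Unique bs
Unique-↭ = AllPairs-↭ (λ ne eq → ne (sym eq))

Unique-++ˡ : (as : List A) {bs : List A} → Unique (as ++ bs) → Unique as
Unique-++ˡ []       _        = []
Unique-++ˡ (a ∷ as) (u ∷ us) = All.++⁻ˡ as u ∷ Unique-++ˡ as us

Unique-++-disjoint : {a : A} (as : List A) {bs : List A} → Unique (as ++ bs) → a ∈ as → a ∉ bs
Unique-++-disjoint (a ∷ as) (u ∷ us) (here refl) j = All.lookup u (∈-++⁺ʳ as j) refl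
Unique-++-disjoint (a ∷ as) (u ∷ us) (there i)   j = Unique-++-disjoint as us i j

lookup-injective : {as : List A} → Unique as → Injective _≡_ _≡_ (lookup as)
lookup-injective {as = a ∷ as} (u ∷ us) {zero}  {zero}  _  = refl
lookup-injective {as = a ∷ as} (u ∷ us) {zero}  {suc j} eq = contradiction eq (All.lookup u (∈-lookup j))
lookup-injective {as = a ∷ as} (u ∷ us) {suc i} {zero}  eq = contradiction (sym eq) (All.lookup u (∈-lookup i))
lookup-injective {as = a ∷ as} (u ∷ us) {suc i} {suc j} eq = cong suc (lookup-injective us eq)

Unique-length : ∀ {n} {as : List (Fin n)} → Unique as → length as ≤ n
Unique-length us = Fin.injective⇒≤ (lookup-injective us)

-- Greedy pairing: once `a` is paired with `b`, the apartness hypotheses keep `M` total in both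
-- directions on what remains. It serves for lists without repetition, for children of corresponding
-- vertices, and for components.
match : {M : A → B → Set} → ∀ as bs →
  AllPairs (λ a a′ → ∀ b → M a b → ¬ M a′ b) as → AllPairs (λ b b′ → ∀ a → M a b → ¬ M a b′) bs →
  (∀ {a} → a ∈ as → ∃ λ b → b ∈ bs × M a b) → (∀ {b} → b ∈ bs → ∃ λ a → a ∈ as × M a b) →
  ∃ λ bs′ → bs ↭ bs′ × Pointwise M as bs′
match []       []       _ _ _ _ = [] , ↭-refl , []
match []       (b ∷ bs) _ _ _ g with g (here refl)
... | _ , () , _
match {M = M} (a ∷ as) bs (ra ∷ ras) rbs f g
  with b , j , m ← f (here refl)
  with bs₁ , p ← ∈⇒↭ j
  with rb ∷ rbs₁ ← AllPairs-↭ {R = λ b b′ → ∀ a → M a b → ¬ M a b′} (λ r a m m′ → r a m′ m) p rbs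
  = let (bs₂ , q , ms) = match as bs₁ ras rbs₁ f₁ g₁ in b ∷ bs₂ , ↭-trans p (↭-prep b q) , m ∷ ms
  where
  f₁ : ∀ {a′} → a′ ∈ as → ∃ λ b′ → b′ ∈ bs₁ × M a′ b′
  f₁ i with b′ , j′ , m′ ← f (there i) with ↭ₚ.∈-resp-↭ p j′
  ... | here refl = contradiction m′ (All.lookup ra i b m)
  ... | there j″  = b′ , j″ , m′
  g₁ : ∀ {b′} → b′ ∈ bs₁ → ∃ λ a′ → a′ ∈ as × M a′ b′
  g₁ j′ with g (↭ₚ.∈-resp-↭ (↭-sym p) (there j′))
  ... | a′ , here refl , m′ = contradiction m′ (All.lookup rb j′ a m)
  ... | a′ , there i   , m′ = a′ , i , m′

AllPairs-map : {R S : Rel A 0ℓ} → (∀ {a b} → R a b → S a b) → ∀ {as} → AllPairs R as → AllPairs S as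
AllPairs-map f []       = []
AllPairs-map f (r ∷ rs) = All.map f r ∷ AllPairs-map f rs

Unique-↭-ext : {as bs : List A} → Unique as → Unique bs → (∀ {a} → a ∈ as → a ∈ bs) →
    (∀ {a} → a ∈ bs → a ∈ as) → as ↭ bs
Unique-↭-ext {as = as} {bs} u v f g with match {M = _≡_} as bs
    (AllPairs-map (λ ne _ e e′ → ne (trans e (sym e′))) u)
        (AllPairs-map (λ ne _ e e′ → ne (trans (sym e) e′)) v)
    (λ i → _ , f i , refl) (λ j → _ , g j , refl)
... | bs′ , p , es = ↭-trans (↭-reflexive (go es)) (↭-sym p)
  where
  go : ∀ {as bs} → Pointwise _≡_ as bs → as ≡ bs
  go []          = refl
  go (refl ∷ es) = cong (_ ∷_) (go es)

mutual
  flatten : Tree A → List A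
  flatten (node a ts) = a ∷ flattenᶠ ts

  flattenᶠ : List (Tree A) → List A
  flattenᶠ []       = []
  flattenᶠ (t ∷ ts) = flatten t ++ flattenᶠ ts

mutual
  mapTree : (A → B) → Tree A → Tree B
  mapTree f (node a ts) = node (f a) (mapTrees f ts)

  mapTrees : (A → B) → List (Tree A) → List (Tree B)
  mapTrees f []       = []
  mapTrees f (t ∷ ts) = mapTree f t ∷ mapTrees f ts

mapTrees-map : (f : A → B) (ts : List (Tree A)) → mapTrees f ts ≡ map (mapTree f) ts
mapTrees-map f []       = refl
mapTrees-map f (t ∷ ts) = cong (_ ∷_) (mapTrees-map f ts)

label∈flatten : (t : Tree A) → label t ∈ flatten t
label∈flatten (node a ts) = here refl

flatten⊆flattenᶠ : ∀ {a} {t : Tree A} {ts} → t ∈ ts → a ∈ flatten t → a ∈ flattenᶠ ts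
flatten⊆flattenᶠ (here refl) i = ∈-++⁺ˡ i
flatten⊆flattenᶠ {ts = t ∷ ts} (there j) i = ∈-++⁺ʳ (flatten t) (flatten⊆flattenᶠ j i)

∈-flattenᶠ⁻ : ∀ {a : A} ts → a ∈ flattenᶠ ts → ∃ λ t → t ∈ ts × a ∈ flatten t
∈-flattenᶠ⁻ (t ∷ ts) i with ∈-++⁻ (flatten t) i
... | inj₁ j = t , here refl , j
... | inj₂ j with u , k , l ← ∈-flattenᶠ⁻ ts j = u , there k , l

-- Unfolding Adj p t: the tree t is spanned by walking away from its root without ever going back,
-- where p is the vertex (if any) from which the root was reached.
data Unfolding {V : Set} (Adj : Rel V 0ℓ) : Maybe V → Tree V → Set where
  node : ∀ {p v ts} → Unique (map label ts) →
         (∀ {t} → t ∈ ts → Adj v (label t) × just (label t) ≢ p) →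
         (∀ {u} → Adj v u → just u ≢ p → u ∈ map label ts) →
         All (Unfolding Adj (just v)) ts → Unfolding Adj p (node v ts)

module _ {V V′ : Set} {Adj : Rel V 0ℓ} {Adj′ : Rel V′ 0ℓ} (ρ : V → V′ → Set) {D : Pred V 0ℓ} {D′ : Pred V′ 0ℓ}
         (f : V → ℕ) (f′ : V′ → ℕ)
         (agree : ∀ {u u′} → ρ u u′ → f u ≡ f′ u′)
         (injective : ∀ {u v u′} → ρ u u′ → ρ v u′ → u ≡ v)
         (functional : ∀ {u u′ v′} → ρ u u′ → ρ u v′ → u′ ≡ v′)
         (forth : ∀ {v v′ u} → ρ v v′ → D u → Adj v u → ∃ λ u′ → ρ u u′ × Adj′ v′ u′)
         (back : ∀ {v v′ u′} → ρ v v′ → D′ u′ → Adj′ v′ u′ → ∃ λ u → ρ u u′ × Adj v u) where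

  private
    ParentsAgree : Maybe V → Maybe V′ → Set
    ParentsAgree p p′ = ∀ {u u′} → ρ u u′ → (just u ≡ p → just u′ ≡ p′) × (just u′ ≡ p′ → just u ≡ p)

  mutual
    -- An isomorphism of branches says nothing about vertices outside them, so `forth` and `back`
    -- transfer an edge only towards `D` or `D′`. `ParentsAgree` keeps the step back to the parent
    -- from being matched with a step to a child.
    bisimilar⇒~ : ∀ {p p′ t t′} → Unfolding Adj p t → Unfolding Adj′ p′ t′ → All D (flatten t) →
        All D′ (flatten t′) →
                  ParentsAgree p p′ → ρ (label t) (label t′) → mapTree f t ~ mapTree f′ t′
    bisimilar⇒~ {p} {p′} {node v ts} {node v′ ts′} (node u sound complete us) (node u′ sound′ complete′ us′)
        (_ ∷ ds) (_ ∷ ds′) pp r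
      = let (ts″ , perm , ms) = match {M = λ t t′ → ρ (label t) (label t′)} ts ts′
              (AllPairs-map (λ ne _ r r′ → ne (injective r r′)) (AllPairs.map⁻ u))
              (AllPairs-map (λ ne _ r r′ → ne (functional r r′)) (AllPairs.map⁻ u′))
              forth′ back′ in
        subst (λ k → node (f v) (mapTrees f ts) ~ node k (mapTrees f′ ts′)) (agree r) (node (H.trans
          (H.refl (bisimilar⇒~ᶠ us (↭ₚ.All-resp-↭ perm us′) (allD ts ds) (↭ₚ.All-resp-↭ perm (allD ts′ ds′))
              (λ r₁ → parents r₁) ms))
          (↭⇒~ᶠ (subst₂ _↭_ (sym (mapTrees-map f′ ts″)) (sym (mapTrees-map f′ ts′))
              (↭ₚ.map⁺ (mapTree f′) (↭-sym perm))))))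
      where
      allD : ∀ {V : Set} {D : Pred V 0ℓ} (ts : List (Tree V)) → All D (flattenᶠ ts) →
          All (λ t → All D (flatten t)) ts
      allD []       _  = []
      allD (t ∷ ts) ds = All.++⁻ˡ (flatten t) ds ∷ allD ts (All.++⁻ʳ (flatten t) ds)
      parents : ParentsAgree (just v) (just v′)
      parents r₁ = (λ { refl → cong just (functional r₁ r) }) , (λ { refl → cong just (injective r₁ r) })
      forth′ : ∀ {t} → t ∈ ts → ∃ λ t′ → t′ ∈ ts′ × ρ (label t) (label t′)
      forth′ {t} i with a , ne ← sound i
        with u′ , r₁ , a′ ← forth r (All.lookup (All.lookup (allD ts ds) i) (label∈flatten t)) a
        with t′ , j , refl ← ∈-map⁻ label (complete′ a′ (λ e → ne (proj₂ (pp r₁) e))) = t′ , j , r₁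
      back′ : ∀ {t′} → t′ ∈ ts′ → ∃ λ t → t ∈ ts × ρ (label t) (label t′)
      back′ {t′} i with a , ne ← sound′ i
        with u₁ , r₁ , a₁ ← back r (All.lookup (All.lookup (allD ts′ ds′) i) (label∈flatten t′)) a
        with t , j , refl ← ∈-map⁻ label (complete a₁ (λ e → ne (proj₁ (pp r₁) e))) = t , j , r₁

    bisimilar⇒~ᶠ : ∀ {p p′ ts ts′} → All (Unfolding Adj p) ts → All (Unfolding Adj′ p′) ts′ →
                   All (λ t → All D (flatten t)) ts → All (λ t → All D′ (flatten t)) ts′ → ParentsAgree p p′ →
                   Pointwise (λ t t′ → ρ (label t) (label t′)) ts ts′ →
                       Pointwise _~_ (mapTrees f ts) (mapTrees f′ ts′)
    bisimilar⇒~ᶠ [] [] _ _ _ [] = []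
    bisimilar⇒~ᶠ (u ∷ us) (u′ ∷ us′) (d ∷ ds) (d′ ∷ ds′) pp (r ∷ rs) =
        bisimilar⇒~ u u′ d d′ (λ r₁ → pp r₁) r ∷ bisimilar⇒~ᶠ us us′ ds ds′ (λ r₁ → pp r₁) rs

-- Walks in acyclic graphs, and existence of unfoldings

module Walks {n : ℕ} {Adj : Rel (Fin n) 0ℓ} (Adj-sym : Symmetric Adj) (Adj-irrefl : ∀ {u} → ¬ Adj u u)
             (acyclic : ∀ v vs → ¬ (2 ≤ length vs × Unique (v ∷ vs) × Linked Adj (v ∷ vs ++ [ v ]))) where

  private
    V = Fin n

  -- Walks that never turn back, latest vertex first.
  data Walk : List V → Set where
    [-]   : ∀ {v} → Walk [ v ]
    first : ∀ {u v} → Adj u v → Walk (u ∷ [ v ])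
    next  : ∀ {u v w l} → Adj u v → u ≢ w → Walk (v ∷ w ∷ l) → Walk (u ∷ v ∷ w ∷ l)

  walk⇒linked : ∀ {l} → Walk l → Linked Adj l
  walk⇒linked [-]          = [-]
  walk⇒linked (first a)    = a ∷ [-]
  walk⇒linked (next a _ p) = a ∷ walk⇒linked p

  linked-prefix : ∀ l {v m} → Linked Adj (l ++ v ∷ m) → Linked Adj (l ++ [ v ])
  linked-prefix []            _        = [-]
  linked-prefix (u ∷ [])      (a ∷ _)  = a ∷ [-]
  linked-prefix (u ∷ v ∷ l)   (a ∷ as) = a ∷ linked-prefix (v ∷ l) as

  adjacent⇒≢ : ∀ {u v} → Adj u v → u ≢ v
  adjacent⇒≢ a refl = Adj-irrefl a

  -- A repeated vertex would close a cycle.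
  walk⇒unique : ∀ {l} → Walk l → Unique l
  walk⇒unique [-]       = [] ∷ []
  walk⇒unique (first a) = (adjacent⇒≢ a ∷ []) ∷ [] ∷ []
  walk⇒unique (next {u} {v} {w} {l} a u≢w p) = (adjacent⇒≢ a ∷ u≢w ∷ All.tabulate fresh) ∷ walk⇒unique p
    where
    fresh : ∀ {y} → y ∈ l → u ≢ y
    fresh i refl with l₁ , l₂ , refl ← ∈-∃++ i = acyclic u (v ∷ w ∷ l₁)
      ( s≤s (s≤s z≤n)
      , Unique-++ˡ (u ∷ v ∷ w ∷ l₁) (Unique-↭ (↭ₚ.shift u (v ∷ w ∷ l₁) l₂) (walk⇒unique p))
      , a ∷ linked-prefix (v ∷ w ∷ l₁) (walk⇒linked p) )

  -- Ties the parent in an unfolding to the walk `l` that lies behind: the parent is its latest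
  -- vertex, and without a parent the walk has just begun.
  Extends : Maybe V → List V → Set
  Extends nothing  l = l ≡ []
  Extends (just p) l = ∃ λ m → l ≡ p ∷ m

  extend : ∀ {p u v l} → Extends p l → Walk (v ∷ l) → Adj v u → just u ≢ p → Walk (u ∷ v ∷ l)
  extend {nothing} refl       wk a _  = first (Adj-sym a)
  extend {just p}  (m , refl) wk a ne = next (Adj-sym a) (λ e → ne (cong just e)) wk

  module _ (Adj? : ∀ u v → Dec (Adj u v)) where
    neighbour? : ∀ p v u → Dec (Adj v u × just u ≢ p)
    neighbour? p v u = Adj? v u ×-dec ¬? (Maybe.≡-dec Fin._≟_ (just u) p)

    unfold : ℕ → Maybe V → V → Tree V
    unfold zero    p v = node v []
    unfold (suc k) p v = node v (map (unfold k (just v)) (filter (neighbour? p v) (allFin n)))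

    label-unfold : ∀ k p v → label (unfold k p v) ≡ v
    label-unfold zero    p v = refl
    label-unfold (suc k) p v = refl

    -- The fuel cannot run out: a walk that never turns back has distinct vertices, so at most `n`,
    -- while fuel and length together stay above `n`.
    unfold-unfolding : ∀ k {p v l} → Extends p l → Walk (v ∷ l) → n < k + length (v ∷ l) →
        Unfolding Adj p (unfold k p v)
    unfold-unfolding zero    ex wk lt = contradiction lt (ℕ.≤⇒≯ (Unique-length (walk⇒unique wk)))
    unfold-unfolding (suc k) {p} {v} {l} ex wk lt = node
      (subst Unique (sym labels) (Unique.filter⁺ (neighbour? p v) (Unique.allFin⁺ n)))
      (λ i → let j = subst (_ ∈_) labels (∈-map⁺ label i) in proj₂
          (∈-filter⁻ (neighbour? p v) {xs = allFin n} j))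
      (λ a ne → subst (_ ∈_) (sym labels) (∈-filter⁺ (neighbour? p v) (∈-allFin _) (a , ne)))
      (All.map⁺ (All.tabulate λ i → let (a , ne) = proj₂ (∈-filter⁻ (neighbour? p v) {xs = allFin n} i) in
        unfold-unfolding k (l , refl) (extend ex wk a ne) (ℕ.<-≤-trans lt (ℕ.≤-reflexive (sym (ℕ.+-suc k _))))))
      where
      labels : map label (map (unfold k (just v)) (filter (neighbour? p v) (allFin n))) ≡ filter
          (neighbour? p v) (allFin n)
      labels = trans (sym (map-∘ _)) (trans (map-cong (label-unfold k (just v)) _) (map-id _))

  mutual
    -- Prolongs the walk that reached the root of `t` down to `a`; as its vertices are distinct,
    -- nothing below repeats a vertex of `l`.
    descend : ∀ {p t l a} → Unfolding Adj p t → Extends p l → Walk (label t ∷ l) → a ∈ flatten t →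
              ∃ λ k → a ∈ k × Walk (k ++ l)
    descend {t = node v ts} _ ex wk (here refl) = [ v ] , here refl , wk
    descend {t = node v ts} {l} (node _ sound _ us) ex wk (there i)
      with k , j , wk′ ← descendᶠ us (l , refl) (λ {t} i → let (a , ne) = sound i in extend ex wk a ne) i =
      k ++ [ v ] , ∈-++⁺ˡ j , subst Walk (sym (++-assoc k [ v ] l)) wk′

    descendᶠ : ∀ {p ts l a} → All (Unfolding Adj p) ts → Extends p l →
        (∀ {t} → t ∈ ts → Walk (label t ∷ l)) → a ∈ flattenᶠ ts →
               ∃ λ k → a ∈ k × Walk (k ++ l)
    descendᶠ {ts = t ∷ ts} (u ∷ us) ex wks i with ∈-++⁻ (flatten t) i
    ... | inj₁ j = descend u ex (wks (here refl)) j
    ... | inj₂ j = descendᶠ us ex (λ i → wks (there i)) j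

  mutual
    -- Runs in the other direction, through the root and on to `q`, so that it can be prolonged into
    -- a sibling branch.
    ascend : ∀ {q t a} → Unfolding Adj (just q) t → Adj q (label t) → a ∈ flatten t →
             ∃ λ l → a ∈ label t ∷ l × Walk (q ∷ label t ∷ l)
    ascend {t = node v ts} _ e (here refl) = [] , here refl , first e
    ascend {q} {node v ts} (node _ sound _ us) e (there i)
      with t , j , l , k , wk ← ascendᶠ us (λ j → proj₁ (sound j)) i =
      label t ∷ l , there k , next e (λ eq → proj₂ (sound j) (cong just (sym eq))) wk

    ascendᶠ : ∀ {q ts a} → All (Unfolding Adj (just q)) ts →
        (∀ {t} → t ∈ ts → Adj q (label t)) → a ∈ flattenᶠ ts →
              ∃ λ t → t ∈ ts × ∃ λ l → a ∈ label t ∷ l × Walk (q ∷ label t ∷ l)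
    ascendᶠ {ts = t ∷ ts} (u ∷ us) es i with ∈-++⁻ (flatten t) i
    ... | inj₁ j = t , here refl , ascend u (es (here refl)) j
    ... | inj₂ j with t′ , k , r ← ascendᶠ us (λ i → es (there i)) j = t′ , there k , r

  parent∉flatten : ∀ {q t} → Unfolding Adj (just q) t → Adj q (label t) → q ∉ flatten t
  parent∉flatten {q} u e i with k , j , wk ← descend {l = [ q ]} u ([] , refl) (first (Adj-sym e)) i =
    Unique-++-disjoint k (walk⇒unique wk) j (here refl)

  -- A common vertex would occur twice on a walk that climbs from it to `q` and descends to it again
  -- through the sibling.
  siblings-disjoint : ∀ {q t t′ a} → Unfolding Adj (just q) t → Unfolding Adj (just q) t′ → Adj q (label t) →
      Adj q (label t′) →
                      label t′ ≢ label t → a ∈ flatten t → a ∉ flatten t′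
  siblings-disjoint u u′ e e′ ne i i′ with l , j , wk ← ascend u e i
    with k , j′ , wk′ ← descend u′ (_ , refl) (next (Adj-sym e′) ne wk) i′ =
        Unique-++-disjoint k (walk⇒unique wk′) j′ (there j)

  mutual
    flatten-unique : ∀ {p t} → Unfolding Adj p t → Unique (flatten t)
    flatten-unique {t = node v ts} (node uniq sound _ us) =
      All.tabulate (λ i eq → let (t , j , k) = ∈-flattenᶠ⁻ ts i in
        parent∉flatten (All.lookup us j) (proj₁ (sound j)) (subst (_∈ flatten t) (sym eq) k))
      ∷ flattenᶠ-unique uniq (λ i → proj₁ (sound i)) us

    flattenᶠ-unique : ∀ {q ts} → Unique (map label ts) →
        (∀ {t} → t ∈ ts → Adj q (label t)) → All (Unfolding Adj (just q)) ts → Unique (flattenᶠ ts)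
    flattenᶠ-unique _ _ [] = []
    flattenᶠ-unique {ts = t ∷ ts} (ne ∷ uniq) es (u ∷ us) =
        Unique.++⁺ (flatten-unique u) (flattenᶠ-unique uniq (λ i → es (there i)) us)
      λ (i , j) → let (t′ , k , l) = ∈-flattenᶠ⁻ ts j in
        siblings-disjoint u (All.lookup us k) (es (here refl)) (es (there k))
            (λ eq → All.lookup ne (∈-map⁺ label k) (sym eq)) i l

  -- At every vertex the children are all neighbours except the parent, so a branch can be left only
  -- from its root.
  neighbours-in-flatten : ∀ {p t u y} → Unfolding Adj p t → u ∈ flatten t → Adj u y →
      (u ≡ label t × just y ≡ p) ⊎ y ∈ flatten t
  neighbours-in-flatten {p} {node v ts} {u} {y} (node _ sound complete us)
      (here refl) a with Maybe.≡-dec Fin._≟_ (just y) p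
  ... | yes eq = inj₁ (refl , eq)
  ... | no ne with t , i , refl ← ∈-map⁻ label (complete a ne) =
      inj₂ (there (flatten⊆flattenᶠ i (label∈flatten t)))
  neighbours-in-flatten {p} {node v ts} {u} {y} (node _ sound complete us) (there i) a = inj₂ (go us i)
    where
    go : ∀ {ts} → All (Unfolding Adj (just v)) ts → u ∈ flattenᶠ ts → y ∈ v ∷ flattenᶠ ts
    go {t ∷ ts} (w ∷ ws) i with ∈-++⁻ (flatten t) i
    ... | inj₁ j with neighbours-in-flatten w j a
    ...   | inj₁ (_ , refl) = here refl
    ...   | inj₂ k          = there (∈-++⁺ˡ k)
    go {t ∷ ts} (w ∷ ws) i | inj₂ j with go ws j
    ...   | here eq = here eq
    ...   | there k = there (∈-++⁺ʳ (flatten t) k)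

  mutual
    flatten-induction : ∀ {p t} {P : Pred V 0ℓ} → Unfolding Adj p t → P (label t) →
                        (∀ {a b} → a ∈ flatten t → b ∈ flatten t → Adj a b → P a → P b) → All P (flatten t)
    flatten-induction {t = node v ts} {P} (node _ sound _ us) base step =
      base ∷ flattenᶠ-induction us (λ {t} i → step (here refl) (there (flatten⊆flattenᶠ i (label∈flatten t)))
          (proj₁ (sound i)) base)
                                   (λ i j → step (there i) (there j))

    flattenᶠ-induction : ∀ {p ts} {P : Pred V 0ℓ} → All (Unfolding Adj p) ts → (∀ {t} → t ∈ ts → P (label t)) →
                         (∀ {a b} → a ∈ flattenᶠ ts → b ∈ flattenᶠ ts → Adj a b → P a → P b) →
                             All P (flattenᶠ ts)
    flattenᶠ-induction [] _ _ = []
    flattenᶠ-induction {ts = t ∷ ts} (u ∷ us) base step = All.++⁺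
      (flatten-induction u (base (here refl)) (λ i j → step (∈-++⁺ˡ i) (∈-++⁺ˡ j)))
      (flattenᶠ-induction us (λ i → base (there i)) (λ i j →
          step (∈-++⁺ʳ (flatten t) i) (∈-++⁺ʳ (flatten t) j)))

  spanning : ∀ {t} → (∀ u v → Star Adj u v) → Unfolding Adj nothing t → ∀ v → v ∈ flatten t
  spanning {t} connected u v = go (label∈flatten t) (connected (label t) v)
    where
    go : ∀ {a b} → a ∈ flatten t → Star Adj a b → b ∈ flatten t
    go i ε = i
    go i (e ◅ es) with neighbours-in-flatten u i e
    ... | inj₂ j = go j es

-- Branches as shapes

module TreeFacts (T : WeightedTree) where
  open WeightedTree T public
  open IsTree isTree public
  open Walks {Adj = Adj} symmetric (irreflexive refl) acyclic public

  ω : V → ℕ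
  ω = pred ∘ w

  suc-ω : ∀ v → suc (ω v) ≡ w v
  suc-ω v with w v | w-positive v
  ... | suc k | _ = refl

  mutual
    weights-mapTree : ∀ t → weights (mapTree ω t) ≡ map w (flatten t)
    weights-mapTree (node v ts) = cong₂ _∷_ (suc-ω v) (weights-mapTrees ts)

    weights-mapTrees : ∀ ts → weightsᶠ (mapTrees ω ts) ≡ map w (flattenᶠ ts)
    weights-mapTrees []       = refl
    weights-mapTrees (t ∷ ts) = trans (cong₂ _++_ (weights-mapTree t) (weights-mapTrees ts))
        (sym (map-++ w (flatten t) _))

  treeWeight-mapTree : ∀ t → treeWeight (mapTree ω t) ≡ weight (flatten t)
  treeWeight-mapTree t = cong sum (weights-mapTree t)

  length≤weight : ∀ vs → length vs ≤ weight vs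
  length≤weight []       = z≤n
  length≤weight (v ∷ vs) = ℕ.+-mono-≤ (w-positive v) (length≤weight vs)

  covering : ∀ {vs} → Unique vs → order ≤ length vs → vs ↭ vertices
  covering {vs} u le = Unique-↭-ext u (Unique.allFin⁺ order) (λ _ → ∈-allFin _) (λ {v} _ → member v)
    where
    member : ∀ v → v ∈ vs
    member v with Any.any? (v Fin.≟_) vs
    ... | yes i = i
    ... | no ni = contradiction (Unique-length {as = v ∷ vs}
        (All.tabulate (λ i e → ni (subst (_∈ vs) (sym e) i)) ∷ u)) (ℕ.<⇒≱ (s≤s le))

  unfolding-covers : ∀ {t} → Unfolding Adj nothing t → flatten t ↭ vertices
  unfolding-covers u = Unique-↭-ext (flatten-unique u) (Unique.allFin⁺ order) (λ _ → ∈-allFin _)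
      (λ {v} _ → spanning connected u v)

  unfoldAt : V → Tree V
  unfoldAt v = unfold (λ u v → T? (adj u v)) order nothing v

  unfoldAt-unfolding : ∀ v → Unfolding Adj nothing (unfoldAt v)
  unfoldAt-unfolding v = unfold-unfolding (λ u v → T? (adj u v)) order refl [-]
      (ℕ.≤-reflexive (ℕ.+-comm 1 order))

  -- Exactly half of the weight is allowed, since both sides of a halving edge have to count as
  -- branches.
  record Branch (t : Tree V) : Set where
    constructor branch
    field
      {parent} : V
      unfolds  : Unfolding Adj (just parent) t
      joined   : Adj parent (label t)
      half     : 2 * weight (flatten t) ≤ totalWeight

  branch-children : ∀ {v ts} → Branch (node v ts) → All Branch ts
  branch-children {v} {ts} (branch (node _ sound _ us) _ half) = All.tabulate λ i →
    branch (All.lookup us i) (proj₁ (sound i)) (ℕ.≤-trans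
        (ℕ.*-monoʳ-≤ 2 (ℕ.≤-trans (part i) (ℕ.m≤n+m _ (w v)))) half)
    where
    part : ∀ {t ts} → t ∈ ts → weight (flatten t) ≤ weight (flattenᶠ ts)
    part {t} {t ∷ ts} (here refl) = subst (weight (flatten t) ≤_)
        (sym (trans (cong sum (map-++ w (flatten t) _)) (ℕ.sum-++ (map w (flatten t)) _))) (ℕ.m≤m+n _ _)
    part {t} {t′ ∷ ts} (there i) = subst (weight (flatten t) ≤_)
        (sym (trans (cong sum (map-++ w (flatten t′) _)) (ℕ.sum-++ (map w (flatten t′)) _)))
      (ℕ.≤-trans (part i) (ℕ.m≤n+m _ (weight (flatten t′))))

  module _ (unit-leaves : ∀ v → Leaf v → w v ≡ 1) {t : Tree V} (b : Branch t)
      (big : 2 ≤ length (flatten t)) where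
    open Branch b

    private
      l : List V
      l = flatten t

      q∉l : parent ∉ l
      q∉l = parent∉flatten unfolds joined

      l-unique : Unique l
      l-unique = flatten-unique unfolds

      ql-unique : Unique (parent ∷ l)
      ql-unique = All.tabulate (λ i e → q∉l (subst (_∈ l) (sym e) i)) ∷ l-unique

    embed-injective : Injective _≡_ _≡_ (lookup l)
    embed-injective = lookup-injective l-unique

    positions : ∀ {v} → v ∈ l → ∃ λ i → lookup l i ≡ v
    positions i = Any.index i , sym (Any.lookup-index i)

    shapeRoot : Fin (length l)
    shapeRoot = proj₁ (positions (label∈flatten t))

    shapeRoot-label : lookup l shapeRoot ≡ label t
    shapeRoot-label = proj₂ (positions (label∈flatten t))

    private
      -- When the branch and its parent exhaust the vertices, the root of the branch is the only
      -- possible neighbour of the parent.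
      leaf-parent : order ≤ suc (length l) → Leaf parent
      leaf-parent le = ↭ₚ.↭-length (Unique-↭-ext {bs = [ label t ]}
          (Unique.filter⁺ (λ u → T? (adj parent u)) (Unique.allFin⁺ order)) ([] ∷ [])
        (λ {u} i → here (only-root (proj₂ (∈-filter⁻ (λ u → T? (adj parent u)) {xs = vertices} i))))
        (λ { (here refl) → ∈-filter⁺ (λ u → T? (adj parent u)) (∈-allFin _) joined }))
        where
        only-root : ∀ {u} → Adj parent u → u ≡ label t
        only-root {u} a with ↭ₚ.∈-resp-↭ (↭-sym (covering ql-unique le)) (∈-allFin u)
        ... | here refl = contradiction a (irreflexive refl)
        ... | there i with neighbours-in-flatten unfolds i (symmetric a)
        ...   | inj₁ (eq , _) = eq
        ...   | inj₂ j        = contradiction j q∉l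

      -- If only the parent were outside, it would be a leaf, of weight 1. The branch, having at
      -- most half of the total, would then weigh at most 1, but two vertices weigh at least 2.
      shape-size : length l + 2 ≤ order
      shape-size = ℕ.≮⇒≥ λ lt → let le = ℕ.≤-pred (ℕ.≤-trans lt (ℕ.≤-reflexive (ℕ.+-comm (length l) 2))) in
        ℕ.<⇒≱ big (ℕ.≤-trans (length≤weight l) (ℕ.+-cancelˡ-≤ (weight l) _ _ (begin
          weight l + weight l       ≡⟨ cong (weight l +_) (sym (ℕ.+-identityʳ _)) ⟩
          2 * weight l              ≤⟨ half ⟩
          totalWeight               ≡⟨ sym (ℕ.sum-↭ (↭ₚ.map⁺ w (covering ql-unique le))) ⟩
          w parent + weight l       ≡⟨ cong (_+ weight l) (unit-leaves parent (leaf-parent le)) ⟩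
          1 + weight l              ≡⟨ ℕ.+-comm 1 (weight l) ⟩
          weight l + 1              ∎)))
        where open ℕ.≤-Reasoning

      shapeGraph : Graph
      shapeGraph = record
        { order       = length l
        ; adj         = λ i j → adj (lookup l i) (lookup l j)
        ; symmetric   = symmetric
        ; irreflexive = λ { refl → irreflexive refl }
        }
      module S = Graph shapeGraph

      from-root : All (λ v → ∀ j → lookup l j ≡ v → Star S.Adj shapeRoot j) l
      from-root = flatten-induction unfolds (λ j eq →
          subst (Star S.Adj shapeRoot) (embed-injective (trans shapeRoot-label (sym eq))) ε)
        λ { {a} {b} i j e ps k refl → let (m , eq) = positions i in ps m eq ◅◅
            (subst (λ c → Adj c b) (sym eq) e ◅ ε) }

      within : All (λ v → Star (AdjWithout (label t) parent) (label t) v) l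
      within = flatten-induction unfolds ε λ {a} {b} i j e s → s ◅◅ ((e , removed i j) ◅ ε)
        where
        removed : ∀ {a b} → a ∈ l → b ∈ l → ¬ ((a ≡ label t × b ≡ parent) ⊎ (a ≡ parent × b ≡ label t))
        removed i j (inj₁ (_ , refl)) = q∉l j
        removed i j (inj₂ (refl , _)) = q∉l i

      closed : ∀ {a b} → a ∈ l → Star (AdjWithout (label t) parent) a b → b ∈ l
      closed i ε = i
      closed i ((e , ne) ◅ es) with neighbours-in-flatten unfolds i e
      ... | inj₁ (refl , refl) = contradiction (inj₁ (refl , refl)) ne
      ... | inj₂ j             = closed j es

    shape : RootedWeightedTree
    shape = record
      { tree = record
        { weightedGraph = record { graph = shapeGraph ; w = w ∘ lookup l ; w-positive = w-positive ∘ lookup l }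
        ; isTree = record
          { nonempty  = ℕ.<⇒≤ big
          ; connected = λ i j → Star.reverse symmetric (All.lookup from-root (∈-lookup i) i refl) ◅◅ All.lookup
              from-root (∈-lookup j) j refl
          ; acyclic   = λ i is (long , unique , linked) → acyclic (lookup l i) (map (lookup l) is)
              ( subst (2 ≤_) (sym (length-map (lookup l) is)) long
              , Unique.map⁺ embed-injective unique
              , subst (Linked Adj) (map-++ (lookup l) (i ∷ is) [ i ]) (Linked.map⁺ linked) )
          }
        }
      ; root = shapeRoot
      }

    shape-isShape : IsShape shape T
    shape-isShape = record
      { size-lower = big
      ; size-upper = shape-size
      ; end        = label t
      ; other      = parent
      ; edge       = symmetric joined
      ; embed      = lookup l
      ; injective  = embed-injective
      ; image      = λ v → mk⇔ (λ { (i , refl) → All.lookup within (∈-lookup i) })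
          (λ s → positions (closed (label∈flatten t) s))
      ; adjacency  = λ i j → mk⇔ (λ a → a , λ { (inj₁ (_ , e)) →
          q∉l (subst (_∈ l) e (∈-lookup j)) ; (inj₂ (e , _)) → q∉l (subst (_∈ l) e (∈-lookup i)) }) proj₁
      ; weights    = λ _ → refl
      ; roots      = shapeRoot-label
      }

    shape-Ex : RootedWeightedTree.Ex shape ≡ map w l
    shape-Ex = trans (map-∘ (allFin (length l))) (cong (map w)
        (trans (List.map-tabulate id (lookup l)) (List.tabulate-lookup l)))

    parent∉shape : ∀ i → lookup l i ≢ parent
    parent∉shape i e = q∉l (subst (_∈ l) e (∈-lookup i))

module _ (T T′ : WeightedTree) where
  private
    module T  = TreeFacts T
    module T′ = TreeFacts T′

  module _ (unit-leaves : ∀ v → T.Leaf v → T.w v ≡ 1) (unit-leaves′ : ∀ v → T′.Leaf v → T′.w v ≡ 1)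
           (shapes-determined : ∀ {S S′} → IsShape S T → IsShape S′ T′ →
             2 * RootedWeightedTree.totalWeight S ≤ T.totalWeight →
             RootedWeightedTree.Ex S′ ↭ RootedWeightedTree.Ex S → S′ ≅ᵣ S) where

    -- A single vertex is not a shape, but its weight determines it. Any larger branch is a shape,
    -- and the r-isomorphism that goodness supplies becomes a bisimulation of the unfoldings.
    branch-determined : ∀ {t t′} → T.Branch t → T′.Branch t′ → map T.w (flatten t) ↭ map T′.w (flatten t′) →
                        mapTree T.ω t ~ mapTree T′.ω t′
    branch-determined {node v []} {node v′ []} b b′ p =
      subst (λ k → node (T.ω v) [] ~ node k []) (cong pred (singleton p)) ~-refl
      where
      singleton : ∀ {i j : ℕ} → [ i ] ↭ [ j ] → i ≡ j
      singleton p with refl ← ↭ₚ.↭-singleton-inv p = refl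
    branch-determined {node v []} {node v′ (node u ts ∷ us)} b b′ p = contradiction (↭ₚ.↭-length p) λ ()
    branch-determined {node v (node u ts ∷ us)} {node v′ []} b b′ p = contradiction (↭ₚ.↭-length p) λ ()
    branch-determined {t@(node v (node u ts ∷ us))} {t′@(node v′ (node u′ ts′ ∷ us′))} b b′ p =
      bisimilar⇒~ ρ {D = _∈ flatten t} {D′ = _∈ flatten t′} T.ω T′.ω
        (λ { (i , refl , refl) → cong pred (iso.weights i) })
        (λ { (i , refl , e) (j , refl , e′) → cong (lookup (flatten t) ∘ iso.to)
            (T′.embed-injective unit-leaves′ b′ big′ (trans e (sym e′))) })
        (λ { (i , e , refl) (j , e′ , refl) → cong (lookup (flatten t′))
            (to-injective (T.embed-injective unit-leaves b big (trans e (sym e′)))) })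
        forth back
        (T.Branch.unfolds b) (T′.Branch.unfolds b′) (All.tabulate id) (All.tabulate id)
        -- The parents lie outside the shapes and so are related to nothing: `ParentsAgree` holds
        -- vacuously.
        (λ { (i , e , e′) → (λ { refl → contradiction e (T.parent∉shape unit-leaves b big (iso.to i)) }) ,
            (λ { refl → contradiction e′ (T′.parent∉shape unit-leaves′ b′ big′ i) }) })
        (S′.root , trans (cong (lookup (flatten t)) iso.roots) (T.shapeRoot-label unit-leaves b big) ,
            T′.shapeRoot-label unit-leaves′ b′ big′)
      where
      big : 2 ≤ length (flatten t)
      big = s≤s (s≤s z≤n)
      big′ : 2 ≤ length (flatten t′)
      big′ = s≤s (s≤s z≤n)
      module S  = RootedWeightedTree (T.shape unit-leaves b big)
      module S′ = RootedWeightedTree (T′.shape unit-leaves′ b′ big′)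
      iso : T′.shape unit-leaves′ b′ big′ ≅ᵣ T.shape unit-leaves b big
      iso = shapes-determined (T.shape-isShape unit-leaves b big) (T′.shape-isShape unit-leaves′ b′ big′)
        (subst (λ k → 2 * k ≤ T.totalWeight) (sym (cong sum (T.shape-Ex unit-leaves b big))) (T.Branch.half b))
        (subst₂ _↭_ (sym (T′.shape-Ex unit-leaves′ b′ big′)) (sym (T.shape-Ex unit-leaves b big)) (↭-sym p))
      module iso = _≅ᵣ_ iso
      to-injective : ∀ {i j} → iso.to i ≡ iso.to j → i ≡ j
      to-injective e = trans (sym (Inverse.strictlyInverseʳ iso.bijection _))
          (trans (cong iso.from e) (Inverse.strictlyInverseʳ iso.bijection _))
      -- Vertices at corresponding positions of the two shapes are related; a vertex outside the
      -- branches is related to none.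
      ρ : T.V → T′.V → Set
      ρ u u′ = ∃ λ i → lookup (flatten t) (iso.to i) ≡ u × lookup (flatten t′) i ≡ u′
      forth : ∀ {v v′ u} → ρ v v′ → u ∈ flatten t → T.Adj v u → ∃ λ u′ → ρ u u′ × T′.Adj v′ u′
      forth {u = u} (i , refl , refl) m a with k , refl ← T.positions unit-leaves b big m =
        _ , (iso.from k , cong (lookup (flatten t)) to-from , refl) ,
        Equivalence.from (iso.adjacency i (iso.from k)) (subst (S.Adj (iso.to i)) (sym to-from) a)
        where
        to-from : iso.to (iso.from k) ≡ k
        to-from = Inverse.strictlyInverseˡ iso.bijection k
      back : ∀ {v v′ u′} → ρ v v′ → u′ ∈ flatten t′ → T′.Adj v′ u′ → ∃ λ u → ρ u u′ × T.Adj v u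
      back (i , refl , refl) m a with k , refl ← T′.positions unit-leaves′ b′ big′ m =
        _ , (k , refl , refl) , Equivalence.to (iso.adjacency i k) a

-- Components of spanning subgraphs

subsets-++ : {A : Set} (as bs : List A) → subsets (as ++ bs) ≡ cartesianProductWith _++_ (subsets as)
    (subsets bs)
subsets-++ []       bs = sym (trans (++-identityʳ _) (map-id _))
subsets-++ (a ∷ as) bs = trans (cong₂ _++_ (subsets-++ as bs) (trans (cong (map (a ∷_)) (subsets-++ as bs))
    (trans (map-cartesianProductWith (a ∷_) _++_ _++_ (a ∷_) id (λ _ _ → refl) (subsets as) (subsets bs))
        (cong (cartesianProductWith _++_ (map (a ∷_) (subsets as))) (map-id (subsets bs))))))
  (sym (cartesianProductWith-distribʳ-++ _++_ (subsets as) (map (a ∷_) (subsets as)) (subsets bs)))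

subsets-map : {A B : Set} (f : A → B) (as : List A) → subsets (map f as) ≡ map (map f) (subsets as)
subsets-map f []       = refl
subsets-map f (a ∷ as) = trans (cong (λ s → s ++ map (f a ∷_) s) (subsets-map f as))
  (trans (cong (map (map f) (subsets as) ++_) (trans (sym (map-∘ (subsets as))) (map-∘ (subsets as))))
      (sym (map-++ (map f) (subsets as) _)))

-- Sums over sets of edges, and coefficients

sumℤ : List ℤ.ℤ → ℤ.ℤ
sumℤ = foldr ℤ._+_ ℤ.0ℤ

sumℤ-++ : ∀ as bs → sumℤ (as ++ bs) ≡ sumℤ as ℤ.+ sumℤ bs
sumℤ-++ []       bs = sym (ℤ.+-identityˡ _)
sumℤ-++ (a ∷ as) bs = trans (cong (ℤ._+_ a) (sumℤ-++ as bs)) (sym (ℤ.+-assoc a _ _))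

subsetSum : {A : Set} → (List A → ℤ.ℤ) → List A → ℤ.ℤ
subsetSum f as = sumℤ (map f (subsets as))

subsetSum-cong : {A : Set} {f g : List A → ℤ.ℤ} → (∀ as → f as ≡ g as) → ∀ as → subsetSum f as ≡ subsetSum g as
subsetSum-cong e as = cong sumℤ (map-cong e (subsets as))

subsetSum-∷ : {A : Set} (f : List A → ℤ.ℤ) (a : A) (as : List A) →
    subsetSum f (a ∷ as) ≡ subsetSum f as ℤ.+ subsetSum (f ∘ (a ∷_)) as
subsetSum-∷ f a as = trans (cong sumℤ (map-++ f (subsets as) _)) (trans (sumℤ-++ (map f (subsets as)) _)
  (cong (λ s → subsetSum f as ℤ.+ sumℤ s) (sym (map-∘ (subsets as)))))

-- Reordering the edges also reorders each subset as a list. So invariance concerns the sum of a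
-- function that ignores order, not the list of subsets.
subsetSum-↭ : {A : Set} (f : List A → ℤ.ℤ) → (∀ {as bs} → as ↭ bs → f as ≡ f bs) → ∀ {as bs} → as ↭ bs →
    subsetSum f as ≡ subsetSum f bs
subsetSum-↭ f resp ↭.refl = refl
subsetSum-↭ f resp (↭.prep {as} {bs} a p) = trans (subsetSum-∷ f a as) (trans
  (cong₂ ℤ._+_ (subsetSum-↭ f resp p) (subsetSum-↭ (f ∘ (a ∷_)) (λ q → resp (↭-prep a q)) p))
      (sym (subsetSum-∷ f a bs)))
subsetSum-↭ f resp (↭.swap {as} {bs} a b p) = trans (expand a b as) (trans
  (cong₂ ℤ._+_ (cong₂ ℤ._+_ (subsetSum-↭ f resp p) (subsetSum-↭ (f ∘ (b ∷_)) (λ q → resp (↭-prep b q)) p))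
               (cong₂ ℤ._+_ (subsetSum-↭ (f ∘ (a ∷_)) (λ q → resp (↭-prep a q)) p)
                            (trans (subsetSum-cong (λ as → resp (↭-swap a b ↭-refl)) as)
                                (subsetSum-↭ (f ∘ (b ∷_) ∘ (a ∷_)) (λ q → resp (↭-prep b (↭-prep a q))) p))))
  (trans (interchange (subsetSum f bs) (subsetSum (f ∘ (b ∷_)) bs) (subsetSum (f ∘ (a ∷_)) bs)
      (subsetSum (f ∘ (b ∷_) ∘ (a ∷_)) bs)) (sym (expand b a bs))))
  where
  expand : ∀ a b as → subsetSum f (a ∷ b ∷ as) ≡ (subsetSum f as ℤ.+ subsetSum (f ∘ (b ∷_)) as) ℤ.+
      (subsetSum (f ∘ (a ∷_)) as ℤ.+ subsetSum (f ∘ (a ∷_) ∘ (b ∷_)) as)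
  expand a b as = trans (subsetSum-∷ f a (b ∷ as)) (cong₂ ℤ._+_ (subsetSum-∷ f b as)
      (subsetSum-∷ (f ∘ (a ∷_)) b as))
  interchange : ∀ i j k l → (i ℤ.+ j) ℤ.+ (k ℤ.+ l) ≡ (i ℤ.+ k) ℤ.+ (j ℤ.+ l)
  interchange i j k l = trans (ℤ.+-assoc i j _) (trans
      (cong (ℤ._+_ i) (trans (sym (ℤ.+-assoc j k l)) (trans (cong (ℤ._+ l) (ℤ.+-comm j k)) (ℤ.+-assoc k j l))))
        (sym (ℤ.+-assoc i k _)))
subsetSum-↭ f resp (↭.trans p q) = trans (subsetSum-↭ f resp p) (subsetSum-↭ f resp q)

coefficient-++ : ∀ p q m → coefficient (p ++ q) m ≡ coefficient p m ℤ.+ coefficient q m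
coefficient-++ []            q m = sym (ℤ.+-identityˡ _)
coefficient-++ ((c , m′) ∷ p) q m with does (m′ ↭? m)
... | true  = trans (cong (ℤ._+_ c) (coefficient-++ p q m)) (sym (ℤ.+-assoc c _ _))
... | false = coefficient-++ p q m

coefficient-sumₚ : ∀ ps m → coefficient (sumₚ ps) m ≡ sumℤ (map (λ p → coefficient p m) ps)
coefficient-sumₚ []       m = refl
coefficient-sumₚ (p ∷ ps) m = trans (coefficient-++ p (sumₚ ps) m)
    (cong (ℤ._+_ (coefficient p m)) (coefficient-sumₚ ps m))

coefficient-monomial : ∀ m {μ} → m ↭ map x μ → ∀ ν → coefficient [ (ℤ.1ℤ , m) ] (map x ν) ≡ ℤ.+ ind (μ ≟ₚ ν)
coefficient-monomial m {μ} p ν with m ↭? map x ν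
... | yes q = cong ℤ.+_ (sym (ind-yes (μ ≟ₚ ν) (map-x-↭⁻ (↭-trans (↭-sym p) q))))
... | no ¬q = cong ℤ.+_ (sym (ind-no (μ ≟ₚ ν) (λ r → ¬q (↭-trans p (↭ₚ.map⁺ x r)))))

-- Components as blocks of a partition of the vertices

module _ {R : Rel A 0ℓ} (R? : ∀ a b → Dec (R a b)) where

  deduplicate-apart : ∀ as → AllPairs (λ a b → ¬ R a b) (deduplicate R? as)
  deduplicate-apart []       = []
  deduplicate-apart (a ∷ as) = All.all-filter _ (deduplicate R? as) ∷ AllPairs.filter⁺ _ (deduplicate-apart as)

  deduplicate-covers : (∀ {a} → R a a) → (∀ {a b c} → R a b → R b c → R a c) → ∀ {a as} → a ∈ as → ∃ λ r →
      r ∈ deduplicate R? as × R r a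
  deduplicate-covers R-refl R-trans (here refl) = _ , here refl , R-refl
  deduplicate-covers R-refl R-trans {as = a′ ∷ as} (there i) with r , j , ra ←
      deduplicate-covers R-refl R-trans i with R? a′ r
  ... | yes a′r = a′ , here refl , R-trans a′r ra
  ... | no ¬a′r = r , there (∈-filter⁺ (λ b → ¬? (R? a′ b)) j ¬a′r) , ra

deduplicate-cong : {R S : Rel A 0ℓ} (R? : ∀ a b → Dec (R a b)) (S? : ∀ a b → Dec (S a b)) →
                   (∀ {a b} → R a b → S a b) → (∀ {a b} → S a b → R a b) → ∀ as →
                       deduplicate R? as ≡ deduplicate S? as
deduplicate-cong R? S? f g []       = refl
deduplicate-cong R? S? f g (a ∷ as) = cong (a ∷_) (trans (cong (filter _) (deduplicate-cong R? S? f g as))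
  (filter-≐ _ _ ((λ ¬r s → ¬r (g s)) , (λ ¬s r → ¬s (f r))) (deduplicate S? as)))

module _ {n : ℕ} where
  private
    V = Fin n

  SC : List (V × V) → Rel V 0ℓ
  SC = SameComponent

  same-mono : ∀ {A A′ : List (V × V)} {u v} → (∀ {u v} → Joins A u v → Joins A′ u v) → SC A u v → SC A′ u v
  same-mono f = Star.map f

  same-sym : ∀ {A : List (V × V)} {u v} → SC A u v → SC A v u
  same-sym = Star.reverse λ { (inj₁ i) → inj₂ i ; (inj₂ i) → inj₁ i }

  components-cong : ∀ {A A′ : List (V × V)} → (∀ {u v} → Joins A u v → Joins A′ u v) →
      (∀ {u v} → Joins A′ u v → Joins A u v) → components A ≡ components A′
  components-cong {A} {A′} f g = trans
    (cong (map _) (deduplicate-cong (sameComponent? A) (sameComponent? A′) (same-mono f) (same-mono g)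
        (allFin n)))
    (map-cong (λ r → filter-≐ (sameComponent? A r) (sameComponent? A′ r) (same-mono f , same-mono g) (allFin n))
        _)

  -- A certificate that `Bs` lists the components of the graph on `vs` with edges `A`: `connects`
  -- says that the blocks are not too large, `contains` that they are not too small. `forest` is the
  -- count |A| + c(A) = |V|, which makes the exponent of z - 1 vanish.
  record Blocks (A : List (V × V)) (Bs : List (List V)) (vs : List V) : Set where
    constructor blocks
    field
      partition : concat Bs ↭ vs
      inhabited : All (λ B → ∃ λ u → u ∈ B) Bs
      connects  : All (λ B → ∀ u v → u ∈ B → v ∈ B → SC A u v) Bs
      contains  : All (λ (u , v) → Any (λ B → u ∈ B × v ∈ B) Bs) A
      forest    : length A + length Bs ≡ length vs
  open Blocks

  blocks-[-] : ∀ v → Blocks [] [ [ v ] ] [ v ]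
  blocks-[-] v = blocks ↭-refl ((v , here refl) ∷ []) ((λ { _ _ (here refl) (here refl) → ε }) ∷ []) [] refl

  blocks-↭ : ∀ {A Bs Bs′ vs vs′} → Bs ↭ Bs′ → vs ↭ vs′ → Blocks A Bs vs → Blocks A Bs′ vs′
  blocks-↭ {A} {Bs} {Bs′} p q b = blocks
    (↭-trans (subst₂ _↭_ (concat≡ Bs′) (concat≡ Bs) (concatMap-↭ id (↭-sym p))) (↭-trans (b .partition) q))
    (↭ₚ.All-resp-↭ p (b .inhabited)) (↭ₚ.All-resp-↭ p (b .connects)) (All.map (↭ₚ.Any-resp-↭ p) (b .contains))
    (trans (cong (length A +_) (sym (↭ₚ.↭-length p))) (trans (b .forest) (↭ₚ.↭-length q)))
    where
    concat≡ : ∀ (Cs : List (List V)) → concatMap id Cs ≡ concat Cs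
    concat≡ Cs = cong concat (map-id Cs)

  blocks-∪ : ∀ {A A′ Bs Bs′ vs vs′} → Blocks A Bs vs → Blocks A′ Bs′ vs′ →
      Blocks (A ++ A′) (Bs ++ Bs′) (vs ++ vs′)
  blocks-∪ {A} {A′} {Bs} {Bs′} {vs} {vs′} b b′ = blocks
    (subst (_↭ vs ++ vs′) (List.concat-++ Bs Bs′) (↭ₚ.++⁺ (b .partition) (b′ .partition)))
    (All.++⁺ (b .inhabited) (b′ .inhabited))
    (All.++⁺ (All.map (λ c u v i j → same-mono (λ { (inj₁ k) → inj₁ (∈-++⁺ˡ k) ; (inj₂ k) → inj₂ (∈-++⁺ˡ k) })
        (c u v i j)) (b .connects))
             (All.map (λ c u v i j → same-mono (λ { (inj₁ k) → inj₁ (∈-++⁺ʳ A k) ; (inj₂ k) →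
                 inj₂ (∈-++⁺ʳ A k) }) (c u v i j)) (b′ .connects)))
    (All.++⁺ (All.map Any.++⁺ˡ (b .contains)) (All.map (Any.++⁺ʳ Bs) (b′ .contains)))
    (trans (cong₂ _+_ (length-++ A) (length-++ Bs)) (trans
        (interchange (length A) (length A′) (length Bs) (length Bs′))
      (trans (cong₂ _+_ (b .forest) (b′ .forest)) (sym (length-++ vs)))))
    where
    open +-*-Solver
    interchange : ∀ a a′ b b′ → a + a′ + (b + b′) ≡ a + b + (a′ + b′)
    interchange = solve 4 (λ a a′ b b′ → a :+ a′ :+ (b :+ b′) := a :+ b :+ (a′ :+ b′)) refl

  blocks-merge : ∀ {A B B′ C Bs vs u v} → u ∈ B → v ∈ B′ → B ++ B′ ↭ C → Blocks A (B ∷ B′ ∷ Bs) vs →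
      Blocks ((u , v) ∷ A) (C ∷ Bs) vs
  blocks-merge {A} {B} {B′} {C} {Bs} {vs} {u} {v} i j p (blocks part (_ ∷ _ ∷ inh) (c ∷ c′ ∷ cs) cont for) =
      blocks
    (↭-trans (↭ₚ.++⁺ʳ (concat Bs) (↭-sym p)) (subst (_↭ vs) (sym (++-assoc B B′ (concat Bs))) part))
    ((u , ↭ₚ.∈-resp-↭ p (∈-++⁺ˡ i)) ∷ inh)
    (connect ∷ All.map (λ c a b k l → weaken (c a b k l)) cs)
    ((here (↭ₚ.∈-resp-↭ p (∈-++⁺ˡ i) , ↭ₚ.∈-resp-↭ p (∈-++⁺ʳ B j))) ∷ All.map contain cont)
    (trans (sym (ℕ.+-suc (length A) (suc (length Bs)))) for)
    where
    weaken : ∀ {a b} → SC A a b → SC ((u , v) ∷ A) a b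
    weaken = same-mono λ { (inj₁ k) → inj₁ (there k) ; (inj₂ k) → inj₂ (there k) }
    to-u : ∀ {a} → a ∈ C → SC ((u , v) ∷ A) a u
    to-u k with ∈-++⁻ B (↭ₚ.∈-resp-↭ (↭-sym p) k)
    ... | inj₁ l = weaken (c _ _ l i)
    ... | inj₂ l = weaken (c′ _ _ l j) ◅◅ (inj₂ (here refl) ◅ ε)
    connect : ∀ a b → a ∈ C → b ∈ C → SC ((u , v) ∷ A) a b
    connect a b k l = to-u k ◅◅ same-sym (to-u l)
    contain : ∀ {a b} → Any (λ B → a ∈ B × b ∈ B) (B ∷ B′ ∷ Bs) → Any (λ B → a ∈ B × b ∈ B) (C ∷ Bs)
    contain (here (k , l))         = here (↭ₚ.∈-resp-↭ p (∈-++⁺ˡ k) , ↭ₚ.∈-resp-↭ p (∈-++⁺ˡ l))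
    contain (there (here (k , l))) = here (↭ₚ.∈-resp-↭ p (∈-++⁺ʳ B k) , ↭ₚ.∈-resp-↭ p (∈-++⁺ʳ B l))
    contain (there (there k))      = there k

  Unique-++ʳ : ∀ (as : List V) {bs} → Unique (as ++ bs) → Unique bs
  Unique-++ʳ []       us       = us
  Unique-++ʳ (a ∷ as) (_ ∷ us) = Unique-++ʳ as us

  concat-disjoint : ∀ (Bs : List (List V)) → Unique (concat Bs) → AllPairs (λ B B′ → ∀ u → u ∈ B → u ∉ B′) Bs
  concat-disjoint []       _  = []
  concat-disjoint (B ∷ Bs) us = All.tabulate (λ j u i k → Unique-++-disjoint B us i (∈-concat⁺′ k j)) ∷
      concat-disjoint Bs (Unique-++ʳ B us)

  same-block : ∀ {Bs : List (List V)} {B B′ u} → AllPairs (λ B B′ → ∀ u → u ∈ B → u ∉ B′) Bs → B ∈ Bs →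
      B′ ∈ Bs → u ∈ B → u ∈ B′ → B ≡ B′
  same-block (r ∷ rs) (here refl) (here refl) _ _ = refl
  same-block (r ∷ rs) (here refl) (there j) k l = contradiction l (All.lookup r j _ k)
  same-block (r ∷ rs) (there i) (here refl) k l = contradiction k (All.lookup r i _ l)
  same-block (r ∷ rs) (there i) (there j) k l = same-block rs i j k l

  concat-unique : ∀ (Bs : List (List V)) → Unique (concat Bs) → All Unique Bs
  concat-unique []       _  = []
  concat-unique (B ∷ Bs) us = Unique-++ˡ B us ∷ concat-unique Bs (Unique-++ʳ B us)

  blocks-components : ∀ {A Bs vs} → vs ↭ allFin n → Blocks A Bs vs → ∃ λ Bs′ →
      Bs ↭ Bs′ × Pointwise _↭_ (components A) Bs′
  blocks-components {A} {Bs} all b =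
    let (Bs′ , p , ms) = match {M = M} reps Bs
          (AllPairs-map (λ ¬s B (i , k) (j , _) → ¬s (All.lookup (b .connects) k _ _ i j))
              (deduplicate-apart (sameComponent? A) (allFin n)))
          (AllPairs-map (λ d u (i , _) (j , _) → d u i j) disjoint)
              (λ {r} _ → let (B , i , j) = block r in B , j , i , j) represented
    in Bs′ , p , component ms
    where
    reps = deduplicate (sameComponent? A) (allFin n)
    M : V → List V → Set
    M r B = r ∈ B × B ∈ Bs
    all′ : concat Bs ↭ allFin n
    all′ = ↭-trans (b .partition) all
    unique : Unique (concat Bs)
    unique = Unique-↭ (↭-sym all′) (Unique.allFin⁺ n)
    disjoint : AllPairs (λ B B′ → ∀ u → u ∈ B → u ∉ B′) Bs
    disjoint = concat-disjoint Bs unique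
    block : ∀ v → ∃ λ B → v ∈ B × B ∈ Bs
    block v = ∈-concat⁻′ Bs (↭ₚ.∈-resp-↭ (↭-sym all′) (∈-allFin v))
    -- Every edge lies inside one block and the blocks are disjoint, so no path leaves its block.
    closed : ∀ {B u v} → B ∈ Bs → u ∈ B → SC A u v → v ∈ B
    closed k i ε = i
    closed {B} k i (_◅_ {j = w} s ss) = closed k (step s) ss
      where
      step : ∀ {w} → Joins A _ w → w ∈ B
      step (inj₁ e) with B′ , k′ , u∈ , w∈ ← find (All.lookup (b .contains) e) =
          subst (_ ∈_) (same-block disjoint k′ k u∈ i) w∈
      step (inj₂ e) with B′ , k′ , w∈ , u∈ ← find (All.lookup (b .contains) e) =
          subst (_ ∈_) (same-block disjoint k′ k u∈ i) w∈
    represented : ∀ {B} → B ∈ Bs → ∃ λ r → r ∈ reps × M r B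
    represented k with u , i ← All.lookup (b .inhabited) k
      with r , j , s ← deduplicate-covers (sameComponent? A) ε _◅◅_ (∈-allFin u) = r , j ,
          closed k i (same-sym s) , k
    component : ∀ {rs Bs′} → Pointwise M rs Bs′ → Pointwise _↭_
        (map (λ r → filter (sameComponent? A r) (allFin n)) rs) Bs′
    component []                       = []
    component (_∷_ {x = r} (i , k) ms) = Unique-↭-ext (Unique.filter⁺ (sameComponent? A r) (Unique.allFin⁺ n))
        (All.lookup (concat-unique Bs unique) k)
      (λ j → closed k i (proj₂ (∈-filter⁻ (sameComponent? A r) {xs = allFin n} j)))
      (λ j → ∈-filter⁺ (sameComponent? A r) (∈-allFin _) (All.lookup (b .connects) k _ _ i j)) ∷ component ms

-- Sets of edges of an unfolded tree and their components

mutual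
  treeEdges : Tree A → List (A × A)
  treeEdges (node a ts) = forestEdges a ts

  forestEdges : A → List (Tree A) → List (A × A)
  forestEdges a []       = []
  forestEdges a (t ∷ ts) = (a , label t) ∷ treeEdges t ++ forestEdges a ts

mutual
  treeEdges-ends : ∀ {u v : A} (t : Tree A) → (u , v) ∈ treeEdges t → u ∈ flatten t × v ∈ flatten t
  treeEdges-ends (node a ts) i = let (j , k) = forestEdges-ends ts i in j , there k

  forestEdges-ends : ∀ {a u v : A} (ts : List (Tree A)) →
      (u , v) ∈ forestEdges a ts → u ∈ a ∷ flattenᶠ ts × v ∈ flattenᶠ ts
  forestEdges-ends (t ∷ ts) (here refl) = here refl , ∈-++⁺ˡ (label∈flatten t)
  forestEdges-ends (t ∷ ts) (there i) with ∈-++⁻ (treeEdges t) i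
  ... | inj₁ j = let (k , l) = treeEdges-ends t j in there (∈-++⁺ˡ k) , ∈-++⁺ˡ l
  ... | inj₂ j with forestEdges-ends ts j
  ...   | here refl , l = here refl , ∈-++⁺ʳ (flatten t) l
  ...   | there k   , l = there (∈-++⁺ʳ (flatten t) k) , ∈-++⁺ʳ (flatten t) l

-- A set of edges, the component of the root and the other components.
Splitting : Set → Set
Splitting A = List (A × A) × List A × List (List A)

cutEdge : Splitting A → Splitting A → Splitting A
cutEdge (E , C , Bs) (E′ , C′ , Bs′) = E ++ E′ , C′ , C ∷ Bs ++ Bs′

keepEdge : A × A → Splitting A → Splitting A → Splitting A
keepEdge e (E , C , Bs) (E′ , C′ , Bs′) = e ∷ E ++ E′ , C ++ C′ , Bs ++ Bs′

mutual
  -- The recursion of `splits` with edges and vertices remembered. It links the two descriptions: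
  -- forgetting the components gives the subsets of edges, and weighing the components gives
  -- `splits`.
  splittings : Tree A → List (Splitting A)
  splittings (node a ts) = map (map₂ (map₁ (a ∷_))) (splittingsᶠ a ts)

  splittingsᶠ : A → List (Tree A) → List (Splitting A)
  splittingsᶠ a []       = [ [] , [] , [] ]
  splittingsᶠ a (t ∷ ts) = cartesianProductWith cutEdge (splittings t) (splittingsᶠ a ts) ++
                           cartesianProductWith (keepEdge (a , label t)) (splittings t) (splittingsᶠ a ts)

mutual
  splittings-edges : (t : Tree A) → map proj₁ (splittings t) ≡ subsets (treeEdges t)
  splittings-edges (node a ts) = trans (sym (map-∘ (splittingsᶠ a ts))) (splittingsᶠ-edges a ts)

  splittingsᶠ-edges : (a : A) (ts : List (Tree A)) → map proj₁ (splittingsᶠ a ts) ≡ subsets (forestEdges a ts)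
  splittingsᶠ-edges a []       = refl
  splittingsᶠ-edges a (t ∷ ts) = trans (map-++ proj₁
      (cartesianProductWith cutEdge (splittings t) (splittingsᶠ a ts)) _) (cong₂ _++_
    (trans (map-cartesianProductWith proj₁ cutEdge _++_ proj₁ proj₁ (λ _ _ → refl) (splittings t)
        (splittingsᶠ a ts)) product)
    (trans (map-cartesianProductWith proj₁ (keepEdge (a , label t))
        (λ E E′ → (a , label t) ∷ E ++ E′) proj₁ proj₁ (λ _ _ → refl) (splittings t) (splittingsᶠ a ts))
      (trans (sym (trans (map-cartesianProductWith ((a , label t) ∷_) _++_
          (λ E E′ → (a , label t) ∷ E ++ E′) id id (λ _ _ → refl) (map proj₁ (splittings t))
            (map proj₁ (splittingsᶠ a ts)))
          (cong₂ (cartesianProductWith _) (map-id (map proj₁ (splittings t)))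
              (map-id (map proj₁ (splittingsᶠ a ts))))))
        (cong (map ((a , label t) ∷_)) product))))
    where
    product : cartesianProductWith _++_ (map proj₁ (splittings t)) (map proj₁ (splittingsᶠ a ts)) ≡ subsets
        (treeEdges t ++ forestEdges a ts)
    product = trans (cong₂ (cartesianProductWith _++_) (splittings-edges t) (splittingsᶠ-edges a ts))
        (sym (subsets-++ (treeEdges t) (forestEdges a ts)))

module _ {n : ℕ} where
  private
    V = Fin n

    Good-splitting : Tree V → Splitting V → Set
    Good-splitting t (E , C , Bs) = Blocks E (C ∷ Bs) (flatten t) × label t ∈ C

    -- The parent `v` is adjoined because `C` holds only what is joined to it and may be empty,
    -- whereas blocks are inhabited.
    Good-splittingᶠ : V → List (Tree V) → Splitting V → Set
    Good-splittingᶠ v ts (E , C , Bs) = Blocks E ((v ∷ C) ∷ Bs) (v ∷ flattenᶠ ts)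

  mutual
    splittings-blocks : (t : Tree V) → All (Good-splitting t) (splittings t)
    splittings-blocks (node v ts) = All.map⁺ (All.map (λ b → b , here refl) (splittingsᶠ-blocks v ts))

    splittingsᶠ-blocks : (v : V) (ts : List (Tree V)) → All (Good-splittingᶠ v ts) (splittingsᶠ v ts)
    splittingsᶠ-blocks v []       = blocks-[-] v ∷ []
    splittingsᶠ-blocks v (t ∷ ts) = All.++⁺
      (All-cartesianProductWith {P = Good-splitting t} {Q = Good-splittingᶠ v ts} (λ (b , i) b′ → union b b′)
          (splittings-blocks t) (splittingsᶠ-blocks v ts))
      (All-cartesianProductWith {P = Good-splitting t} {Q = Good-splittingᶠ v ts}
        (λ {(_ , C , _)} {(_ , C′ , _)} (b , i) b′ → blocks-merge (here refl) i (↭-prep v (↭ₚ.++-comm C′ C))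
            (union b b′)) (splittings-blocks t) (splittingsᶠ-blocks v ts))
      where
      union : ∀ {E C Bs E′ C′ Bs′} → Blocks E (C ∷ Bs) (flatten t) →
          Blocks E′ ((v ∷ C′) ∷ Bs′) (v ∷ flattenᶠ ts) →
              Blocks (E ++ E′) ((v ∷ C′) ∷ C ∷ Bs ++ Bs′) (v ∷ flatten t ++ flattenᶠ ts)
      union {C = C} {Bs} {C′ = C′} {Bs′} b b′ = blocks-↭ (↭ₚ.shift (v ∷ C′) (C ∷ Bs) Bs′)
          (↭ₚ.shift v (flatten t) (flattenᶠ ts)) (blocks-∪ b b′)

  -- `treeEdges` directs edges away from the root, while `edges` puts the smaller end first.
  orient : V × V → V × V
  orient (u , v) with u Fin.<? v
  ... | yes _ = u , v
  ... | no _  = v , u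

  orient-< : ∀ {u v} → u Fin.< v → orient (u , v) ≡ (u , v)
  orient-< {u} {v} lt with u Fin.<? v
  ... | yes _   = refl
  ... | no ¬lt = contradiction lt ¬lt

  orient-> : ∀ {u v} → v Fin.< u → orient (u , v) ≡ (v , u)
  orient-> {u} {v} gt with u Fin.<? v
  ... | yes lt = contradiction lt (ℕ.<⇒≯ gt)
  ... | no _   = refl

  orient-ends : ∀ {a b c d} → orient (a , b) ≡ orient (c , d) → (a ≡ c × b ≡ d) ⊎ (a ≡ d × b ≡ c)
  orient-ends {a} {b} {c} {d} eq with a Fin.<? b | c Fin.<? d
  orient-ends refl | yes _ | yes _ = inj₁ (refl , refl)
  orient-ends refl | yes _ | no _  = inj₂ (refl , refl)
  orient-ends refl | no _  | yes _ = inj₂ (refl , refl)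
  orient-ends refl | no _  | no _  = inj₁ (refl , refl)

  mutual
    treeEdges-oriented : ∀ t → Unique (flatten t) → Unique (map orient (treeEdges t))
    treeEdges-oriented t u = AllPairs.map⁺ (treeEdges-apart t u)

    treeEdges-apart : ∀ t → Unique (flatten t) → AllPairs (λ e e′ → orient e ≢ orient e′) (treeEdges t)
    treeEdges-apart (node a ts) u = forestEdges-apart a ts u

    forestEdges-apart : ∀ a ts → Unique (a ∷ flattenᶠ ts) →
        AllPairs (λ e e′ → orient e ≢ orient e′) (forestEdges a ts)
    forestEdges-apart a []       _          = []
    forestEdges-apart a (t ∷ ts) (ne ∷ u) =
      All.tabulate head-apart ∷ AllPairs.++⁺ (treeEdges-apart t (Unique-++ˡ (flatten t) u))
        (forestEdges-apart a ts (All.++⁻ʳ (flatten t) ne ∷ Unique-++ʳ (flatten t) u))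
        (All.tabulate λ i → All.tabulate λ j → apart i j)
      where
      a∉ : a ∉ flatten t ++ flattenᶠ ts
      a∉ i = All.lookup ne i refl
      head-apart : ∀ {e} → e ∈ treeEdges t ++ forestEdges a ts → orient (a , label t) ≢ orient e
      head-apart {b , c} i eq with ∈-++⁻ (treeEdges t) i
      ... | inj₁ j with treeEdges-ends t j | orient-ends {a} {label t} {b} {c} eq
      ...   | k , l | inj₁ (refl , _) = a∉ (∈-++⁺ˡ k)
      ...   | k , l | inj₂ (refl , _) = a∉ (∈-++⁺ˡ l)
      head-apart {b , c} i eq | inj₂ j with forestEdges-ends ts j | orient-ends {a} {label t} {b} {c} eq
      ...   | k , l | inj₁ (_ , refl) = Unique-++-disjoint (flatten t) u (label∈flatten t) l
      ...   | k , l | inj₂ (refl , _) = a∉ (∈-++⁺ʳ (flatten t) l)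
      apart : ∀ {e e′} → e ∈ treeEdges t → e′ ∈ forestEdges a ts → orient e ≢ orient e′
      apart {b , c} {b′ , c′} i j eq with treeEdges-ends t i | forestEdges-ends ts j | orient-ends {b} {c} {b′}
          {c′} eq
      ... | k , l | k′ , l′ | inj₁ (_ , refl) = Unique-++-disjoint (flatten t) u l l′
      ... | k , l | k′ , l′ | inj₂ (refl , _) = Unique-++-disjoint (flatten t) u k l′

  mutual
    treeEdges-adjacent : ∀ {Adj : Rel V 0ℓ} {p t u v} → Unfolding Adj p t → (u , v) ∈ treeEdges t → Adj u v
    treeEdges-adjacent (node _ sound _ us) i = forestEdges-adjacent (λ j → proj₁ (sound j)) us i

    forestEdges-adjacent : ∀ {Adj : Rel V 0ℓ} {a ts u v} →
        (∀ {t} → t ∈ ts → Adj a (label t)) → All (Unfolding Adj (just a)) ts →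
          (u , v) ∈ forestEdges a ts → Adj u v
    forestEdges-adjacent {ts = t ∷ ts} es (u ∷ us) (here refl) = es (here refl)
    forestEdges-adjacent {ts = t ∷ ts} es (u ∷ us) (there i) with ∈-++⁻ (treeEdges t) i
    ... | inj₁ j = treeEdges-adjacent u j
    ... | inj₂ j = forestEdges-adjacent (λ k → es (there k)) us j

  root-edges : ∀ {a t} {ts : List (Tree V)} → t ∈ ts → (a , label t) ∈ forestEdges a ts
  root-edges (here refl)            = here refl
  root-edges {ts = t ∷ ts} (there i) = there (∈-++⁺ʳ (treeEdges t) (root-edges i))

  treeEdges-complete : ∀ {Adj : Rel V 0ℓ} {p t u v} → Unfolding Adj p t → u ∈ flatten t → Adj u v →
                       (u ≡ label t × just v ≡ p) ⊎ ((u , v) ∈ treeEdges t ⊎ (v , u) ∈ treeEdges t)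
  treeEdges-complete {p = p} {v = v} (node _ sound complete us) (here refl) a with Maybe.≡-dec Fin._≟_
      (just v) p
  ... | yes eq = inj₁ (refl , eq)
  ... | no ne with t , i , refl ← ∈-map⁻ label (complete a ne) = inj₂ (inj₁ (root-edges i))
  treeEdges-complete {Adj} {t = node w _} {u} {v} (node _ sound complete us) (there i) a = inj₂ (go us i)
    where
    go : ∀ {ts} → All (Unfolding Adj (just w)) ts → u ∈ flattenᶠ ts →
        (u , v) ∈ forestEdges w ts ⊎ (v , u) ∈ forestEdges w ts
    go {t ∷ ts} (unf ∷ us) i with ∈-++⁻ (flatten t) i
    ... | inj₁ j with treeEdges-complete unf j a
    ...   | inj₁ (refl , refl) = inj₂ (here refl)
    ...   | inj₂ (inj₁ k)      = inj₁ (there (∈-++⁺ˡ k))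
    ...   | inj₂ (inj₂ k)      = inj₂ (there (∈-++⁺ˡ k))
    go {t ∷ ts} (unf ∷ us) i | inj₂ j with go us j
    ...   | inj₁ k = inj₁ (there (∈-++⁺ʳ (treeEdges t) k))
    ...   | inj₂ k = inj₂ (there (∈-++⁺ʳ (treeEdges t) k))

-- The W-polynomial of a tree

Pointwise-map-≡ : {R : A → B → Set} {f : A → C} {g : B → C} →
    (∀ {a b} → R a b → f a ≡ g b) → ∀ {as bs} → Pointwise R as bs → map f as ≡ map g bs
Pointwise-map-≡ e []       = refl
Pointwise-map-≡ e (r ∷ rs) = cong₂ _∷_ (e r) (Pointwise-map-≡ e rs)

module WTerms (T : WeightedTree) where
  open TreeFacts T

  blockWeights : Splitting V → ℕ × Partition
  blockWeights (_ , C , Bs) = weight C , map weight Bs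

  weight-++ : ∀ us vs → weight (us ++ vs) ≡ weight us + weight vs
  weight-++ us vs = trans (cong sum (map-++ w us vs)) (ℕ.sum-++ (map w us) (map w vs))

  mutual
    splittings-splits : ∀ t → map blockWeights (splittings t) ≡ splits (mapTree ω t)
    splittings-splits (node v ts) = trans (sym (map-∘ (splittingsᶠ v ts))) (trans
      (trans (map-cong (λ (_ , C , Bs) → cong (λ k → k + weight C , map weight Bs) (sym (suc-ω v)))
          (splittingsᶠ v ts)) (map-∘ (splittingsᶠ v ts)))
      (cong (map (map₁ (suc (ω v) +_))) (splittingsᶠ-splitsᶠ v ts)))

    splittingsᶠ-splitsᶠ : ∀ v ts → map blockWeights (splittingsᶠ v ts) ≡ splitsᶠ (mapTrees ω ts)
    splittingsᶠ-splitsᶠ v []       = refl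
    splittingsᶠ-splitsᶠ v (t ∷ ts) = trans (map-++ blockWeights
        (cartesianProductWith cutEdge (splittings t) (splittingsᶠ v ts)) _) (cong₂ _++_
      (trans (map-cartesianProductWith blockWeights cutEdge cut blockWeights blockWeights
          (λ (_ , C , Bs) (_ , C′ , Bs′) → cong (λ m → weight C′ , weight C ∷ m) (map-++ weight Bs Bs′))
              (splittings t) (splittingsᶠ v ts))
        (cong₂ (cartesianProductWith cut) (splittings-splits t) (splittingsᶠ-splitsᶠ v ts)))
      (trans (map-cartesianProductWith blockWeights (keepEdge (v , label t)) keep blockWeights blockWeights
          (λ (_ , C , Bs) (_ , C′ , Bs′) → cong₂ _,_ (weight-++ C C′) (map-++ weight Bs Bs′)) (splittings t)
              (splittingsᶠ v ts))
        (cong₂ (cartesianProductWith keep) (splittings-splits t) (splittingsᶠ-splitsᶠ v ts))))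

  -- The term of `W` as a function of the components and the number of edges only; reordering or
  -- reorienting the edges changes neither.
  summand : List (List V) → ℕ → Polynomial
  summand Cs k = term ℤ.1ℤ (map (x ∘ weight) Cs) *ₚ (term ℤ.1ℤ [ z ] +ₚ term ℤ.-1ℤ []) ^ₚ
      (k + length Cs ∸ order)

  edgeTerm : List (V × V) → Polynomial
  edgeTerm A = summand (components A) (length A)

  edgeTerm-cong : ∀ {A A′} → (∀ {u v} → Joins A u v → Joins A′ u v) →
      (∀ {u v} → Joins A′ u v → Joins A u v) → length A ≡ length A′ →
                  edgeTerm A ≡ edgeTerm A′
  edgeTerm-cong f g e = cong₂ summand (components-cong f g) e

  edgeTerm-↭ : ∀ {A A′} → A ↭ A′ → edgeTerm A ≡ edgeTerm A′
  edgeTerm-↭ p = edgeTerm-cong (joins p) (joins (↭-sym p)) (↭ₚ.↭-length p)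
    where
    joins : ∀ {A A′ u v} → A ↭ A′ → Joins A u v → Joins A′ u v
    joins p (inj₁ i) = inj₁ (↭ₚ.∈-resp-↭ p i)
    joins p (inj₂ i) = inj₂ (↭ₚ.∈-resp-↭ p i)

  edgeTerm-orient : ∀ A → edgeTerm (map orient A) ≡ edgeTerm A
  edgeTerm-orient A = edgeTerm-cong oriented⇒ ⇒oriented (length-map orient A)
    where
    Joins-sym : ∀ {A : List (V × V)} {u v} → Joins A u v → Joins A v u
    Joins-sym (inj₁ i) = inj₂ i
    Joins-sym (inj₂ i) = inj₁ i
    reorient : ∀ {a b u v} → (a , b) ∈ A → (u , v) ≡ orient (a , b) → Joins A u v
    reorient {a} {b} j eq with a Fin.<? b
    reorient j refl | yes _ = inj₁ j
    reorient j refl | no _  = inj₂ j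
    unoriented : ∀ {u v} → (u , v) ∈ map orient A → Joins A u v
    unoriented i with _ , j , eq ← ∈-map⁻ orient i = reorient j eq
    oriented⇒ : ∀ {u v} → Joins (map orient A) u v → Joins A u v
    oriented⇒ (inj₁ i) = unoriented i
    oriented⇒ (inj₂ i) = Joins-sym (unoriented i)
    orientedJoin : ∀ {u v} → (u , v) ∈ A → Joins (map orient A) u v
    orientedJoin {u} {v} i with u Fin.<? v | ∈-map⁺ orient i
    ... | yes _ | j = inj₁ j
    ... | no _  | j = inj₂ j
    ⇒oriented : ∀ {u v} → Joins A u v → Joins (map orient A) u v
    ⇒oriented (inj₁ i) = orientedJoin i
    ⇒oriented (inj₂ i) = Joins-sym (orientedJoin i)

  module _ {t : Tree V} (u : Unfolding Adj nothing t) where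

    edges-↭ : edges ↭ map orient (treeEdges t)
    edges-↭ = Unique-↭-ext (Unique.filter⁺ edge? (Unique.cartesianProduct⁺ (Unique.allFin⁺ order)
        (Unique.allFin⁺ order)))
        (treeEdges-oriented t (flatten-unique u)) to from
      where
      edge? = λ ((u , v) : V × V) → (u Fin.<? v) ×-dec T? (adj u v)
      ∈-edges : ∀ {a b} → a Fin.< b → Adj a b → (a , b) ∈ edges
      ∈-edges lt e = ∈-filter⁺ edge? (∈-cartesianProduct⁺ (∈-allFin _) (∈-allFin _)) (lt , e)
      to : ∀ {e} → e ∈ edges → e ∈ map orient (treeEdges t)
      to {a , b} i with lt , e ← proj₂ (∈-filter⁻ edge? {xs = cartesianProduct vertices vertices} i)
        with treeEdges-complete u (spanning connected u a) e
      ... | inj₂ (inj₁ j) = subst (_∈ map orient (treeEdges t)) (orient-< lt) (∈-map⁺ orient j)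
      ... | inj₂ (inj₂ j) = subst (_∈ map orient (treeEdges t)) (orient-> lt) (∈-map⁺ orient j)
      from : ∀ {e} → e ∈ map orient (treeEdges t) → e ∈ edges
      from i with (a , b) , j , refl ← ∈-map⁻ orient i with a Fin.<? b | treeEdges-adjacent u j
      ... | yes lt | e = ∈-edges lt e
      ... | no ¬lt | e = ∈-edges (ℕ.≤∧≢⇒< (ℕ.≮⇒≥ ¬lt) (λ eq → adjacent⇒≢ e (sym (Fin.toℕ-injective eq))))
          (symmetric e)

    edgeTerm-coefficient : ∀ {A Bs} → Blocks A Bs (flatten t) → ∀ ν →
        coefficient (edgeTerm A) (map x ν) ≡ ℤ.+ ind (map weight Bs ≟ₚ ν)
    edgeTerm-coefficient {A} {Bs} b ν with Bs′ , p , es ← blocks-components (unfolding-covers u) b =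
      trans (cong (λ k → coefficient (term ℤ.1ℤ (map (x ∘ weight) (components A)) *ₚ
          (term ℤ.1ℤ [ z ] +ₚ term ℤ.-1ℤ []) ^ₚ k) (map x ν)) rank)
            (coefficient-monomial (map (x ∘ weight) (components A) ++ []) monomial ν)
      where
      -- By the count for forests the exponent of z - 1 is zero, so a single monomial remains.
      rank : length A + length (components A) ∸ order ≡ 0
      rank = trans (cong (λ k → length A + k ∸ order)
          (trans (Pointwise.Pointwise-length es) (sym (↭ₚ.↭-length p))))
        (trans (cong (_∸ order) (trans (Blocks.forest b)
            (trans (↭ₚ.↭-length (unfolding-covers u)) (List.length-tabulate id)))) (ℕ.n∸n≡0 order))
      monomial : map (x ∘ weight) (components A) ++ [] ↭ map x (map weight Bs)
      monomial = ↭-trans (↭-reflexive (trans (++-identityʳ _)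
          (trans (map-∘ (components A)) (cong (map x) (Pointwise-map-≡ (λ q → ℕ.sum-↭ (↭ₚ.map⁺ w q)) es)))))
        (↭ₚ.map⁺ x (↭ₚ.map⁺ weight (↭-sym p)))

    -- Up to the order and orientation of edges, `splittings t` runs through the same edge sets as
    -- `W` and carries their components along. Monomials in the `x` suffice, as all powers of z - 1
    -- are trivial.
    W-coefficient : ∀ ν → coefficient (W weightedGraph) (map x ν) ≡ ℤ.+ count (whole (mapTree ω t)) ν
    W-coefficient ν = begin
      coefficient (W weightedGraph) (map x ν)             ≡⟨ coefficient-sumₚ (map edgeTerm (subsets edges))
          (map x ν) ⟩
      sumℤ (map (λ p → coefficient p (map x ν)) (map edgeTerm (subsets edges))) ≡⟨ cong sumℤ
          (sym (map-∘ (subsets edges))) ⟩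
      subsetSum value edges                               ≡⟨ subsetSum-↭ value
          (λ p → cong (λ q → coefficient q (map x ν)) (edgeTerm-↭ p)) edges-↭ ⟩
      subsetSum value (map orient (treeEdges t))          ≡⟨ cong (sumℤ ∘ map value)
          (subsets-map orient (treeEdges t)) ⟩
      sumℤ (map value (map (map orient) (subsets (treeEdges t)))) ≡⟨ cong sumℤ
          (sym (map-∘ (subsets (treeEdges t)))) ⟩
      subsetSum (value ∘ map orient) (treeEdges t)        ≡⟨ subsetSum-cong
          (λ A → cong (λ q → coefficient q (map x ν)) (edgeTerm-orient A)) (treeEdges t) ⟩
      subsetSum value (treeEdges t)                       ≡⟨ cong (sumℤ ∘ map value)
          (sym (splittings-edges t)) ⟩
      sumℤ (map value (map proj₁ (splittings t)))         ≡⟨ sum-count (splittings-blocks t) ⟩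
      ℤ.+ count (map partition (splittings t)) ν          ≡⟨ cong (λ p → ℤ.+ count p ν)
          (trans (map-∘ (splittings t)) (cong (map (uncurry _∷_)) (splittings-splits t))) ⟩
      ℤ.+ count (whole (mapTree ω t)) ν                   ∎
      where
      open ≡-Reasoning
      value : List (V × V) → ℤ.ℤ
      value A = coefficient (edgeTerm A) (map x ν)
      partition : Splitting V → Partition
      partition s = uncurry _∷_ (blockWeights s)
      sum-count : ∀ {ss} → All (λ (E , C , Bs) → Blocks E (C ∷ Bs) (flatten t) × label t ∈ C) ss →
                  sumℤ (map value (map proj₁ ss)) ≡ ℤ.+ count (map partition ss) ν
      sum-count [] = refl
      sum-count ((b , _) ∷ bs) = cong₂ ℤ._+_ (edgeTerm-coefficient b ν) (sum-count bs)

-- Isomorphisms from similar unfoldings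

mutual
  flatten-mapTree : (f : A → B) (t : Tree A) → flatten (mapTree f t) ≡ map f (flatten t)
  flatten-mapTree f (node a ts) = cong (f a ∷_) (flatten-mapTrees f ts)

  flatten-mapTrees : (f : A → B) (ts : List (Tree A)) → flattenᶠ (mapTrees f ts) ≡ map f (flattenᶠ ts)
  flatten-mapTrees f []       = refl
  flatten-mapTrees f (t ∷ ts) = trans (cong₂ _++_ (flatten-mapTree f t) (flatten-mapTrees f ts))
      (sym (map-++ f (flatten t) _))

label-mapTree : (f : A → B) (t : Tree A) → label (mapTree f t) ≡ f (label t)
label-mapTree f (node a ts) = refl

mapBoth : (A → B) → A × A → B × B
mapBoth f (a , b) = f a , f b

mutual
  treeEdges-mapTree : (f : A → B) (t : Tree A) → treeEdges (mapTree f t) ≡ map (mapBoth f) (treeEdges t)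
  treeEdges-mapTree f (node a ts) = forestEdges-mapTrees f a ts

  forestEdges-mapTrees : (f : A → B) (a : A) (ts : List (Tree A)) →
      forestEdges (f a) (mapTrees f ts) ≡ map (mapBoth f) (forestEdges a ts)
  forestEdges-mapTrees f a []       = refl
  forestEdges-mapTrees f a (t ∷ ts) = cong₂ _∷_ (cong (f a ,_) (label-mapTree f t))
    (trans (cong₂ _++_ (treeEdges-mapTree f t) (forestEdges-mapTrees f a ts))
        (sym (map-++ (mapBoth f) (treeEdges t) _)))

module _ (f : A → C) (g : B → C) where
  mutual
    -- Trees with equal images have the same form and can be laid over each other; the pairs of
    -- labels are then the graph of a bijection of vertices.
    zipTree : ∀ t u → mapTree f t ≡ mapTree g u →
              ∃ λ (s : Tree (A × B)) → mapTree proj₁ s ≡ t × mapTree proj₂ s ≡ u × All (λ (a , b) → f a ≡ g b)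
                  (flatten s)
    zipTree (node a ts) (node b us) e with ss , p , q , all ← zipTrees ts us (cong children e) =
      node (a , b) ss , cong (node a) p , cong (node b) q , cong label e ∷ all

    zipTrees : ∀ ts us → mapTrees f ts ≡ mapTrees g us →
               ∃ λ (ss : List (Tree (A × B))) → mapTrees proj₁ ss ≡ ts × mapTrees proj₂ ss ≡ us × All
                   (λ (a , b) → f a ≡ g b) (flattenᶠ ss)
    zipTrees []       []       _ = [] , refl , refl , []
    zipTrees (t ∷ ts) (u ∷ us) e
      with s , p , q , all ← zipTree t u (List.∷-injectiveˡ e)
      with ss , ps , qs , alls ← zipTrees ts us (List.∷-injectiveʳ e) =
      s ∷ ss , cong₂ _∷_ p ps , cong₂ _∷_ q qs , All.++⁺ all alls

module _ {V : Set} {Adj : Rel V 0ℓ} where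

  unfolding-↭ : ∀ {p v ts us} → map label ts ↭ map label us → All (Unfolding Adj (just v)) us →
      Unfolding Adj p (node v ts) → Unfolding Adj p (node v us)
  unfolding-↭ {p} {v} {ts} {us} perm us-unfold (node uniq sound complete _) =
      node (Unique-↭ perm uniq) sound′ (λ a ne → ↭ₚ.∈-resp-↭ perm (complete a ne)) us-unfold
    where
    sound′ : ∀ {u} → u ∈ us → Adj v (label u) × just (label u) ≢ p
    sound′ i with t , j , eq ← ∈-map⁻ label (↭ₚ.∈-resp-↭ (↭-sym perm) (∈-map⁺ label i)) =
      subst (λ a → Adj v a × just a ≢ p) (sym eq) (sound j)

  unfolding-children : ∀ {p v ts} → Unfolding Adj p (node v ts) → All (Unfolding Adj (just v)) ts
  unfolding-children (node _ _ _ us) = us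

  reorder-children : ∀ {p v ts us} → ts ↭ us → Unfolding Adj p (node v ts) → Unfolding Adj p (node v us)
  reorder-children perm u = unfolding-↭ (↭ₚ.map⁺ label perm) (↭ₚ.All-resp-↭ perm (unfolding-children u)) u

  -- Along a similarity of the weights, the children of every vertex are permuted.
  module _ (f : V → ℕ) where
    mutual
      relabel : ∀ {t s s′} → mapTree f t ≡ s → s ~ s′ →
                ∃ λ t′ → mapTree f t′ ≡ s′ × label t ≡ label t′ ×
                    (∀ {p} → Unfolding Adj p t → Unfolding Adj p t′)
      relabel {node v ts} refl (node p) with us , eq , perm , unf ← relabelᶠ {ts} refl p =
        node v us , cong (node (f v)) eq , refl , λ u → unfolding-↭ perm (unf (unfolding-children u)) u

      relabelᶠ : ∀ {ts ss ss′} → mapTrees f ts ≡ ss → ss ~ᶠ ss′ →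
                 ∃ λ ts′ → mapTrees f ts′ ≡ ss′ × map label ts ↭ map label ts′ ×
                     (∀ {p} → All (Unfolding Adj p) ts → All (Unfolding Adj p) ts′)
      relabelᶠ eq (H.refl es) = relabelᵖ eq es
      relabelᶠ {t ∷ ts} refl (H.prep e p)
        with t′ , eq , l , unf ← relabel {t} refl e
        with ts′ , eqs , perm , unfs ← relabelᶠ {ts} refl p =
        t′ ∷ ts′ , cong₂ _∷_ eq eqs , subst (λ a → label t ∷ map label ts ↭ a ∷ map label ts′) l
            (↭-prep _ perm) ,
        λ { (u ∷ us) → unf u ∷ unfs us }
      relabelᶠ {t ∷ u ∷ ts} refl (H.swap e f p)
        with t′ , eq , l , unf ← relabel {t} refl e
        with u′ , eq′ , l′ , unf′ ← relabel {u} refl f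
        with ts′ , eqs , perm , unfs ← relabelᶠ {ts} refl p =
        u′ ∷ t′ ∷ ts′ , cong₂ _∷_ eq′ (cong₂ _∷_ eq eqs) ,
            subst₂ (λ a b → label t ∷ label u ∷ map label ts ↭ b ∷ a ∷ map label ts′) l l′ (↭-swap _ _ perm) ,
        λ { (v ∷ v′ ∷ vs) → unf′ v′ ∷ unf v ∷ unfs vs }
      relabelᶠ eq (H.trans p q)
        with us , eq′ , perm , unf ← relabelᶠ eq p
        with ts′ , eq″ , perm′ , unf′ ← relabelᶠ eq′ q = ts′ , eq″ , ↭-trans perm perm′ , unf′ ∘ unf

      relabelᵖ : ∀ {ts ss ss′} → mapTrees f ts ≡ ss → Pointwise _~_ ss ss′ →
                 ∃ λ ts′ → mapTrees f ts′ ≡ ss′ × map label ts ↭ map label ts′ ×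
                     (∀ {p} → All (Unfolding Adj p) ts → All (Unfolding Adj p) ts′)
      relabelᵖ {[]} refl [] = [] , refl , ↭-refl , id
      relabelᵖ {t ∷ ts} refl (e ∷ es)
        with t′ , eq , l , unf ← relabel {t} refl e
        with ts′ , eqs , perm , unfs ← relabelᵖ {ts} refl es =
        t′ ∷ ts′ , cong₂ _∷_ eq eqs , subst (λ a → label t ∷ map label ts ↭ a ∷ map label ts′) l
            (↭-prep _ perm) ,
        λ { (u ∷ us) → unf u ∷ unfs us }

functional-pairs : {ps : List (A × B)} → Unique (map proj₁ ps) → ∀ {a b b′} → (a , b) ∈ ps →
    (a , b′) ∈ ps → b ≡ b′
functional-pairs (n ∷ u) (here refl) (here refl) = refl
functional-pairs (n ∷ u) (here refl) (there j)   = contradiction refl (All.lookup n (∈-map⁺ proj₁ j))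
functional-pairs (n ∷ u) (there i)   (here refl) = contradiction refl (All.lookup n (∈-map⁺ proj₁ i))
functional-pairs (n ∷ u) (there i)   (there j)   = functional-pairs u i j

injective-pairs : {ps : List (A × B)} → Unique (map proj₂ ps) → ∀ {a a′ b} → (a , b) ∈ ps →
    (a′ , b) ∈ ps → a ≡ a′
injective-pairs (n ∷ u) (here refl) (here refl) = refl
injective-pairs (n ∷ u) (here refl) (there j)   = contradiction refl (All.lookup n (∈-map⁺ proj₂ j))
injective-pairs (n ∷ u) (there i)   (here refl) = contradiction refl (All.lookup n (∈-map⁺ proj₂ i))
injective-pairs (n ∷ u) (there i)   (there j)   = injective-pairs u i j

module _ (T T′ : WeightedTree) where
  private
    module T  = TreeFacts T
    module T′ = TreeFacts T′

  -- Reordering children makes the weighted trees equal. Laid over each other, they pair every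
  -- vertex of `T` with exactly one of `T′`, and the edges of both trees are the projections of the
  -- edges of the overlay.
  ~⇒≅ : ∀ {t t′} → Unfolding T.Adj nothing t → Unfolding T′.Adj nothing t′ → mapTree T.ω t ~ mapTree T′.ω t′ →
      T.weightedGraph ≅ T′.weightedGraph
  ~⇒≅ {t} {t′} u₀ u′ sim with r , eq , _ , unf ← relabel {Adj = T.Adj} T.ω {t} refl sim
    with s , refl , refl , agree ← zipTree T.ω T′.ω r t′ eq = record
    { bijection = mk↔ₛ′ to from to-from from-to
    ; adjacency = λ v v′ → mk⇔ (forward v v′) (backward v v′)
    ; weights   = λ v → trans (sym (T′.suc-ω (to v)))
        (trans (cong suc (sym (All.lookup agree (to-pair v)))) (T.suc-ω v))
    }
    where
    u : Unfolding T.Adj nothing (mapTree proj₁ s)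
    u = unf u₀
    pairs : List (T.V × T′.V)
    pairs = flatten s
    lefts : map proj₁ pairs ↭ T.vertices
    lefts = subst (_↭ T.vertices) (flatten-mapTree proj₁ s) (T.unfolding-covers u)
    rights : map proj₂ pairs ↭ T′.vertices
    rights = subst (_↭ T′.vertices) (flatten-mapTree proj₂ s) (T′.unfolding-covers u′)
    left-unique : Unique (map proj₁ pairs)
    left-unique = Unique-↭ (↭-sym lefts) (Unique.allFin⁺ T.order)
    right-unique : Unique (map proj₂ pairs)
    right-unique = Unique-↭ (↭-sym rights) (Unique.allFin⁺ T′.order)
    partner : ∀ v → ∃ λ v′ → (v , v′) ∈ pairs
    partner v with (_ , v′) , i , refl ← ∈-map⁻ proj₁ (↭ₚ.∈-resp-↭ (↭-sym lefts) (∈-allFin v)) = v′ , i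
    partner′ : ∀ v′ → ∃ λ v → (v , v′) ∈ pairs
    partner′ v′ with (v , _) , i , refl ← ∈-map⁻ proj₂ (↭ₚ.∈-resp-↭ (↭-sym rights) (∈-allFin v′)) = v , i
    to : T.V → T′.V
    to v = proj₁ (partner v)
    to-pair : ∀ v → (v , to v) ∈ pairs
    to-pair v = proj₂ (partner v)
    from : T′.V → T.V
    from v′ = proj₁ (partner′ v′)
    from-pair : ∀ v′ → (from v′ , v′) ∈ pairs
    from-pair v′ = proj₂ (partner′ v′)
    to-from : ∀ v′ → to (from v′) ≡ v′
    to-from v′ = functional-pairs left-unique (to-pair (from v′)) (from-pair v′)
    from-to : ∀ v → from (to v) ≡ v
    from-to v = injective-pairs right-unique (from-pair (to v)) (to-pair v)
    forwardEdge : ∀ {v v′} → (v , v′) ∈ treeEdges (mapTree proj₁ s) → T′.Adj (to v) (to v′)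
    forwardEdge {v₀} {v₀′} i with ((v , a) , (v′ , a′)) , j , refl ←
        ∈-map⁻ (mapBoth proj₁) (subst ((v₀ , v₀′) ∈_) (treeEdges-mapTree proj₁ s) i)
      with k , k′ ← treeEdges-ends s j
      with refl ← functional-pairs left-unique (to-pair v) k
      with refl ← functional-pairs left-unique (to-pair v′) k′ =
      treeEdges-adjacent u′ (subst ((to v , to v′) ∈_) (sym (treeEdges-mapTree proj₂ s))
          (∈-map⁺ (mapBoth proj₂) j))
    forward : ∀ v v′ → T.Adj v v′ → T′.Adj (to v) (to v′)
    forward v v′ e with treeEdges-complete u (T.spanning T.connected u v) e
    ... | inj₂ (inj₁ i) = forwardEdge i
    ... | inj₂ (inj₂ i) = T′.symmetric (forwardEdge i)
    backwardEdge : ∀ {v v′} → (to v , to v′) ∈ treeEdges (mapTree proj₂ s) → T.Adj v v′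
    backwardEdge {v₀} {v₀′} i with ((v , a) , (v′ , a′)) , j , eq ←
        ∈-map⁻ (mapBoth proj₂) (subst ((to v₀ , to v₀′) ∈_) (treeEdges-mapTree proj₂ s) i)
      with k , k′ ← treeEdges-ends s j =
      subst₂ T.Adj (injective-pairs right-unique k (subst (λ b → (v₀ , b) ∈ pairs) (cong proj₁ eq)
          (to-pair v₀)))
                   (injective-pairs right-unique k′ (subst (λ b → (v₀′ , b) ∈ pairs) (cong proj₂ eq)
                       (to-pair v₀′)))
        (treeEdges-adjacent u (subst ((v , v′) ∈_) (sym (treeEdges-mapTree proj₁ s))
            (∈-map⁺ (mapBoth proj₁) j)))
    backward : ∀ v v′ → T′.Adj (to v) (to v′) → T.Adj v v′
    backward v v′ e with treeEdges-complete u′ (T′.spanning T′.connected u′ (to v)) e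
    ... | inj₂ (inj₁ i) = backwardEdge i
    ... | inj₂ (inj₂ i) = T.symmetric (backwardEdge i)

-- Centroids

match-first : ∀ {a b c d} → a ∷ b ∷ [] ~ᶠ c ∷ d ∷ [] → a ~ c → b ~ d
match-first {a} {b} p a~c with ~ₚ.Any-resp-↭ {P = b ~_} (λ e f → ~-trans f e)
    (~ₚ.drop-∷ (H.trans (H.prep (~-sym a~c) (↭⇒~ᶠ ↭-refl)) p)) (here ~-refl)
... | here b~d = b~d

pair-~ : ∀ {a b c d} → a ∷ b ∷ [] ~ᶠ c ∷ d ∷ [] → (a ~ c × b ~ d) ⊎ (a ~ d × b ~ c)
pair-~ {a} p with ~ₚ.Any-resp-↭ {P = a ~_} (λ e f → ~-trans f e) p (here ~-refl)
... | here a~c         = inj₁ (a~c , match-first p a~c)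
... | there (here a~d) = inj₂ (a~d , match-first (H.trans p (H.swap ~-refl ~-refl (H.refl []))) a~d)

graft : ∀ {k l t u ts us} → t ~ u → node k ts ~ node l us → node k (t ∷ ts) ~ node l (u ∷ us)
graft e (node p) = node (H.prep e p)

2*⌊n/2⌋≤n : ∀ n → 2 * ⌊ n /2⌋ ≤ n
2*⌊n/2⌋≤n n = subst₂ _≤_ (cong (⌊ n /2⌋ +_) (sym (ℕ.+-identityʳ _))) (ℕ.⌊n/2⌋+⌈n/2⌉≡n n)
    (ℕ.+-monoʳ-≤ ⌊ n /2⌋ (ℕ.⌊n/2⌋≤⌈n/2⌉ n))

2*m≤n⇒m≤⌊n/2⌋ : ∀ {m n} → 2 * m ≤ n → m ≤ ⌊ n /2⌋
2*m≤n⇒m≤⌊n/2⌋ {m} {n} le = subst (_≤ ⌊ n /2⌋) (sym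
    (trans (ℕ.n≡⌊n+n/2⌋ m) (cong (λ k → ⌊ m + k /2⌋) (sym (ℕ.+-identityʳ m))))) (ℕ.⌊n/2⌋-mono le)

module Centroid (T : WeightedTree) where
  open TreeFacts T

  -- Only the edge between `v` and `u` changes direction: `v` loses the child `u` and becomes its
  -- child, so both keep the same neighbours.
  reroot : ∀ {v u ts us} → Unfolding Adj nothing (node v (node u us ∷ ts)) →
      Unfolding Adj nothing (node u (node v ts ∷ us))
  reroot {v} {u} {ts} {us} (node (fresh ∷ uniq) sound complete (node uniq′ sound′ complete′ us-unf ∷ ts-unf)) =
    node (All.map⁺ (All.tabulate (λ i e → proj₂ (sound′ i) (cong just (sym e)))) ∷ uniq′) outer-sound
        outer-complete (back ∷ us-unf)
    where
    back : Unfolding Adj (just u) (node v ts)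
    back = node uniq (λ i → proj₁ (sound (there i)) , λ { refl → All.lookup fresh (∈-map⁺ label i) refl })
      (λ a ne → case complete a (λ ()) of λ { (here refl) → contradiction refl ne ; (there j) → j }) ts-unf
    outer-sound : ∀ {t} → t ∈ node v ts ∷ us → Adj u (label t) × just (label t) ≢ nothing
    outer-sound (here refl) = symmetric (proj₁ (sound (here refl))) , λ ()
    outer-sound (there i)   = proj₁ (sound′ i) , λ ()
    outer-complete : ∀ {y} → Adj u y → just y ≢ nothing → y ∈ v ∷ map label us
    outer-complete {y} a _ with y Fin.≟ v
    ... | yes eq = here eq
    ... | no ne  = there (complete′ a (λ { refl → ne refl }))

  total-weight : ∀ {t} → Unfolding Adj nothing t → weight (flatten t) ≡ totalWeight
  total-weight u = ℕ.sum-↭ (↭ₚ.map⁺ w (unfolding-covers u))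

  two-sides : ∀ {v t ts} → Unfolding Adj nothing (node v (t ∷ ts)) →
      weight (flatten t) + weight (flatten (node v ts)) ≡ totalWeight
  two-sides {v} {t} {ts} u = trans (sym (trans (ℕ.sum-↭
      (↭ₚ.map⁺ w (↭-sym (↭ₚ.shift v (flatten t) (flattenᶠ ts)))))
    (trans (cong sum (map-++ w (flatten t) _)) (ℕ.sum-++ (map w (flatten t)) _)))) (total-weight u)

  -- A halving edge is kept apart, since rooting at either of its ends leaves a branch that is not
  -- below half.
  data Centre : Set where
    atVertex : ∀ v ts → Unfolding Adj nothing (node v ts) →
        All (λ t → Small totalWeight (weight (flatten t))) ts → Centre
    atEdge   : ∀ v u ts us → Unfolding Adj nothing (node v (node u us ∷ ts)) →
        2 * weight (flatten (node u us)) ≡ totalWeight → Centre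

  -- A branch with more than half of the weight leaves less than half on the other side.
  search : ∀ smalls v ts → Unfolding Adj nothing (node v (smalls ++ ts)) →
      All (λ t → Small totalWeight (weight (flatten t))) smalls → Centre
  search smalls v [] unf small = atVertex v smalls (subst (λ ts → Unfolding Adj nothing (node v ts))
      (++-identityʳ smalls) unf) small
  search smalls v (node u us ∷ ts) unf small
    with unf′ ← reorder-children (↭ₚ.shift (node u us) smalls ts) unf
    with ℕ.<-cmp (2 * weight (flatten (node u us))) totalWeight
  ... | tri< lt _ _ = search (node u us ∷ smalls) v ts unf′ (lt ∷ small)
  ... | tri≈ _ eq _ = atEdge v u (smalls ++ ts) us unf′ eq
  -- The recursion passes to the smaller list `us`; the side left behind is already among the small
  -- branches and is never entered again.
  ... | tri> _ _ gt = search [ node v (smalls ++ ts) ] u us (reroot unf′) (back-small ∷ [])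
    where
    back-small : Small totalWeight (weight (flatten (node v (smalls ++ ts))))
    back-small = ℕ.≰⇒> λ le → ℕ.<-irrefl (trans (cong₂ _+_ (sym (two-sides unf′)) (sym (two-sides unf′)))
        (lemma (weight (flatten (node u us))) _)) (ℕ.+-mono-<-≤ gt le)
      where
      open +-*-Solver
      lemma : ∀ a b → a + b + (a + b) ≡ 2 * a + 2 * b
      lemma = solve 2 (λ a b → a :+ b :+ (a :+ b) := con 2 :* a :+ con 2 :* b) refl

  centre : Centre
  centre = start (unfoldAt v₀) (unfoldAt-unfolding v₀)
    where
    v₀ : V
    v₀ = Fin.fromℕ< nonempty
    start : ∀ t → Unfolding Adj nothing t → Centre
    start (node v ts) u = search [] v ts u []

  centreTree : Centre → Tree V
  centreTree (atVertex v ts _ _)   = node v ts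
  centreTree (atEdge v u ts us _ _) = node v (node u us ∷ ts)

  centreForest : Centre → List (Tree V)
  centreForest (atVertex v ts _ _)   = ts
  centreForest (atEdge v u ts us _ _) = node u us ∷ node v ts ∷ []

  centreTree-unfolding : ∀ c → Unfolding Adj nothing (centreTree c)
  centreTree-unfolding (atVertex _ _ u _)   = u
  centreTree-unfolding (atEdge _ _ _ _ u _) = u

  other-half : ∀ {v t ts} → Unfolding Adj nothing (node v (t ∷ ts)) → 2 * weight (flatten t) ≡ totalWeight →
               weight (flatten (node v ts)) ≡ weight (flatten t)
  other-half {v} {t} unf eq = ℕ.+-cancelˡ-≡ (weight (flatten t)) _ _
    (trans (two-sides unf) (trans (sym eq) (cong (weight (flatten t) +_) (ℕ.+-identityʳ _))))

  centreForest-branches : ∀ c → All Branch (centreForest c)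
  centreForest-branches (atVertex v ts (node _ sound _ us) small) = All.tabulate λ i →
    branch (All.lookup us i) (proj₁ (sound i)) (ℕ.<⇒≤ (All.lookup small i))
  centreForest-branches (atEdge v u ts us unf eq) with unf | reroot unf
  ... | node _ sound _ (u-unf ∷ _) | node _ sound′ _ (v-unf ∷ _) =
    branch u-unf (proj₁ (sound (here refl))) (ℕ.≤-reflexive eq) ∷
    branch v-unf (proj₁ (sound′ (here refl))) (ℕ.≤-reflexive (trans (cong (2 *_) (other-half unf eq)) eq)) ∷ []

  branch-bound : ∀ {t} → Branch t → treeWeight (mapTree ω t) ≤ ⌊ totalWeight /2⌋
  branch-bound {t} b = subst (_≤ ⌊ totalWeight /2⌋) (sym (treeWeight-mapTree t)) (2*m≤n⇒m≤⌊n/2⌋ (Branch.half b))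

  centre-rests : ∀ c → concatMap rests (whole (mapTree ω (centreTree c))) ≈[ ⌊ totalWeight /2⌋ ] restᶠ
      (mapTrees ω (centreForest c))
  centre-rests (atVertex v ts unf small) = vertex-rests (mapTree ω (node v ts))
      (trans (treeWeight-mapTree (node v ts)) (total-weight unf)) (2*⌊n/2⌋≤n totalWeight)
    (subst (All _) (sym (mapTrees-map ω ts)) (All.map⁺
        (All.map (λ {t} → subst (Small totalWeight) (sym (treeWeight-mapTree t))) small)))
  centre-rests (atEdge v u ts us unf eq) = edge-rests (ω v) (mapTree ω (node u us)) (mapTrees ω ts)
    (trans (treeWeight-mapTree (node u us)) half)
    (trans (treeWeight-mapTree (node v ts)) (trans (other-half unf eq) half))
    where
    half : weight (flatten (node u us)) ≡ ⌊ totalWeight /2⌋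
    half = trans (ℕ.n≡⌊n+n/2⌋ _) (cong ⌊_/2⌋ (trans (cong (weight (flatten (node u us)) +_)
        (sym (ℕ.+-identityʳ _))) eq))

  IsBranch : Pred (Tree ℕ) 0ℓ
  IsBranch s = ∃ λ t → mapTree ω t ≡ s × Branch t

  map-branches : ∀ {ts} → All Branch ts → All IsBranch (mapTrees ω ts)
  map-branches []               = []
  map-branches {t ∷ ts} (b ∷ bs) = (t , refl , b) ∷ map-branches bs

  IsBranch-hereditary : Hereditary IsBranch
  IsBranch-hereditary (node v ts , refl , b) = map-branches (branch-children b)

  map-bounds : ∀ {ts} → All Branch ts → All (λ t → treeWeight t ≤ ⌊ totalWeight /2⌋) (mapTrees ω ts)
  map-bounds []       = []
  map-bounds (b ∷ bs) = branch-bound b ∷ map-bounds bs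

-- Comparing two trees with the same W-polynomial

module _ (T T′ : WeightedTree) where
  private
    module T  = TreeFacts T
    module T′ = TreeFacts T′
    module C  = Centroid T
    module C′ = Centroid T′

  Similar : Set
  Similar = ∃ λ t → ∃ λ t′ → Unfolding T.Adj nothing t × Unfolding T′.Adj nothing t′ × mapTree T.ω t ~ mapTree
      T′.ω t′

  vertex-weight : ∀ k ts → treeWeight (node k ts) ≡ sum (weightsᶠ ts) → ⊥
  vertex-weight k ts e = ℕ.<-irrefl (sym e) (s≤s (ℕ.m≤n+m _ k))

  edge-weight : ∀ k u ts → treeWeight (node k (u ∷ ts)) ≡ sum (weightsᶠ (u ∷ node k ts ∷ []))
  edge-weight k u ts = ℕ.sum-↭ (subst (λ m → suc k ∷ weights u ++ weightsᶠ ts ↭ weights u ++ m)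
      (sym (++-identityʳ _)) (↭-sym (↭ₚ.shift (suc k) (weights u) (weightsᶠ ts))))

  -- At a vertex the forest lacks the weight of the root, at an edge it has all of the weight. So
  -- similar forests with equal totals rule out the mixed cases.
  similar : T.totalWeight ≡ T′.totalWeight → ∀ c c′ →
      mapTrees T.ω (C.centreForest c) ~ᶠ mapTrees T′.ω (C′.centreForest c′) → Similar
  similar same c c′ p = go c c′ p (trans (trans (T.treeWeight-mapTree (C.centreTree c))
      (C.total-weight (C.centreTree-unfolding c))) (trans same
      (sym (trans (T′.treeWeight-mapTree (C′.centreTree c′)) (C′.total-weight (C′.centreTree-unfolding c′))))))
    where
    go : ∀ c c′ → mapTrees T.ω (C.centreForest c) ~ᶠ mapTrees T′.ω (C′.centreForest c′) →
         treeWeight (mapTree T.ω (C.centreTree c)) ≡ treeWeight (mapTree T′.ω (C′.centreTree c′)) → Similar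
    go (C.atVertex v ts unf _) (C′.atVertex v′ ts′ unf′ _) p e = _ , _ , unf , unf′ ,
      subst (λ k → node (T.ω v) (mapTrees T.ω ts) ~ node k (mapTrees T′.ω ts′))
        -- The weight of the centre is what the forests leave of the common total.
        (ℕ.+-cancelʳ-≡ (sum (weightsᶠ (mapTrees T′.ω ts′))) _ _
            (trans (cong (T.ω v +_) (sym (ℕ.sum-↭ (weightsᶠ-~ p)))) (ℕ.suc-injective e))) (node p)
    go (C.atVertex v ts _ _) (C′.atEdge v′ u′ ts′ us′ _ _) p e =
      ⊥-elim (vertex-weight (T.ω v) (mapTrees T.ω ts)
          (trans e (trans (edge-weight (T′.ω v′) (mapTree T′.ω (node u′ us′)) (mapTrees T′.ω ts′))
            (sym (ℕ.sum-↭ (weightsᶠ-~ p))))))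
    go (C.atEdge v u ts us _ _) (C′.atVertex v′ ts′ _ _) p e =
      ⊥-elim (vertex-weight (T′.ω v′) (mapTrees T′.ω ts′)
          (trans (sym e) (trans (edge-weight (T.ω v) (mapTree T.ω (node u us)) (mapTrees T.ω ts))
            (ℕ.sum-↭ (weightsᶠ-~ p)))))
    go (C.atEdge v u ts us unf _) (C′.atEdge v′ u′ ts′ us′ unf′ _) p e with pair-~ p
    ... | inj₁ (r , s) = _ , _ , unf , unf′ , graft r s
    -- The halves correspond crosswise, so the second tree is rooted at the other end of its edge.
    ... | inj₂ (r , s) = _ , _ , unf , C′.reroot unf′ , graft r s

  module _ (W≈W′ : W T.weightedGraph ≈ₚ W T′.weightedGraph) where

    wholes-equal : whole (mapTree T.ω (C.centreTree C.centre)) ≈ whole (mapTree T′.ω (C′.centreTree C′.centre))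
    wholes-equal ν = ℤ.+-injective (trans (sym (WTerms.W-coefficient T (C.centreTree-unfolding C.centre) ν))
      (trans (W≈W′ (map x ν)) (WTerms.W-coefficient T′ (C′.centreTree-unfolding C′.centre) ν)))

    -- The multiset of all vertex weights of `T` is one of the partitions counted for `T′`, and
    -- those all have the total weight of `T′` as their sum.
    weights-equal : T.totalWeight ≡ T′.totalWeight
    weights-equal with m , i , p ← positive-count (whole (mapTree T′.ω (C′.centreTree C′.centre)))
                         (subst (0 <_) (wholes-equal _) (count-positive
                             (weights∈whole (mapTree T.ω (C.centreTree C.centre))))) = trans
      (sym (trans (T.treeWeight-mapTree (C.centreTree C.centre))
          (C.total-weight (C.centreTree-unfolding C.centre))))
      (trans (sym (ℕ.sum-↭ p)) (trans (All.lookup (whole-homogeneous (mapTree T′.ω (C′.centreTree C′.centre)))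
          i)
      (trans (T′.treeWeight-mapTree (C′.centreTree C′.centre))
          (C′.total-weight (C′.centreTree-unfolding C′.centre)))))

    forests-equal : restᶠ (mapTrees T.ω (C.centreForest C.centre)) ≈[ ⌊ T.totalWeight /2⌋ ] restᶠ
        (mapTrees T′.ω (C′.centreForest C′.centre))
    forests-equal = ≈-trans (≈-sym (C.centre-rests C.centre)) (≈-trans
      (≈⇒≈[] (concatMap-≈ rests (λ p → ≈[]⇒≈ (rests-↭ p)) {whole (mapTree T.ω (C.centreTree C.centre))}
          {whole (mapTree T′.ω (C′.centreTree C′.centre))} wholes-equal))
      (≈-weaken (ℕ.≤-reflexive (cong ⌊_/2⌋ weights-equal)) (C′.centre-rests C′.centre)))

theorem1 : ∀ {ℓ : Level} (𝒯 : Pred WeightedTree ℓ) → Good 𝒯 →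
    ∀ (T T′ : WeightedTree) → 𝒯 T → 𝒯 T′ →
    W (WeightedTree.weightedGraph T) ≈ₚ W (WeightedTree.weightedGraph T′) →
    WeightedTree.weightedGraph T ≅ WeightedTree.weightedGraph T′
theorem1 𝒯 good T T′ T∈𝒯 T′∈𝒯 W≈W′ =
  let (_ , _ , unf , unf′ , sim) = similar T T′ (weights-equal T T′ W≈W′) C.centre C′.centre forests in ~⇒≅ T T′
      unf unf′ sim
  where
  module T  = TreeFacts T
  module T′ = TreeFacts T′
  module C  = Centroid T
  module C′ = Centroid T′
  determined : ∀ {s s′} → C.IsBranch s → C′.IsBranch s′ → weights s ↭ weights s′ → s ~ s′
  determined (t , refl , b) (t′ , refl , b′) p = branch-determined T T′
    (λ v leaf → Good.unit-weights good T∈𝒯 v (inj₁ leaf)) (λ v leaf → Good.unit-weights good T′∈𝒯 v (inj₁ leaf))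
    (Good.shapes-determined good T∈𝒯 T′∈𝒯) b b′
    (subst₂ _↭_ (T.weights-mapTree t) (T′.weights-mapTree t′) p)
  forests : mapTrees T.ω (C.centreForest C.centre) ~ᶠ mapTrees T′.ω (C′.centreForest C′.centre)
  forests = restᶠ-injective C.IsBranch-hereditary C′.IsBranch-hereditary determined ⌊ T.totalWeight /2⌋
    (C.map-branches (C.centreForest-branches C.centre)) (C′.map-branches (C′.centreForest-branches C′.centre))
    (C.map-bounds (C.centreForest-branches C.centre))
    (subst (λ d → All (λ t → treeWeight t ≤ d) _) (cong ⌊_/2⌋ (sym (weights-equal T T′ W≈W′)))
        (C′.map-bounds (C′.centreForest-branches C′.centre)))
    (forests-equal T T′ W≈W′)
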